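{- For $n \in \mathbb{N} = \{1,2,3,\ldots\}$ let $x_n := \left\{ \frac{\log(2n-1)}{\log(2)} \right\}$, and for $N\in\mathbb{N}$ and $s \ge 0$ let $$F_{N}(s) := \frac{1}{N} \# \left\{ (k,l) \ : \ 1 \leq k, l \leq N,\ k \neq l,\ \left\| x_k - x_l\right\| \leq \frac{s}{N} \right\}.$$ Then for every $s \ge 0$ the limit $F(s) := \lim_{N \to \infty} F_N(s)$ exists and is given by $$F(s) = \begin{cases} 0 & \text{if } 0 \leq s < \frac{1}{\log(4)},\\[4pt] 3k - \dfrac{3k^2+2k}{4\log(2)s} & \text{if } \frac{k}{\log(4)} \leq s < \frac{k+1}{\log(4)},\ k \in \mathbb{N} \text{ even},\\[8pt] 3k + 1 - \dfrac{3k^2+4k+1}{4\log(2)s} & \text{if } \frac{k}{\log(4)} \leq s < \frac{k+1}{\log(4)},\ k \in \mathbb{N} \text{ odd}.\end{cases}$$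
   Context: Here $\log$ is the natural logarithm, $\{\cdot\}$ denotes the fractional part of a real number, $\|\cdot\|$ denotes the distance of a real number from its nearest integer, and $\mathbb{N}$ denotes the positive integers. -}

module Defs where

open import Axiom.ExcludedMiddle using (ExcludedMiddle)
open import Data.Integer using (ℤ; +_; -[1+_]; 1ℤ)
import Data.Integer as ℤ
import Data.Integer.Properties as ℤP
open import Data.List using (List; map; filter; length; upTo; cartesianProduct)
open import Data.Nat using (ℕ; zero; suc; _∸_)
import Data.Nat as ℕ
import Data.Nat.Properties as ℕP
open import Data.Product using (∃; _×_; _,_; proj₁; proj₂)
open import Data.Rational using (ℚ; 0ℚ; 1ℚ; ½; mkℚ)
import Data.Rational as ℚ
import Data.Rational.Properties as ℚP
import Data.Rational.Unnormalised as ℚᵘ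
import Data.Rational.Unnormalised.Properties as ℚᵘP
open import Data.Rational.Solver using (module +-*-Solver)
open import Data.Sum using (inj₁; inj₂; [_,_]′)
open import Level using (0ℓ)
open import Relation.Binary.PropositionalEquality
open import Relation.Nullary using (¬_; Dec; yes; no; contradiction)

module Rational where

  open ℚP.≤-Reasoning
  open +-*-Solver using (solve; _:+_; _:*_; _:-_; :-_; _:=_; con)

  private
    variable
      a b p q r δ ε : ℚ

  ∣p-q∣≡∣q-p∣ : ∀ p q → ℚ.∣ p ℚ.- q ∣ ≡ ℚ.∣ q ℚ.- p ∣
  ∣p-q∣≡∣q-p∣ p q = trans
    (cong ℚ.∣_∣ (solve 2 (λ p q → p :- q := :- (q :- p)) refl p q))
    (ℚP.∣-p∣≡∣p∣ (q ℚ.- p))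

  p≤∣p∣ : ∀ p → p ℚ.≤ ℚ.∣ p ∣
  p≤∣p∣ p with ℚP.≤-total 0ℚ p
  ... | inj₁ 0≤p = ℚP.≤-reflexive (sym (ℚP.0≤p⇒∣p∣≡p 0≤p))
  ... | inj₂ p≤0 = ℚP.≤-trans p≤0 (ℚP.0≤∣p∣ p)

  ∣p∣≤ : p ℚ.≤ a → ℚ.- p ℚ.≤ a → ℚ.∣ p ∣ ℚ.≤ a
  ∣p∣≤ {p} {a} p≤a -p≤a = [ (λ e → subst (ℚ._≤ a) (sym e) p≤a) , (λ e → subst (ℚ._≤ a) (sym e) -p≤a) ]′
                     (ℚP.∣p∣≡p∨∣p∣≡-p p)

  ∣p-q∣≤ : p ℚ.≤ q ℚ.+ a → q ℚ.≤ p ℚ.+ a → ℚ.∣ p ℚ.- q ∣ ℚ.≤ a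
  ∣p-q∣≤ {p} {q} {a} h k = ∣p∣≤
    (begin
      p ℚ.- q           ≤⟨ ℚP.+-monoˡ-≤ (ℚ.- q) h ⟩
      q ℚ.+ a ℚ.- q     ≡⟨ solve 2 (λ q a → q :+ a :- q := a) refl q a ⟩
      a                 ∎)
    (begin
      ℚ.- (p ℚ.- q)     ≡⟨ solve 2 (λ p q → :- (p :- q) := q :- p) refl p q ⟩
      q ℚ.- p           ≤⟨ ℚP.+-monoˡ-≤ (ℚ.- p) k ⟩
      p ℚ.+ a ℚ.- p     ≡⟨ solve 2 (λ p a → p :+ a :- p := a) refl p a ⟩
      a                 ∎)

  ∣p∣≤∣q∣+∣p-q∣ : ∀ p q → ℚ.∣ p ∣ ℚ.≤ ℚ.∣ q ∣ ℚ.+ ℚ.∣ p ℚ.- q ∣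
  ∣p∣≤∣q∣+∣p-q∣ p q = begin
    ℚ.∣ p ∣                      ≡⟨ cong ℚ.∣_∣ (solve 2 (λ p q → p := q :+ (p :- q)) refl p q) ⟩
    ℚ.∣ q ℚ.+ (p ℚ.- q) ∣        ≤⟨ ℚP.∣p+q∣≤∣p∣+∣q∣ q (p ℚ.- q) ⟩
    ℚ.∣ q ∣ ℚ.+ ℚ.∣ p ℚ.- q ∣    ∎

  ∣∣p∣-∣q∣∣≤∣p-q∣ : ∀ p q → ℚ.∣ ℚ.∣ p ∣ ℚ.- ℚ.∣ q ∣ ∣ ℚ.≤ ℚ.∣ p ℚ.- q ∣
  ∣∣p∣-∣q∣∣≤∣p-q∣ p q = ∣p-q∣≤ (∣p∣≤∣q∣+∣p-q∣ p q)
    (subst (λ d → ℚ.∣ q ∣ ℚ.≤ ℚ.∣ p ∣ ℚ.+ d) (∣p-q∣≡∣q-p∣ q p) (∣p∣≤∣q∣+∣p-q∣ q p))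

  ∣-p+q∣≡∣p-q∣ : ∀ p q → ℚ.∣ ℚ.- p ℚ.- ℚ.- q ∣ ≡ ℚ.∣ p ℚ.- q ∣
  ∣-p+q∣≡∣p-q∣ p q = trans
    (cong ℚ.∣_∣ (solve 2 (λ p q → :- p :- (:- q) := q :- p) refl p q)) (∣p-q∣≡∣q-p∣ q p)

  ½ε+½ε≡ε : ∀ ε → ½ ℚ.* ε ℚ.+ ½ ℚ.* ε ≡ ε
  ½ε+½ε≡ε = solve 1 (λ e → con ½ :* e :+ con ½ :* e := e) refl

  *-pos : 0ℚ ℚ.< p → 0ℚ ℚ.< q → 0ℚ ℚ.< p ℚ.* q
  *-pos {p} {q} 0<p 0<q = ℚP.positive⁻¹ (p ℚ.* q)
    {{ℚP.pos*pos⇒pos p {{ℚ.positive 0<p}} q {{ℚ.positive 0<q}}}}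

  ½-pos : 0ℚ ℚ.< ε → 0ℚ ℚ.< ½ ℚ.* ε
  ½-pos = *-pos (ℚP.positive⁻¹ ½)

  *-mono-≤-∣∣ : ∀ p q → ℚ.∣ p ∣ ℚ.≤ a → ℚ.∣ q ∣ ℚ.≤ b → ℚ.∣ p ℚ.* q ∣ ℚ.≤ a ℚ.* b
  *-mono-≤-∣∣ {a} {b} p q h k = begin
    ℚ.∣ p ℚ.* q ∣        ≡⟨ ℚP.∣p*q∣≡∣p∣*∣q∣ p q ⟩
    ℚ.∣ p ∣ ℚ.* ℚ.∣ q ∣  ≤⟨ ℚP.*-monoˡ-≤-nonNeg ℚ.∣ p ∣ {{ℚP.∣-∣-nonNeg p}} k ⟩
    ℚ.∣ p ∣ ℚ.* b        ≤⟨ ℚP.*-monoʳ-≤-nonNeg b {{ℚ.nonNegative (ℚP.≤-trans (ℚP.0≤∣p∣ q) k)}} h ⟩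
    a ℚ.* b              ∎

  -- The reciprocal, extended by 0 at 0.
  recip : ℚ → ℚ
  recip p with p ℚP.≟ 0ℚ
  ... | yes _  = 0ℚ
  ... | no p≢0 = (ℚ.1/ p) {{ℚ.≢-nonZero p≢0}}

  recip-inverse : p ≢ 0ℚ → p ℚ.* recip p ≡ 1ℚ
  recip-inverse {p} p≢0 with p ℚP.≟ 0ℚ
  ... | yes p≡0 = contradiction p≡0 p≢0
  ... | no p≢0′ = ℚP.*-inverseʳ p {{ℚ.≢-nonZero p≢0′}}

  <⇒≢0 : 0ℚ ℚ.< p → p ≢ 0ℚ
  <⇒≢0 0<p p≡0 = ℚP.<⇒≢ 0<p (sym p≡0)

  recip-pos : 0ℚ ℚ.< p → 0ℚ ℚ.< recip p
  recip-pos {p} 0<p with p ℚP.≟ 0ℚ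
  ... | yes p≡0 = contradiction p≡0 (<⇒≢0 0<p)
  ... | no p≢0  = ℚP.positive⁻¹ _ {{ℚP.1/pos⇒pos p {{ℚ.positive 0<p}}}}

  apart⇒≢0 : 0ℚ ℚ.< δ → δ ℚ.≤ ℚ.∣ p ∣ → p ≢ 0ℚ
  apart⇒≢0 0<δ δ≤∣p∣ refl = ℚP.<-irrefl refl (ℚP.<-≤-trans 0<δ δ≤∣p∣)

  ∣recip∣≤ : ∀ p → 0ℚ ℚ.< δ → δ ℚ.≤ ℚ.∣ p ∣ → ℚ.∣ recip p ∣ ℚ.≤ recip δ
  ∣recip∣≤ {δ} p 0<δ δ≤∣p∣ = ℚP.*-cancelˡ-≤-pos δ {{ℚ.positive 0<δ}} (begin
    δ ℚ.* ℚ.∣ recip p ∣          ≤⟨ ℚP.*-monoʳ-≤-nonNeg ℚ.∣ recip p ∣ {{ℚP.∣-∣-nonNeg (recip p)}} δ≤∣p∣ ⟩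
    ℚ.∣ p ∣ ℚ.* ℚ.∣ recip p ∣    ≡⟨ ℚP.∣p*q∣≡∣p∣*∣q∣ p (recip p) ⟨
    ℚ.∣ p ℚ.* recip p ∣          ≡⟨ cong ℚ.∣_∣ (recip-inverse (apart⇒≢0 0<δ δ≤∣p∣)) ⟩
    1ℚ                           ≡⟨ recip-inverse (<⇒≢0 0<δ) ⟨
    δ ℚ.* recip δ                ∎)

  recip-close : ∀ p q → 0ℚ ℚ.< δ → δ ℚ.≤ ℚ.∣ p ∣ → δ ℚ.≤ ℚ.∣ q ∣ →
                ℚ.∣ p ℚ.- q ∣ ℚ.≤ ε ℚ.* (δ ℚ.* δ) → ℚ.∣ recip p ℚ.- recip q ∣ ℚ.≤ ε
  recip-close {δ} {ε} p q 0<δ δ≤p δ≤q h = begin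
    ℚ.∣ recip p ℚ.- recip q ∣                      ≡⟨ cong ℚ.∣_∣ difference ⟩
    ℚ.∣ (q ℚ.- p) ℚ.* (recip p ℚ.* recip q) ∣      ≤⟨ *-mono-≤-∣∣ (q ℚ.- p) (recip p ℚ.* recip q)
                                                       (subst (ℚ._≤ _) (∣p-q∣≡∣q-p∣ p q) h)
                                                       (*-mono-≤-∣∣ (recip p) (recip q)
                                                         (∣recip∣≤ p 0<δ δ≤p) (∣recip∣≤ q 0<δ δ≤q)) ⟩
    ε ℚ.* (δ ℚ.* δ) ℚ.* (recip δ ℚ.* recip δ)      ≡⟨ solve 3 (λ e d r → e :* (d :* d) :* (r :* r) := e :* ((d :* r) :* (d :* r)))
                                                       refl ε δ (recip δ) ⟩
    ε ℚ.* ((δ ℚ.* recip δ) ℚ.* (δ ℚ.* recip δ))    ≡⟨ cong (λ u → ε ℚ.* (u ℚ.* u)) (recip-inverse (<⇒≢0 0<δ)) ⟩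
    ε ℚ.* 1ℚ                                       ≡⟨ ℚP.*-identityʳ ε ⟩
    ε                                              ∎
    where
    difference : recip p ℚ.- recip q ≡ (q ℚ.- p) ℚ.* (recip p ℚ.* recip q)
    difference = begin-equality
      recip p ℚ.- recip q
        ≡⟨ solve 2 (λ r s → r :- s := con 1ℚ :* r :- con 1ℚ :* s) refl (recip p) (recip q) ⟩
      1ℚ ℚ.* recip p ℚ.- 1ℚ ℚ.* recip q
        ≡⟨ cong₂ (λ u v → u ℚ.* recip p ℚ.- v ℚ.* recip q)
             (recip-inverse (apart⇒≢0 0<δ δ≤q)) (recip-inverse (apart⇒≢0 0<δ δ≤p)) ⟨
      q ℚ.* recip q ℚ.* recip p ℚ.- p ℚ.* recip p ℚ.* recip q
        ≡⟨ solve 4 (λ p q r s → q :* s :* r :- p :* r :* s := (q :- p) :* (r :* s)) refl p q (recip p) (recip q) ⟩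
      (q ℚ.- p) ℚ.* (recip p ℚ.* recip q) ∎

  *-close : ∀ p p′ q q′ → ℚ.∣ p ∣ ℚ.≤ a → ℚ.∣ q′ ∣ ℚ.≤ b → 0ℚ ℚ.< a → 0ℚ ℚ.< b →
            ℚ.∣ q ℚ.- q′ ∣ ℚ.≤ ½ ℚ.* ε ℚ.* recip a → ℚ.∣ p ℚ.- p′ ∣ ℚ.≤ ½ ℚ.* ε ℚ.* recip b →
            ℚ.∣ p ℚ.* q ℚ.- p′ ℚ.* q′ ∣ ℚ.≤ ε
  *-close {a} {b} {ε} p p′ q q′ p≤a q′≤b 0<a 0<b h k = begin
    ℚ.∣ p ℚ.* q ℚ.- p′ ℚ.* q′ ∣
      ≡⟨ cong ℚ.∣_∣ (solve 4 (λ p p′ q q′ → p :* q :- p′ :* q′ := p :* (q :- q′) :+ q′ :* (p :- p′)) refl p p′ q q′) ⟩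
    ℚ.∣ p ℚ.* (q ℚ.- q′) ℚ.+ q′ ℚ.* (p ℚ.- p′) ∣
      ≤⟨ ℚP.∣p+q∣≤∣p∣+∣q∣ (p ℚ.* (q ℚ.- q′)) (q′ ℚ.* (p ℚ.- p′)) ⟩
    ℚ.∣ p ℚ.* (q ℚ.- q′) ∣ ℚ.+ ℚ.∣ q′ ℚ.* (p ℚ.- p′) ∣
      ≤⟨ ℚP.+-mono-≤ (*-mono-≤-∣∣ p (q ℚ.- q′) p≤a h) (*-mono-≤-∣∣ q′ (p ℚ.- p′) q′≤b k) ⟩
    a ℚ.* (½ ℚ.* ε ℚ.* recip a) ℚ.+ b ℚ.* (½ ℚ.* ε ℚ.* recip b)
      ≡⟨ solve 5 (λ a b e r s → a :* (e :* r) :+ b :* (e :* s) := e :* (a :* r) :+ e :* (b :* s))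
           refl a b (½ ℚ.* ε) (recip a) (recip b) ⟩
    ½ ℚ.* ε ℚ.* (a ℚ.* recip a) ℚ.+ ½ ℚ.* ε ℚ.* (b ℚ.* recip b)
      ≡⟨ cong₂ (λ u v → ½ ℚ.* ε ℚ.* u ℚ.+ ½ ℚ.* ε ℚ.* v) (recip-inverse (<⇒≢0 0<a)) (recip-inverse (<⇒≢0 0<b)) ⟩
    ½ ℚ.* ε ℚ.* 1ℚ ℚ.+ ½ ℚ.* ε ℚ.* 1ℚ
      ≡⟨ solve 1 (λ e → con ½ :* e :* con 1ℚ :+ con ½ :* e :* con 1ℚ := e) refl ε ⟩
    ε ∎

  /-monoˡ-≤ : ∀ {i j} d .{{_ : ℕ.NonZero d}} → i ℤ.≤ j → i ℚ./ d ℚ.≤ j ℚ./ d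
  /-monoˡ-≤ {i} {j} (suc d) i≤j = ℚP.toℚᵘ-cancel-≤ (ℚᵘP.≤-respˡ-≃ (ℚᵘP.≃-sym (ℚP.toℚᵘ-fromℚᵘ (ℚᵘ.mkℚᵘ i d)))
    (ℚᵘP.≤-respʳ-≃ (ℚᵘP.≃-sym (ℚP.toℚᵘ-fromℚᵘ (ℚᵘ.mkℚᵘ j d))) (ℚᵘ.*≤* (ℤP.*-monoʳ-≤-nonNeg (+ suc d) i≤j))))

  1/sucn>0 : ∀ n → 0ℚ ℚ.< + 1 ℚ./ suc n
  1/sucn>0 n = ℚP.positive⁻¹ _ {{ℚP.normalize-pos 1 (suc n)}}

  1/-antimono : ∀ {m n} → m ℕ.≤ n → + 1 ℚ./ suc n ℚ.≤ + 1 ℚ./ suc m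
  1/-antimono {m} {n} m≤n = ℚP.toℚᵘ-cancel-≤
    (ℚᵘP.≤-respˡ-≃ (ℚᵘP.≃-sym (ℚP.toℚᵘ-fromℚᵘ (ℚᵘ.mkℚᵘ (+ 1) n)))
    (ℚᵘP.≤-respʳ-≃ (ℚᵘP.≃-sym (ℚP.toℚᵘ-fromℚᵘ (ℚᵘ.mkℚᵘ (+ 1) m)))
    (ℚᵘ.*≤* (ℤP.*-monoˡ-≤-nonNeg (+ 1) (ℤ.+≤+ (ℕ.s≤s m≤n))))))

  n*1/mn≡1/m : ∀ m n → + suc n ℚ./ 1 ℚ.* (+ 1 ℚ./ suc (n ℕ.+ m ℕ.* suc n)) ≡ + 1 ℚ./ suc m
  n*1/mn≡1/m m n = ℚP.toℚᵘ-injective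
    (ℚᵘP.≃-trans (ℚP.toℚᵘ-homo-* (+ suc n ℚ./ 1) (+ 1 ℚ./ suc (n ℕ.+ m ℕ.* suc n)))
    (ℚᵘP.≃-trans (ℚᵘP.*-cong (ℚP.toℚᵘ-fromℚᵘ (ℚᵘ.mkℚᵘ (+ suc n) 0)) (ℚP.toℚᵘ-fromℚᵘ (ℚᵘ.mkℚᵘ (+ 1) (n ℕ.+ m ℕ.* suc n))))
    (ℚᵘP.≃-trans (ℚᵘ.*≡* (cong +_ cross)) (ℚᵘP.≃-sym (ℚP.toℚᵘ-fromℚᵘ (ℚᵘ.mkℚᵘ (+ 1) m))))))
    where
    cross : suc n ℕ.* 1 ℕ.* suc m ≡ 1 ℕ.* (1 ℕ.* (suc m ℕ.* suc n))
    cross = trans (cong (ℕ._* suc m) (ℕP.*-identityʳ (suc n)))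
           (trans (ℕP.*-comm (suc n) (suc m))
           (trans (sym (ℕP.*-identityˡ _)) (sym (ℕP.*-identityˡ _))))

  archimedean : 0ℚ ℚ.< ε → ∃ λ N → + 1 ℚ./ suc N ℚ.≤ ε
  archimedean {mkℚ (+ suc n) d c} _ = d , subst (+ 1 ℚ./ suc d ℚ.≤_) (ℚP.↥p/↧p≡p (mkℚ (+ suc n) d c))
    (/-monoˡ-≤ {+ 1} {+ suc n} (suc d) (ℤ.+≤+ (ℕ.s≤s ℕ.z≤n)))
  archimedean {mkℚ (+ zero) d c}  0<ε = contradiction (ℚP.drop-*<* 0<ε) λ { (ℤ.+<+ ()) }
  archimedean {mkℚ -[1+ n ] d c} 0<ε = contradiction (ℚP.drop-*<* 0<ε) λ ()

  ≤∣↥∣ : ∀ p → p ℚ.≤ + ℤ.∣ ℚ.numerator p ∣ ℚ./ 1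
  ≤∣↥∣ p@(mkℚ i d c) = ℚP.toℚᵘ-cancel-≤ (ℚᵘP.≤-respʳ-≃
    (ℚᵘP.≃-sym (ℚP.toℚᵘ-fromℚᵘ (ℚᵘ.mkℚᵘ (+ ℤ.∣ i ∣) 0)))
    (ℚᵘ.*≤* (bound i)))
    where
    bound : ∀ i → i ℤ.* + 1 ℤ.≤ + ℤ.∣ i ∣ ℤ.* + suc d
    bound i = ℤP.≤-trans (subst (ℤ._≤ + ℤ.∣ i ∣) (sym (ℤP.*-identityʳ i)) (i≤∣i∣ i))
                 (subst (+ ℤ.∣ i ∣ ℤ.≤_) (ℤP.pos-* ℤ.∣ i ∣ (suc d)) (ℤ.+≤+ (ℕP.m≤m*n ℤ.∣ i ∣ (suc d))))
      where
      i≤∣i∣ : ∀ i → i ℤ.≤ + ℤ.∣ i ∣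
      i≤∣i∣ (+ n)    = ℤP.≤-refl
      i≤∣i∣ -[1+ n ] = ℤ.-≤+

  -- harmonic a n = 1/(a+1) + 1/(a+2) + … + 1/(a+n)
  harmonic : ℕ → ℕ → ℚ
  harmonic a zero    = 0ℚ
  harmonic a (suc n) = + 1 ℚ./ suc a ℚ.+ harmonic (suc a) n

  harmonic-+ : ∀ a m n → harmonic a (m ℕ.+ n) ≡ harmonic a m ℚ.+ harmonic (m ℕ.+ a) n
  harmonic-+ a zero    n = sym (ℚP.+-identityˡ _)
  harmonic-+ a (suc m) n = trans
    (cong (+ 1 ℚ./ suc a ℚ.+_) (trans (harmonic-+ (suc a) m n)
      (cong (λ b → harmonic (suc a) m ℚ.+ harmonic b n) (ℕP.+-suc m a))))
    (sym (ℚP.+-assoc (+ 1 ℚ./ suc a) (harmonic (suc a) m) _))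

  suc/1 : ∀ n → + suc n ℚ./ 1 ≡ 1ℚ ℚ.+ + n ℚ./ 1
  suc/1 n = ℚP.toℚᵘ-injective
    (ℚᵘP.≃-trans (ℚP.toℚᵘ-fromℚᵘ (ℚᵘ.mkℚᵘ (+ suc n) 0))
    (ℚᵘP.≃-trans (ℚᵘ.*≡* (cong (ℤ._* + 1) (sym (cong (λ z → 1ℤ ℤ.+ z) (ℤP.*-identityʳ (+ n))))))
    (ℚᵘP.≃-trans (ℚᵘP.+-congʳ (ℚᵘ.mkℚᵘ (+ 1) 0) (ℚᵘP.≃-sym (ℚP.toℚᵘ-fromℚᵘ (ℚᵘ.mkℚᵘ (+ n) 0))))
    (ℚᵘP.≃-sym (ℚP.toℚᵘ-homo-+ 1ℚ (+ n ℚ./ 1))))))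

  neg/1 : ∀ n → (ℤ.- (+ n)) ℚ./ 1 ≡ ℚ.- (+ n ℚ./ 1)
  neg/1 zero    = refl
  neg/1 (suc n) = refl

  sucn*p : ∀ n p → + suc n ℚ./ 1 ℚ.* p ≡ p ℚ.+ + n ℚ./ 1 ℚ.* p
  sucn*p n p = trans (cong (ℚ._* p) (suc/1 n))
    (solve 2 (λ p q → (con 1ℚ :+ q) :* p := p :+ q :* p) refl p (+ n ℚ./ 1))

  harmonic-≤ : ∀ a n b → b ℕ.≤ a → harmonic a n ℚ.≤ + n ℚ./ 1 ℚ.* (+ 1 ℚ./ suc b)
  harmonic-≤ a zero    b b≤a = ℚP.≤-reflexive (sym (ℚP.*-zeroˡ (+ 1 ℚ./ suc b)))
  harmonic-≤ a (suc n) b b≤a = subst (harmonic a (suc n) ℚ.≤_) (sym (sucn*p n (+ 1 ℚ./ suc b)))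
    (ℚP.+-mono-≤ (1/-antimono b≤a) (harmonic-≤ (suc a) n b (ℕP.m≤n⇒m≤1+n b≤a)))

  harmonic-≥ : ∀ a n b → a ℕ.+ n ℕ.≤ suc b → + n ℚ./ 1 ℚ.* (+ 1 ℚ./ suc b) ℚ.≤ harmonic a n
  harmonic-≥ a zero    b h = ℚP.≤-reflexive (ℚP.*-zeroˡ (+ 1 ℚ./ suc b))
  harmonic-≥ a (suc n) b h = subst (ℚ._≤ harmonic a (suc n)) (sym (sucn*p n (+ 1 ℚ./ suc b)))
    (ℚP.+-mono-≤ (1/-antimono (ℕP.≤-trans (ℕP.m≤m+n a n) (ℕ.s≤s⁻¹ (subst (ℕ._≤ suc b) (ℕP.+-suc a n) h))))
      (harmonic-≥ (suc a) n b (subst (ℕ._≤ suc b) (ℕP.+-suc a n) h)))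

  refine-shift : ∀ a r → suc r ℕ.+ (r ℕ.+ a ℕ.* suc r) ≡ r ℕ.+ suc a ℕ.* suc r
  refine-shift a r = trans (sym (ℕP.+-assoc (suc r) r (a ℕ.* suc r)))
    (trans (cong (ℕ._+ a ℕ.* suc r) (ℕP.+-comm (suc r) r)) (ℕP.+-assoc r (suc r) (a ℕ.* suc r)))

  refine-step : ∀ a n r → harmonic (r ℕ.+ a ℕ.* suc r) (suc n ℕ.* suc r) ≡
                harmonic (r ℕ.+ a ℕ.* suc r) (suc r) ℚ.+ harmonic (r ℕ.+ suc a ℕ.* suc r) (n ℕ.* suc r)
  refine-step a n r = trans (harmonic-+ (r ℕ.+ a ℕ.* suc r) (suc r) (n ℕ.* suc r))
    (cong (λ b → harmonic (r ℕ.+ a ℕ.* suc r) (suc r) ℚ.+ harmonic b (n ℕ.* suc r)) (refine-shift a r))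

  refine-≤ : ∀ a n r → harmonic (r ℕ.+ a ℕ.* suc r) (n ℕ.* suc r) ℚ.≤ harmonic a n
  refine-≤ a zero    r = ℚP.≤-refl
  refine-≤ a (suc n) r = subst (ℚ._≤ harmonic a (suc n)) (sym (refine-step a n r))
    (ℚP.+-mono-≤
      (subst (harmonic (r ℕ.+ a ℕ.* suc r) (suc r) ℚ.≤_) (n*1/mn≡1/m a r)
        (harmonic-≤ (r ℕ.+ a ℕ.* suc r) (suc r) (r ℕ.+ a ℕ.* suc r) ℕP.≤-refl))
      (refine-≤ (suc a) n r))

  refine-≥ : ∀ a n r → harmonic a n ℚ.+ (+ 1 ℚ./ suc (a ℕ.+ n)) ℚ.≤
             harmonic (r ℕ.+ a ℕ.* suc r) (n ℕ.* suc r) ℚ.+ (+ 1 ℚ./ suc a)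
  refine-≥ a zero    r = ℚP.+-monoʳ-≤ 0ℚ (1/-antimono (ℕP.m≤m+n a 0))
  refine-≥ a (suc n) r = begin
    u a ℚ.+ harmonic (suc a) n ℚ.+ u (a ℕ.+ suc n)       ≡⟨ cong (λ b → u a ℚ.+ harmonic (suc a) n ℚ.+ u b) (ℕP.+-suc a n) ⟩
    u a ℚ.+ harmonic (suc a) n ℚ.+ u (suc a ℕ.+ n)       ≡⟨ ℚP.+-assoc (u a) (harmonic (suc a) n) _ ⟩
    u a ℚ.+ (harmonic (suc a) n ℚ.+ u (suc a ℕ.+ n))     ≤⟨ ℚP.+-monoʳ-≤ (u a) (refine-≥ (suc a) n r) ⟩
    u a ℚ.+ (rest ℚ.+ u (suc a))                         ≤⟨ ℚP.+-monoʳ-≤ (u a) (ℚP.+-monoʳ-≤ rest block) ⟩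
    u a ℚ.+ (rest ℚ.+ first)                             ≡⟨ solve 3 (λ p q r → p :+ (q :+ r) := r :+ q :+ p) refl (u a) rest first ⟩
    first ℚ.+ rest ℚ.+ u a                               ≡⟨ cong (ℚ._+ u a) (refine-step a n r) ⟨
    harmonic (r ℕ.+ a ℕ.* suc r) (suc n ℕ.* suc r) ℚ.+ u a ∎
    where
    u : ℕ → ℚ
    u n = + 1 ℚ./ suc n
    first = harmonic (r ℕ.+ a ℕ.* suc r) (suc r)
    rest  = harmonic (r ℕ.+ suc a ℕ.* suc r) (n ℕ.* suc r)
    block : u (suc a) ℚ.≤ first
    block = subst (ℚ._≤ first) (n*1/mn≡1/m (suc a) r)
      (harmonic-≥ (r ℕ.+ a ℕ.* suc r) (suc r) (r ℕ.+ suc a ℕ.* suc r)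
        (ℕP.≤-reflexive (trans (ℕP.+-comm (r ℕ.+ a ℕ.* suc r) (suc r)) (refine-shift a r)) ⟨≤⟩ ℕP.n≤1+n _))
      where _⟨≤⟩_ = ℕP.≤-trans

  harmonic-close : ∀ k m n → harmonic m (k ℕ.* suc m) ℚ.≤ harmonic n (k ℕ.* suc n) ℚ.+ (+ 1 ℚ./ suc m)
  harmonic-close k m n = begin
    harmonic m (k ℕ.* suc m)
      ≡⟨ ℚP.+-identityʳ _ ⟨
    harmonic m (k ℕ.* suc m) ℚ.+ 0ℚ
      ≤⟨ ℚP.+-monoʳ-≤ (harmonic m (k ℕ.* suc m)) (ℚP.<⇒≤ (1/sucn>0 (m ℕ.+ k ℕ.* suc m))) ⟩
    harmonic m (k ℕ.* suc m) ℚ.+ (+ 1 ℚ./ suc (m ℕ.+ k ℕ.* suc m))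
      ≤⟨ refine-≥ m (k ℕ.* suc m) n ⟩
    harmonic (n ℕ.+ m ℕ.* suc n) (k ℕ.* suc m ℕ.* suc n) ℚ.+ (+ 1 ℚ./ suc m)
      ≡⟨ cong₂ (λ i j → harmonic i j ℚ.+ (+ 1 ℚ./ suc m)) (ℕP.suc-injective (ℕP.*-comm (suc m) (suc n))) swap ⟩
    harmonic (m ℕ.+ n ℕ.* suc m) (k ℕ.* suc n ℕ.* suc m) ℚ.+ (+ 1 ℚ./ suc m)
      ≤⟨ ℚP.+-monoˡ-≤ (+ 1 ℚ./ suc m) (refine-≤ n (k ℕ.* suc n) m) ⟩
    harmonic n (k ℕ.* suc n) ℚ.+ (+ 1 ℚ./ suc m) ∎
    where
    swap : k ℕ.* suc m ℕ.* suc n ≡ k ℕ.* suc n ℕ.* suc m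
    swap = trans (ℕP.*-assoc k (suc m) (suc n))
          (trans (cong (k ℕ.*_) (ℕP.*-comm (suc m) (suc n))) (sym (ℕP.*-assoc k (suc n) (suc m))))

-- Equality of real numbers is _≈_ below, not _≡_.

record ℝ : Set where
  field
    seq    : ℕ → ℚ
    cauchy : ∀ ε → 0ℚ ℚ.< ε →
             ∃ λ N → ∀ m n → N ℕ.≤ m → N ℕ.≤ n → ℚ.∣ seq m ℚ.- seq n ∣ ℚ.≤ ε

open ℝ public

infix  4 _<_ _≤_ _≈_
infix  8 -_
infixl 6 _+_ _-_
infixl 7 _*_

_<_ : ℝ → ℝ → Set
x < y = ∃ λ ε → 0ℚ ℚ.< ε × ∃ λ N → ∀ n → N ℕ.≤ n → seq x n ℚ.+ ε ℚ.≤ seq y n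

_≤_ : ℝ → ℝ → Set
x ≤ y = ¬ (y < x)

_≈_ : ℝ → ℝ → Set
x ≈ y = x ≤ y × y ≤ x

fromℚ : ℚ → ℝ
fromℚ q = record
  { seq    = λ _ → q
  ; cauchy = λ ε 0<ε → 0 , λ _ _ _ _ →
      subst (λ d → ℚ.∣ d ∣ ℚ.≤ ε) (sym (ℚP.+-inverseʳ q)) (ℚP.<⇒≤ 0<ε)
  }

fromℤ : ℤ → ℝ
fromℤ i = fromℚ (i ℚ./ 1)

fromℕ : ℕ → ℝ
fromℕ n = fromℤ (+ n)

0ℝ : ℝ
0ℝ = fromℚ 0ℚ

_+_ : ℝ → ℝ → ℝ
x + y = record
  { seq    = λ n → seq x n ℚ.+ seq y n
  ; cauchy = λ ε 0<ε →
      let (M , hx) = cauchy x (½ ℚ.* ε) (Rational.½-pos 0<ε)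
          (N , hy) = cauchy y (½ ℚ.* ε) (Rational.½-pos 0<ε)
      in M ℕ.⊔ N , λ m n h k → estimate ε m n
           (hx m n (ℕP.m⊔n≤o⇒m≤o M N h) (ℕP.m⊔n≤o⇒m≤o M N k))
           (hy m n (ℕP.m⊔n≤o⇒n≤o M N h) (ℕP.m⊔n≤o⇒n≤o M N k))
  }
  where
  open ℚP.≤-Reasoning
  open +-*-Solver using (solve; _:+_; _:-_; _:=_)
  estimate : ∀ ε m n → ℚ.∣ seq x m ℚ.- seq x n ∣ ℚ.≤ ½ ℚ.* ε → ℚ.∣ seq y m ℚ.- seq y n ∣ ℚ.≤ ½ ℚ.* ε →
             ℚ.∣ seq x m ℚ.+ seq y m ℚ.- (seq x n ℚ.+ seq y n) ∣ ℚ.≤ ε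
  estimate ε m n h k = begin
    ℚ.∣ seq x m ℚ.+ seq y m ℚ.- (seq x n ℚ.+ seq y n) ∣
      ≡⟨ cong ℚ.∣_∣ (solve 4 (λ p q r s → p :+ q :- (r :+ s) := p :- r :+ (q :- s)) refl
           (seq x m) (seq y m) (seq x n) (seq y n)) ⟩
    ℚ.∣ seq x m ℚ.- seq x n ℚ.+ (seq y m ℚ.- seq y n) ∣
      ≤⟨ ℚP.∣p+q∣≤∣p∣+∣q∣ (seq x m ℚ.- seq x n) (seq y m ℚ.- seq y n) ⟩
    ℚ.∣ seq x m ℚ.- seq x n ∣ ℚ.+ ℚ.∣ seq y m ℚ.- seq y n ∣
      ≤⟨ ℚP.+-mono-≤ h k ⟩
    ½ ℚ.* ε ℚ.+ ½ ℚ.* ε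
      ≡⟨ Rational.½ε+½ε≡ε ε ⟩
    ε ∎

-_ : ℝ → ℝ
- x = record
  { seq    = λ n → ℚ.- seq x n
  ; cauchy = λ ε 0<ε → let (N , h) = cauchy x ε 0<ε in N , λ m n N≤m N≤n →
      subst (ℚ._≤ ε) (sym (Rational.∣-p+q∣≡∣p-q∣ (seq x m) (seq x n))) (h m n N≤m N≤n)
  }

_-_ : ℝ → ℝ → ℝ
x - y = x + (- y)

∣_∣ : ℝ → ℝ
∣ x ∣ = record
  { seq    = λ n → ℚ.∣ seq x n ∣
  ; cauchy = λ ε 0<ε → let (N , h) = cauchy x ε 0<ε in N , λ m n N≤m N≤n →
      ℚP.≤-trans (Rational.∣∣p∣-∣q∣∣≤∣p-q∣ (seq x m) (seq x n)) (h m n N≤m N≤n)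
  }

eventually-bounded : ∀ x → ∃ λ B → 0ℚ ℚ.< B × ∃ λ N → ∀ n → N ℕ.≤ n → ℚ.∣ seq x n ∣ ℚ.≤ B
eventually-bounded x = let (N , h) = cauchy x 1ℚ (ℚP.positive⁻¹ 1ℚ) in
    ℚ.∣ seq x N ∣ ℚ.+ 1ℚ
  , ℚP.+-mono-≤-< (ℚP.0≤∣p∣ (seq x N)) (ℚP.positive⁻¹ 1ℚ)
  , N
  , λ n N≤n → ℚP.≤-trans (Rational.∣p∣≤∣q∣+∣p-q∣ (seq x n) (seq x N))
      (ℚP.+-monoʳ-≤ ℚ.∣ seq x N ∣ (h n N N≤n ℕP.≤-refl))

_*_ : ℝ → ℝ → ℝ
x * y = record
  { seq    = λ n → seq x n ℚ.* seq y n
  ; cauchy = λ ε 0<ε →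
      let (a , 0<a , K , hK) = eventually-bounded x
          (b , 0<b , L , hL) = eventually-bounded y
          (M , hM) = cauchy x (½ ℚ.* ε ℚ.* Rational.recip b)
                       (Rational.*-pos (Rational.½-pos 0<ε) (Rational.recip-pos 0<b))
          (N , hN) = cauchy y (½ ℚ.* ε ℚ.* Rational.recip a)
                       (Rational.*-pos (Rational.½-pos 0<ε) (Rational.recip-pos 0<a))
      in (K ℕ.⊔ L) ℕ.⊔ (M ℕ.⊔ N) , λ m n h k →
         let m≥KL = ℕP.m⊔n≤o⇒m≤o (K ℕ.⊔ L) (M ℕ.⊔ N) h
             n≥KL = ℕP.m⊔n≤o⇒m≤o (K ℕ.⊔ L) (M ℕ.⊔ N) k
             m≥MN = ℕP.m⊔n≤o⇒n≤o (K ℕ.⊔ L) (M ℕ.⊔ N) h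
             n≥MN = ℕP.m⊔n≤o⇒n≤o (K ℕ.⊔ L) (M ℕ.⊔ N) k
         in Rational.*-close (seq x m) (seq x n) (seq y m) (seq y n)
              (hK m (ℕP.m⊔n≤o⇒m≤o K L m≥KL)) (hL n (ℕP.m⊔n≤o⇒n≤o K L n≥KL)) 0<a 0<b
              (hN m n (ℕP.m⊔n≤o⇒n≤o M N m≥MN) (ℕP.m⊔n≤o⇒n≤o M N n≥MN))
              (hM m n (ℕP.m⊔n≤o⇒m≤o M N m≥MN) (ℕP.m⊔n≤o⇒m≤o M N n≥MN))
  }

inverse : ∀ x → 0ℝ < ∣ x ∣ → ℝ
inverse x (δ , 0<δ , M , hM) = record
  { seq    = λ n → Rational.recip (seq x n)
  ; cauchy = λ ε 0<ε →
      let (N , hN) = cauchy x (ε ℚ.* (δ ℚ.* δ)) (Rational.*-pos 0<ε (Rational.*-pos 0<δ 0<δ))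
      in M ℕ.⊔ N , λ m n h k → Rational.recip-close (seq x m) (seq x n) 0<δ
           (apart m (ℕP.m⊔n≤o⇒m≤o M N h)) (apart n (ℕP.m⊔n≤o⇒m≤o M N k))
           (hN m n (ℕP.m⊔n≤o⇒n≤o M N h) (ℕP.m⊔n≤o⇒n≤o M N k))
  }
  where
  apart : ∀ n → M ℕ.≤ n → δ ℚ.≤ ℚ.∣ seq x n ∣
  apart n M≤n = subst (ℚ._≤ ℚ.∣ seq x n ∣) (ℚP.+-identityˡ δ) (hM n M≤n)

-- The natural logarithm of a positive integer, log n = ∫₁ⁿ dt/t, as the limit
-- over M = 1, 2, 3, … of the Riemann sums of mesh 1/M with left endpoints:
--   Σ_{i < (n-1)M} (1/M) · 1/(1 + i/M) = Σ_{i < (n-1)M} 1/(M + i).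
-- The value at n = 0 is a dummy.
log : ℕ → ℝ
log n = record
  { seq    = λ m → Rational.harmonic m ((n ∸ 1) ℕ.* suc m)
  ; cauchy = λ ε 0<ε → let (N , h) = Rational.archimedean 0<ε in N , λ i j N≤i N≤j →
      Rational.∣p-q∣≤
        (ℚP.≤-trans (Rational.harmonic-close (n ∸ 1) i j)
          (ℚP.+-monoʳ-≤ (Rational.harmonic j ((n ∸ 1) ℕ.* suc j))
            (ℚP.≤-trans (Rational.1/-antimono N≤i) h)))
        (ℚP.≤-trans (Rational.harmonic-close (n ∸ 1) j i)
          (ℚP.+-monoʳ-≤ (Rational.harmonic i ((n ∸ 1) ℕ.* suc i))
            (ℚP.≤-trans (Rational.1/-antimono N≤j) h)))
  }

infix 4 _⟶_
_⟶_ : (ℕ → ℝ) → ℝ → Set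
a ⟶ L = ∀ ε → 0ℝ < ε → ∃ λ M → ∀ N → M ℕ.≤ N → ∣ a N - L ∣ < ε

-- The following depends on excluded middle: division is total (x / 0 = 0),
-- and a real number is rounded and compared with another by case distinction.
module Classical (em : ExcludedMiddle 0ℓ) where

  infixl 7 _/_
  infix  9 _⁻¹

  _⁻¹ : ℝ → ℝ
  x ⁻¹ with em {0ℝ < ∣ x ∣}
  ... | yes x≠0 = inverse x x≠0
  ... | no  _   = 0ℝ

  _/_ : ℝ → ℝ → ℝ
  x / y = x * y ⁻¹

  private
    find-floor : ∀ x n i → fromℤ i ≤ x → x < fromℤ (i ℤ.+ + n) →
                 ∃ λ z → fromℤ z ≤ x × x < fromℤ (z ℤ.+ 1ℤ)
    find-floor x zero    i i≤x x<i+n = contradiction (subst (λ j → x < fromℤ j) (ℤP.+-identityʳ i) x<i+n) i≤x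
    find-floor x (suc n) i i≤x x<i+n with em {x < fromℤ (i ℤ.+ 1ℤ)}
    ... | yes x<i+1 = i , i≤x , x<i+1
    ... | no  i+1≤x = find-floor x n (i ℤ.+ 1ℤ) i+1≤x
                        (subst (λ j → x < fromℤ j) (sym (ℤP.+-assoc i 1ℤ (+ n))) x<i+n)

  floor-exists : ∀ x → ∃ λ z → fromℤ z ≤ x × x < fromℤ (z ℤ.+ 1ℤ)
  floor-exists x = find-floor x (K ℕ.+ suc K) (ℤ.- (+ K)) lower
    (subst (λ j → x < fromℤ j) (sym -K+K+sucK) upper)
    where
    bounded = eventually-bounded x
    B = proj₁ bounded
    N = proj₁ (proj₂ (proj₂ bounded))
    K = ℤ.∣ ℚ.numerator B ∣

    ∣xₙ∣≤K : ∀ n → N ℕ.≤ n → ℚ.∣ seq x n ∣ ℚ.≤ + K ℚ./ 1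
    ∣xₙ∣≤K n N≤n = ℚP.≤-trans (proj₂ (proj₂ (proj₂ bounded)) n N≤n) (Rational.≤∣↥∣ B)

    -K+K+sucK : ℤ.- (+ K) ℤ.+ + (K ℕ.+ suc K) ≡ + suc K
    -K+K+sucK = trans (cong (λ j → ℤ.- (+ K) ℤ.+ j) (ℤP.pos-+ K (suc K)))
      (trans (sym (ℤP.+-assoc (ℤ.- (+ K)) (+ K) (+ suc K)))
      (trans (cong (λ j → j ℤ.+ + suc K) (ℤP.+-inverseˡ (+ K))) (ℤP.+-identityˡ (+ suc K))))

    upper : x < fromℤ (+ suc K)
    upper = 1ℚ , ℚP.positive⁻¹ 1ℚ , N , λ n N≤n →
      subst (seq x n ℚ.+ 1ℚ ℚ.≤_) (trans (ℚP.+-comm (+ K ℚ./ 1) 1ℚ) (sym (Rational.suc/1 K)))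
        (ℚP.+-monoˡ-≤ 1ℚ (ℚP.≤-trans (Rational.p≤∣p∣ (seq x n)) (∣xₙ∣≤K n N≤n)))

    lower : fromℤ (ℤ.- (+ K)) ≤ x
    lower (ε , 0<ε , M , h) = ℚP.<-irrefl refl (begin-strict
      ℚ.- (+ K ℚ./ 1)              ≤⟨ ℚP.neg-antimono-≤ (∣xₙ∣≤K n (ℕP.m≤m⊔n N M)) ⟩
      ℚ.- ℚ.∣ seq x n ∣            ≡⟨ cong ℚ.-_ (ℚP.∣-p∣≡∣p∣ (seq x n)) ⟨
      ℚ.- ℚ.∣ ℚ.- seq x n ∣        ≤⟨ ℚP.neg-antimono-≤ (Rational.p≤∣p∣ (ℚ.- seq x n)) ⟩
      ℚ.- (ℚ.- seq x n)            ≡⟨ solve 1 (λ p → :- (:- p) := p :+ con 0ℚ) refl (seq x n) ⟩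
      seq x n ℚ.+ 0ℚ               <⟨ ℚP.+-monoʳ-< (seq x n) 0<ε ⟩
      seq x n ℚ.+ ε                ≤⟨ h n (ℕP.m≤n⊔m N M) ⟩
      (ℤ.- (+ K)) ℚ./ 1            ≡⟨ Rational.neg/1 K ⟩
      ℚ.- (+ K ℚ./ 1)              ∎)
      where
      open ℚP.≤-Reasoning
      open +-*-Solver using (solve; :-_; _:+_; _:=_; con)
      n = N ℕ.⊔ M

  ⌊_⌋ : ℝ → ℤ
  ⌊ x ⌋ = proj₁ (floor-exists x)

  frac : ℝ → ℝ
  frac x = x - fromℤ ⌊ x ⌋

  -- ⌊ x + ½ ⌋ is an integer nearest to x.
  ‖_‖ : ℝ → ℝ
  ‖ x ‖ = ∣ x - fromℤ ⌊ x + fromℚ ½ ⌋ ∣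

  -- The value at n = 0 is a dummy; x is only used at positive indices.
  x : ℕ → ℝ
  x n = frac (log (2 ℕ.* n ∸ 1) / log 2)

  [1…_] : ℕ → List ℕ
  [1… N ] = map suc (upTo N)

  pairCount : ℕ → ℝ → ℕ
  pairCount N s = length (filter close? (cartesianProduct [1… N ] [1… N ]))
    where
    close? : (p : ℕ × ℕ) → Dec (proj₁ p ≢ proj₂ p × ‖ x (proj₁ p) - x (proj₂ p) ‖ ≤ s / fromℕ N)
    close? _ = em

  -- The value at N = 0 is a dummy.
  F : ℕ → ℝ → ℝ
  F N s = fromℕ 1 / fromℕ N * fromℕ (pairCount N s)

{-# OPTIONS --safe #-}
-- Every odd number below 2N, multiplied by a suitable power of 2, gives exactly one of the integers
-- c = N, …, 2N - 1, and this does not change log c / log 2 modulo 1. So, with σ = s log 2, the pairs to be counted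
-- are the pairs c ≠ d in [N , 2N) for which log c - log d is within σ / N of an integer multiple of log 2.
-- For c < d the bounds (d - c) / d ≤ log d - log c ≤ (d - c) / c reduce this, up to O(1) pairs, to
-- d - c = j with j N ≤ σ c: about N such c if j ≤ σ, about (2 - j / σ) N if σ ≤ j ≤ 2σ, and none for larger j.
-- Hence F(s) = 2 Σ_{j ≤ h} 1 + 2 Σ_{h < j ≤ k} (2 - j / σ) with k = ⌊ 2σ ⌋ and h = ⌊ k / 2 ⌋.
module Submission where

-- The interval [N , 2N) is a good set of representatives because two of its points have logarithms
-- less than log 2 apart, so that only the multiples 0 and ± log 2 can be near their difference. The
-- multiple 0 produces the limit. A pair near ± log 2 has one point close to N and the other close
-- to 2N, both within a distance independent of N; this is one source of the O(1) pairs.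
--
-- The other source is the gap between the denominators c and d in the bounds for log d - log c.
-- Replacing c by d = c + j in j N ≤ σ c moves the threshold by j, and j ≤ 2σ whatever N is. Hence
-- these crude bounds already determine the count up to a constant.
--
-- The real numbers here are Cauchy sequences, and equality means that neither strict inequality
-- holds. To keep the sequences out of the counting, it takes place in an arbitrary Archimedean
-- ordered field with a function that has three properties of the logarithm. That field has no total
-- division, so quotients enter it through the equation that characterises them, and floors through
-- a pair of inequalities.

-- Archimedean ordered fields and their elementary inequalities.

module OrderedFields where

  open import Algebra.Structures using (IsCommutativeRing)
  open import Algebra.Bundles using (CommutativeRing)
  open import Data.Integer as ℤ using (ℤ; +_; -[1+_])
  import Data.Integer.Properties as ℤP
  open import Data.Maybe using (Maybe; just; nothing)
  open import Data.Nat as ℕ using (ℕ; zero; suc; z≤n; s≤s)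
  import Data.Nat.Properties as ℕP
  open import Data.Product using (∃; _×_; _,_)
  open import Data.Sum using (_⊎_; [_,_]′)
  open import Level using (0ℓ)
  open import Relation.Binary.PropositionalEquality as ≡ using (_≡_)
  open import Relation.Nullary using (¬_; yes; no; contradiction)
  import Algebra.Solver.Ring
  open import Algebra.Solver.Ring.AlmostCommutativeRing using (fromCommutativeRing; _-Raw-AlmostCommutative⟶_)

  -- The embedding of the integers is a field of the record, so that an instance can supply its own
  -- `fromℤ`, which also provides the coefficients of the ring solver. The strict order x < y
  -- appears throughout as ¬ y ≤ x.
  record OrderedField : Set₁ where
    infix  4 _≈_ _≤_
    infix  8 -_
    infixl 6 _+_
    infixl 7 _*_
    field
      Carrier           : Set
      _≈_ _≤_           : Carrier → Carrier → Set
      _+_ _*_           : Carrier → Carrier → Carrier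
      -_                : Carrier → Carrier
      0# 1#             : Carrier
      isCommutativeRing : IsCommutativeRing _≈_ _+_ _*_ -_ 0# 1#
      fromℤ             : ℤ → Carrier
      fromℤ-+           : ∀ i j → fromℤ (i ℤ.+ j) ≈ fromℤ i + fromℤ j
      fromℤ-*           : ∀ i j → fromℤ (i ℤ.* j) ≈ fromℤ i * fromℤ j
      fromℤ-neg         : ∀ i → fromℤ (ℤ.- i) ≈ - fromℤ i
      fromℤ-0           : fromℤ (+ 0) ≈ 0#
      fromℤ-1           : fromℤ (+ 1) ≈ 1#
      ≤-reflexive       : ∀ {x y} → x ≈ y → x ≤ y
      ≤-antisym         : ∀ {x y} → x ≤ y → y ≤ x → x ≈ y
      ≤-trans           : ∀ {x y z} → x ≤ y → y ≤ z → x ≤ z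
      ≤-total           : ∀ x y → x ≤ y ⊎ y ≤ x
      +-monoˡ-≤         : ∀ z {x y} → x ≤ y → x + z ≤ y + z
      *-nonneg          : ∀ {x y} → 0# ≤ x → 0# ≤ y → 0# ≤ x * y
      1≰0               : ¬ 1# ≤ 0#
      inverse           : ∀ x → ¬ x ≤ 0# → ∃ λ y → x * y ≈ 1#
      archimedean       : ∀ x → ∃ λ n → x ≤ fromℤ (+ n)

  module FieldProperties (R : OrderedField) where

    open OrderedField R public
    open IsCommutativeRing isCommutativeRing public
      using (refl; sym; trans; setoid; +-cong; *-cong; -‿cong; +-identityˡ; +-identityʳ; +-comm;
             *-identityˡ; *-identityʳ; *-comm; zeroˡ; zeroʳ)

    infixl 6 _-_
    _-_ : Carrier → Carrier → Carrier
    x - y = x + (- y)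

    commutativeRing : CommutativeRing 0ℓ 0ℓ
    commutativeRing = record { isCommutativeRing = isCommutativeRing }

    private
      morphism : ℤ.+-*-rawRing -Raw-AlmostCommutative⟶ fromCommutativeRing commutativeRing
      morphism = record
        { ⟦_⟧ = fromℤ ; +-homo = fromℤ-+ ; *-homo = fromℤ-* ; -‿homo = fromℤ-neg
        ; 0-homo = fromℤ-0 ; 1-homo = fromℤ-1 }

      coeff≟ : ∀ i j → Maybe (fromℤ i ≈ fromℤ j)
      coeff≟ i j with i ℤP.≟ j
      ... | yes ≡.refl = just refl
      ... | no _       = nothing

    open Algebra.Solver.Ring ℤ.+-*-rawRing (fromCommutativeRing commutativeRing) morphism coeff≟ public
      using (solve; _:=_; _:+_; _:*_; _:-_; :-_; con)

    fromℕ : ℕ → Carrier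
    fromℕ n = fromℤ (+ n)

    fromℕ-+ : ∀ m n → fromℕ (m ℕ.+ n) ≈ fromℕ m + fromℕ n
    fromℕ-+ m n = fromℤ-+ (+ m) (+ n)

    fromℕ-* : ∀ m n → fromℕ (m ℕ.* n) ≈ fromℕ m * fromℕ n
    fromℕ-* m n = trans (reflexive (≡.cong fromℤ (ℤP.pos-* m n))) (fromℤ-* (+ m) (+ n))
      where open IsCommutativeRing isCommutativeRing using (reflexive)

    fromℕ-suc : ∀ n → fromℕ (suc n) ≈ 1# + fromℕ n
    fromℕ-suc n = trans (fromℕ-+ 1 n) (+-cong fromℤ-1 refl)

    ≤-refl : ∀ {x} → x ≤ x
    ≤-refl = ≤-reflexive refl

    ≤-respˡ : ∀ {x y z} → x ≈ y → x ≤ z → y ≤ z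
    ≤-respˡ e h = ≤-trans (≤-reflexive (sym e)) h

    ≤-respʳ : ∀ {x y z} → x ≈ y → z ≤ x → z ≤ y
    ≤-respʳ e h = ≤-trans h (≤-reflexive e)

    ≤-resp : ∀ {x x′ y y′} → x ≈ x′ → y ≈ y′ → x ≤ y → x′ ≤ y′
    ≤-resp e f h = ≤-respˡ e (≤-respʳ f h)

    +-mono-≤ : ∀ {x x′ y y′} → x ≤ x′ → y ≤ y′ → x + y ≤ x′ + y′
    +-mono-≤ {x} {x′} {y} {y′} h k = ≤-trans (+-monoˡ-≤ y h)
      (≤-resp (+-comm y x′) (+-comm y′ x′) (+-monoˡ-≤ x′ k))

    diff : ∀ {x y} → x ≤ y → 0# ≤ y - x
    diff {x} {y} h = ≤-respˡ (trans (solve 1 (λ x → x :- x := con (+ 0)) refl x) fromℤ-0) (+-monoˡ-≤ (- x) h)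

    -- This splits an inequality into a ring identity, left to the solver, and the nonnegativity of
    -- the difference. Most estimates below are proved this way.
    by-diff : ∀ {x y d} → y - x ≈ d → 0# ≤ d → x ≤ y
    by-diff {x} {y} e h = ≤-resp (+-identityˡ x) (solve 2 (λ x y → y :- x :+ x := y) refl x y)
      (+-monoˡ-≤ x (≤-respʳ (sym e) h))

    0≤+ : ∀ {x y} → 0# ≤ x → 0# ≤ y → 0# ≤ x + y
    0≤+ h k = ≤-respˡ (+-identityˡ 0#) (+-mono-≤ h k)

    ≰⇒≥ : ∀ {x y} → ¬ x ≤ y → y ≤ x
    ≰⇒≥ {x} {y} h = [ (λ k → contradiction k h) , (λ k → k) ]′ (≤-total x y)

    0≤1 : 0# ≤ 1#
    0≤1 = ≰⇒≥ 1≰0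

    0≤fromℕ : ∀ n → 0# ≤ fromℕ n
    0≤fromℕ zero    = ≤-reflexive (sym fromℤ-0)
    0≤fromℕ (suc n) = ≤-respʳ (sym (fromℕ-suc n)) (0≤+ 0≤1 (0≤fromℕ n))

    fromℕ-mono : ∀ {m n} → m ℕ.≤ n → fromℕ m ≤ fromℕ n
    fromℕ-mono {m} {n} h = by-diff
      (trans (+-cong (≡.subst (λ a → fromℕ a ≈ fromℕ m + fromℕ (n ℕ.∸ m)) (ℕP.m+[n∸m]≡n h) (fromℕ-+ m (n ℕ.∸ m))) refl)
        (solve 2 (λ a b → a :+ b :- a := b) refl (fromℕ m) (fromℕ (n ℕ.∸ m)))) (0≤fromℕ (n ℕ.∸ m))

    ≤-1+≰ : ∀ x → ¬ x + 1# ≤ x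
    ≤-1+≰ x h = 1≰0 (≤-resp (solve 2 (λ x o → x :+ o :- x := o) refl x 1#)
      (trans (solve 1 (λ x → x :- x := con (+ 0)) refl x) fromℤ-0) (+-monoˡ-≤ (- x) h))

    fromℕ-<-≰ : ∀ {m n} → m ℕ.< n → ¬ fromℕ n ≤ fromℕ m
    fromℕ-<-≰ {m} {n} h k = ≤-1+≰ (fromℕ m)
      (≤-trans (≤-reflexive (trans (+-comm (fromℕ m) 1#) (sym (fromℕ-suc m)))) (≤-trans (fromℕ-mono h) k))

    fromℕ-pos : ∀ {n} → 1 ℕ.≤ n → ¬ fromℕ n ≤ 0#
    fromℕ-pos h k = fromℕ-<-≰ h (≤-respʳ (sym fromℤ-0) k)

    *-monoˡ-≤ : ∀ {z x y} → 0# ≤ z → x ≤ y → z * x ≤ z * y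
    *-monoˡ-≤ {z} {x} {y} hz h = by-diff
      (solve 3 (λ z x y → z :* y :- z :* x := z :* (y :- x)) refl z x y) (*-nonneg hz (diff h))

    *-mono-≤ : ∀ {x x′ y y′} → 0# ≤ x → 0# ≤ y′ → x ≤ x′ → y ≤ y′ → x * y ≤ x′ * y′
    *-mono-≤ {x} {x′} {y} {y′} hx hy h k = ≤-trans (*-monoˡ-≤ hx k)
      (≤-resp (*-comm y′ x) (*-comm y′ x′) (*-monoˡ-≤ hy h))

    inverse-nonneg : ∀ {x y} → 0# ≤ x → x * y ≈ 1# → 0# ≤ y
    inverse-nonneg {x} {y} hx e = [ (λ h → h) , (λ h → contradiction (bad h) 1≰0) ]′ (≤-total 0# y)
      where
      bad : y ≤ 0# → 1# ≤ 0#
      bad h = ≤-resp e (zeroʳ x) (*-monoˡ-≤ hx h)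

    *-cancelˡ-≤ : ∀ {z x y} → ¬ z ≤ 0# → z * x ≤ z * y → x ≤ y
    *-cancelˡ-≤ {z} {x} {y} hz h with inverse z hz
    ... | w , e = ≤-resp (unit x) (unit y) (*-monoˡ-≤ (inverse-nonneg (≰⇒≥ hz) e) h)
      where
      unit : ∀ u → w * (z * u) ≈ u
      unit u = trans (solve 3 (λ w z u → w :* (z :* u) := z :* w :* u) refl w z u)
        (trans (*-cong e refl) (*-identityˡ u))

    fromℤ-mono : ∀ {i j} → i ℤ.≤ j → fromℤ i ≤ fromℤ j
    fromℤ-mono {i} {j} h = by-diff
        (trans (+-cong (refl {fromℤ j}) (sym (fromℤ-neg i))) (sym (fromℤ-+ j (ℤ.- i)))) (nonneg (ℤP.i≤j⇒0≤j-i h))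
      where
      nonneg : ∀ {i} → + 0 ℤ.≤ i → 0# ≤ fromℤ i
      nonneg (ℤ.+≤+ {n = n} _) = 0≤fromℕ n

    double≥1⇒≰0 : ∀ {x} → fromℕ 1 ≤ fromℕ 2 * x → ¬ x ≤ 0#
    double≥1⇒≰0 h k = fromℕ-pos (s≤s z≤n) (≤-trans h (≤-respʳ (zeroʳ (fromℕ 2)) (*-monoˡ-≤ (0≤fromℕ 2) k)))

    private
      distrib-double : ∀ {s l m} → m ≈ l + l → m * s ≈ s * l + s * l
      distrib-double {s} {l} e = trans (*-cong e refl) (solve 2 (λ s l → (l :+ l) :* s := s :* l :+ s :* l) refl s l)

    -- With l = log 2, m = log 4 and q = a / log 4, this and its converse turn the condition a / log
    -- 4 ≤ s of the theorem into a ≤ 2 s log 2.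
    quotient-≤⇒ : ∀ {q a s l m} → q * m ≈ a → m ≈ l + l → 0# ≤ m → q ≤ s → a ≤ s * l + s * l
    quotient-≤⇒ {q} {m = m} e m≈ 0≤m h = ≤-resp (trans (*-comm m q) e) (distrib-double m≈) (*-monoˡ-≤ 0≤m h)

    quotient-≤⇐ : ∀ {q a s l m} → q * m ≈ a → m ≈ l + l → ¬ m ≤ 0# → a ≤ s * l + s * l → q ≤ s
    quotient-≤⇐ {q} {m = m} e m≈ m≰0 h = *-cancelˡ-≤ m≰0
      (≤-resp (sym (trans (*-comm m q) e)) (sym (distrib-double m≈)) h)

    4ls≰0 : ∀ {k s l} → 1 ℕ.≤ k → fromℕ k ≤ s * l + s * l → ¬ fromℕ 4 * l * s ≤ 0#
    4ls≰0 {k} {s} {l} 1≤k h z = fromℕ-pos 1≤k (*-cancelˡ-≤ (fromℕ-pos {2} (s≤s z≤n))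
      (≤-trans (*-monoˡ-≤ (0≤fromℕ 2) h) (≤-respˡ
        (solve 2 (λ s l → con (+ 4) :* l :* s := con (+ 2) :* (s :* l :+ s :* l)) refl s l)
        (≤-respʳ (sym (zeroʳ (fromℕ 2))) z))))

    reassociate : ∀ {w s l b} → w * (fromℕ 4 * l * s) ≈ b → w * (fromℕ 4 * (s * l)) ≈ b
    reassociate {w} {s} {l} e = trans
      (solve 3 (λ w s l → w :* (con (+ 4) :* (s :* l)) := w :* (con (+ 4) :* l :* s)) refl w s l) e

    floor-unique : ∀ {x k m} → fromℕ k ≤ x → ¬ fromℕ (suc k) ≤ x → fromℕ m ≤ x → ¬ fromℕ (suc m) ≤ x → k ≡ m
    floor-unique h h′ l l′ = ℕP.≤-antisym
      (ℕP.≮⇒≥ (λ m<k → l′ (≤-trans (fromℕ-mono m<k) h))) (ℕP.≮⇒≥ (λ k<m → h′ (≤-trans (fromℕ-mono k<m) l)))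

    -- A negative `i` would give i + 1 ≤ 0 ≤ x, against the upper bound.
    natural-floor : ∀ {x i} → 0# ≤ x → fromℤ i ≤ x → ¬ fromℤ (i ℤ.+ + 1) ≤ x → ∃ λ k → fromℕ k ≤ x × ¬ fromℕ (suc k) ≤ x
    natural-floor {x} {+ k} _ h h′ = k , h , λ l → h′ (≡.subst (λ n → fromℕ n ≤ x) (ℕP.+-comm 1 k) l)
    natural-floor {x} { -[1+ k ]} 0≤x _ h′ = contradiction (≤-trans (fromℤ-mono (nonpos k)) (≤-respˡ (sym fromℤ-0) 0≤x)) h′
      where
      nonpos : ∀ k → -[1+ k ] ℤ.+ + 1 ℤ.≤ + 0
      nonpos zero    = ℤP.≤-refl
      nonpos (suc k) = ℤ.-≤+

-- The real numbers form an Archimedean ordered field.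

module RealField where

  open import Defs
  open OrderedFields
  open import Axiom.ExcludedMiddle using (ExcludedMiddle)
  open import Algebra.Definitions using (Congruent₁)
  open import Algebra.Structures using (IsMonoid; IsAbelianGroup; IsRing; IsCommutativeRing)
  open import Data.Empty using (⊥-elim)
  open import Data.Integer as ℤ using (ℤ; +_; -[1+_])
  import Data.Integer.Properties as ℤP
  open import Data.Nat as ℕ using (ℕ; suc)
  import Data.Nat.Properties as ℕP
  open import Data.Product using (∃; _,_; proj₁; proj₂)
  open import Data.Rational as ℚ using (ℚ; 0ℚ; 1ℚ; ½)
  import Data.Rational.Properties as ℚP
  import Data.Rational.Unnormalised as ℚᵘ
  import Data.Rational.Unnormalised.Properties as ℚᵘP
  import Data.Rational.Solver as ℚSolver
  open import Data.Sum using (_⊎_; inj₁; inj₂)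
  open import Level using (0ℓ)
  open import Relation.Binary.PropositionalEquality
  open import Relation.Nullary using (¬_; yes; no; contradiction)

  open ℚSolver.+-*-Solver using (solve; _:+_; _:*_; _:-_; :-_; _:=_; con)

  p≤q⇒0≤q-p : ∀ {p q} → p ℚ.≤ q → 0ℚ ℚ.≤ q ℚ.- p
  p≤q⇒0≤q-p {p} {q} h = subst (ℚ._≤ q ℚ.- p) (ℚP.+-inverseʳ p) (ℚP.+-monoˡ-≤ (ℚ.- p) h)

  ∣p-q∣≤a⇒p≤q+a : ∀ p q {a} → ℚ.∣ p ℚ.- q ∣ ℚ.≤ a → p ℚ.≤ q ℚ.+ a
  ∣p-q∣≤a⇒p≤q+a p q {a} h = subst (ℚ._≤ q ℚ.+ a) (solve 2 (λ p q → q :+ (p :- q) := p) refl p q)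
    (ℚP.+-monoʳ-≤ q (ℚP.≤-trans (Rational.p≤∣p∣ (p ℚ.- q)) h))

  ∣p-q∣≤a⇒q≤p+a : ∀ p q {a} → ℚ.∣ p ℚ.- q ∣ ℚ.≤ a → q ℚ.≤ p ℚ.+ a
  ∣p-q∣≤a⇒q≤p+a p q {a} h = ∣p-q∣≤a⇒p≤q+a q p (subst (ℚ._≤ a) (Rational.∣p-q∣≡∣q-p∣ p q) h)

  ≤+-trans : ∀ {p q r a b} → p ℚ.≤ q ℚ.+ a → q ℚ.≤ r ℚ.+ b → p ℚ.≤ r ℚ.+ (b ℚ.+ a)
  ≤+-trans {p} {q} {r} {a} {b} h k = ℚP.≤-trans h
    (subst (q ℚ.+ a ℚ.≤_) (ℚP.+-assoc r b a) (ℚP.+-monoˡ-≤ a k))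

  0≤*ℚ : ∀ {p q} → 0ℚ ℚ.≤ p → 0ℚ ℚ.≤ q → 0ℚ ℚ.≤ p ℚ.* q
  0≤*ℚ {p} {q} hp hq = subst (ℚ._≤ p ℚ.* q) (ℚP.*-zeroʳ p) (ℚP.*-monoˡ-≤-nonNeg p {{ℚ.nonNegative hp}} hq)

  /1-+ : ∀ i j → (i ℤ.+ j) ℚ./ 1 ≡ i ℚ./ 1 ℚ.+ j ℚ./ 1
  /1-+ i j = ℚP.toℚᵘ-injective
    (ℚᵘP.≃-trans (ℚP.toℚᵘ-fromℚᵘ (ℚᵘ.mkℚᵘ (i ℤ.+ j) 0))
    (ℚᵘP.≃-trans (ℚᵘ.*≡* (cong (ℤ._* + 1) (sym (cong₂ ℤ._+_ (ℤP.*-identityʳ i) (ℤP.*-identityʳ j)))))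
    (ℚᵘP.≃-trans (ℚᵘP.≃-sym (ℚᵘP.+-cong (ℚP.toℚᵘ-fromℚᵘ (ℚᵘ.mkℚᵘ i 0)) (ℚP.toℚᵘ-fromℚᵘ (ℚᵘ.mkℚᵘ j 0))))
    (ℚᵘP.≃-sym (ℚP.toℚᵘ-homo-+ (i ℚ./ 1) (j ℚ./ 1))))))

  /1-* : ∀ i j → (i ℤ.* j) ℚ./ 1 ≡ (i ℚ./ 1) ℚ.* (j ℚ./ 1)
  /1-* i j = ℚP.toℚᵘ-injective
    (ℚᵘP.≃-trans (ℚP.toℚᵘ-fromℚᵘ (ℚᵘ.mkℚᵘ (i ℤ.* j) 0))
    (ℚᵘP.≃-trans (ℚᵘP.≃-sym (ℚᵘP.*-cong (ℚP.toℚᵘ-fromℚᵘ (ℚᵘ.mkℚᵘ i 0)) (ℚP.toℚᵘ-fromℚᵘ (ℚᵘ.mkℚᵘ j 0))))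
    (ℚᵘP.≃-sym (ℚP.toℚᵘ-homo-* (i ℚ./ 1) (j ℚ./ 1)))))

  /1-neg : ∀ i → (ℤ.- i) ℚ./ 1 ≡ ℚ.- (i ℚ./ 1)
  /1-neg (+ n)    = Rational.neg/1 n
  /1-neg -[1+ n ] = sym (trans (cong ℚ.-_ (Rational.neg/1 (suc n)))
    (solve 1 (λ p → :- (:- p) := p) refl (+ suc n ℚ./ 1)))

  infix 4 _≲_ _≋_

  -- The order and equality of Defs unfold to functions and pairs; the records allow their arguments to be inferred.
  record _≲_ (x y : ℝ) : Set where
    constructor wrap
    field
      unwrap : x ≤ y

  open _≲_ public

  record _≋_ (x y : ℝ) : Set where
    constructor _,_
    field
      ≋⇒≲ : x ≲ y
      ≋⇒≳ : y ≲ x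

  open _≋_ public

  p≤p+ε : ∀ p {ε} → 0ℚ ℚ.< ε → p ℚ.≤ p ℚ.+ ε
  p≤p+ε p 0<ε = subst (ℚ._≤ p ℚ.+ _) (ℚP.+-identityʳ p) (ℚP.+-monoʳ-≤ p (ℚP.<⇒≤ 0<ε))

  mk≲ : ∀ {x y} → (∀ ε → 0ℚ ℚ.< ε → ∃ λ N → ∀ n → N ℕ.≤ n → seq x n ℚ.≤ seq y n ℚ.+ ε) → x ≲ y
  mk≲ {x} {y} x≲y = wrap (λ (ε , 0<ε , M , h) → impossible ε 0<ε M h (x≲y (½ ℚ.* ε) (Rational.½-pos 0<ε)))
    where
    open ℚP.≤-Reasoning
    impossible : ∀ ε → 0ℚ ℚ.< ε → ∀ M → (∀ n → M ℕ.≤ n → seq y n ℚ.+ ε ℚ.≤ seq x n) →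
                 ¬ (∃ λ N → ∀ n → N ℕ.≤ n → seq x n ℚ.≤ seq y n ℚ.+ ½ ℚ.* ε)
    impossible ε 0<ε M h (N , k) = ℚP.<-irrefl refl (begin-strict
      seq y (M ℕ.⊔ N) ℚ.+ ε          ≤⟨ h (M ℕ.⊔ N) (ℕP.m≤m⊔n M N) ⟩
      seq x (M ℕ.⊔ N)                ≤⟨ k (M ℕ.⊔ N) (ℕP.m≤n⊔m M N) ⟩
      seq y (M ℕ.⊔ N) ℚ.+ ½ ℚ.* ε    <⟨ ℚP.+-monoʳ-< (seq y (M ℕ.⊔ N)) ½ε<ε ⟩
      seq y (M ℕ.⊔ N) ℚ.+ ε          ∎)
      where
      ½ε<ε : ½ ℚ.* ε ℚ.< ε
      ½ε<ε = subst₂ ℚ._<_ (ℚP.+-identityˡ _) (Rational.½ε+½ε≡ε ε) (ℚP.+-monoˡ-< (½ ℚ.* ε) (Rational.½-pos 0<ε))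

  quarters : ∀ {p q r t} ε → let δ = ½ ℚ.* (½ ℚ.* ε) in 0ℚ ℚ.< δ →
             p ℚ.≤ q ℚ.+ ½ ℚ.* δ → q ℚ.≤ r ℚ.+ (δ ℚ.+ δ) → r ℚ.≤ t ℚ.+ ½ ℚ.* δ → p ℚ.≤ t ℚ.+ ε
  quarters {p} {q} {r} {t} ε 0<δ h k l = ℚP.≤-trans (≤+-trans {p} {r} {t} (≤+-trans {p} {q} {r} h k) l)
    (ℚP.+-monoʳ-≤ t (ℚP.≤-trans (p≤p+ε _ 0<δ) (ℚP.≤-reflexive
      (solve 1 (λ e → let d = con ½ :* (con ½ :* e) in con ½ :* d :+ ((d :+ d) :+ con ½ :* d) :+ d := e) refl ε))))

  separated : ∀ {p q r t} δ →
              p ℚ.≤ q ℚ.+ ½ ℚ.* δ → q ℚ.+ (δ ℚ.+ δ) ℚ.≤ r → r ℚ.≤ t ℚ.+ ½ ℚ.* δ → p ℚ.+ δ ℚ.≤ t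
  separated {p} {q} {r} {t} δ h k l = subst (p ℚ.+ δ ℚ.≤_)
    (solve 2 (λ t d → t :+ (con ½ :* d :+ (:- (d :+ d) :+ con ½ :* d)) :+ d := t) refl t δ)
    (ℚP.+-monoˡ-≤ δ (≤+-trans {p} {r} {t} (≤+-trans {p} {q} {r} h q≤r-2δ) l))
    where
    q≤r-2δ : q ℚ.≤ r ℚ.+ (ℚ.- (δ ℚ.+ δ))
    q≤r-2δ = subst (ℚ._≤ r ℚ.+ (ℚ.- (δ ℚ.+ δ)))
      (solve 2 (λ q d → q :+ d :- d := q) refl q (δ ℚ.+ δ)) (ℚP.+-monoˡ-≤ (ℚ.- (δ ℚ.+ δ)) k)

  -- The converse of `mk≲`. Put δ = ε / 4 and compare the two sequences at one index beyond which
  -- both vary by at most δ / 2. If x exceeds y there by at most 2δ, then later by at most 3δ < ε;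
  -- if by at least 2δ, then later by at least δ, which is a strict inequality y < x. The comparison
  -- is between rationals, so it is decidable.
  eventually : ∀ {x y} → x ≲ y → ∀ ε → 0ℚ ℚ.< ε → ∃ λ N → ∀ n → N ℕ.≤ n → seq x n ℚ.≤ seq y n ℚ.+ ε
  eventually {x} {y} (wrap x≤y) ε 0<ε = main ε 0<ε
    (cauchy x _ (Rational.½-pos (Rational.½-pos (Rational.½-pos 0<ε))))
    (cauchy y _ (Rational.½-pos (Rational.½-pos (Rational.½-pos 0<ε))))
    where
    Modulus : ℝ → ℚ → Set
    Modulus z ε = ∃ λ N → ∀ m n → N ℕ.≤ m → N ℕ.≤ n → ℚ.∣ seq z m ℚ.- seq z n ∣ ℚ.≤ ε
    main : ∀ ε → 0ℚ ℚ.< ε → Modulus x (½ ℚ.* (½ ℚ.* (½ ℚ.* ε))) → Modulus y (½ ℚ.* (½ ℚ.* (½ ℚ.* ε))) →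
           ∃ λ N → ∀ n → N ℕ.≤ n → seq x n ℚ.≤ seq y n ℚ.+ ε
    main ε 0<ε (M , hx) (N , hy) with ℚP.≤-total (seq x (M ℕ.⊔ N)) (seq y (M ℕ.⊔ N) ℚ.+ (½ ℚ.* (½ ℚ.* ε) ℚ.+ ½ ℚ.* (½ ℚ.* ε)))
    ... | inj₁ h = M ℕ.⊔ N , λ n p → quarters {seq x n} {seq x (M ℕ.⊔ N)} {seq y (M ℕ.⊔ N)} {seq y n} ε (Rational.½-pos (Rational.½-pos 0<ε))
      (∣p-q∣≤a⇒p≤q+a (seq x n) (seq x (M ℕ.⊔ N)) (hx n (M ℕ.⊔ N) (ℕP.m⊔n≤o⇒m≤o M N p) (ℕP.m≤m⊔n M N))) h
      (∣p-q∣≤a⇒q≤p+a (seq y n) (seq y (M ℕ.⊔ N)) (hy n (M ℕ.⊔ N) (ℕP.m⊔n≤o⇒n≤o M N p) (ℕP.m≤n⊔m M N)))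
    ... | inj₂ h = ⊥-elim (x≤y (½ ℚ.* (½ ℚ.* ε) , Rational.½-pos (Rational.½-pos 0<ε) , M ℕ.⊔ N ,
      λ n p → separated {seq y n} {seq y (M ℕ.⊔ N)} {seq x (M ℕ.⊔ N)} {seq x n} (½ ℚ.* (½ ℚ.* ε))
        (∣p-q∣≤a⇒p≤q+a (seq y n) (seq y (M ℕ.⊔ N)) (hy n (M ℕ.⊔ N) (ℕP.m⊔n≤o⇒n≤o M N p) (ℕP.m≤n⊔m M N))) h
        (∣p-q∣≤a⇒q≤p+a (seq x n) (seq x (M ℕ.⊔ N)) (hx n (M ℕ.⊔ N) (ℕP.m⊔n≤o⇒m≤o M N p) (ℕP.m≤m⊔n M N)))))

  eventually-≤⇒≲ : ∀ {x y} M → (∀ n → M ℕ.≤ n → seq x n ℚ.≤ seq y n) → x ≲ y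
  eventually-≤⇒≲ {x} {y} M h = mk≲ {x} {y} λ ε 0<ε → M , λ n M≤n → ℚP.≤-trans (h n M≤n) (p≤p+ε _ 0<ε)

  eventually-≡⇒≋ : ∀ {x y} M → (∀ n → M ℕ.≤ n → seq x n ≡ seq y n) → x ≋ y
  eventually-≡⇒≋ M h = eventually-≤⇒≲ M (λ n M≤n → ℚP.≤-reflexive (h n M≤n))
                     , eventually-≤⇒≲ M (λ n M≤n → ℚP.≤-reflexive (sym (h n M≤n)))

  pointwise : ∀ {x y} → (∀ n → seq x n ≡ seq y n) → x ≋ y
  pointwise {x} {y} h = eventually-≡⇒≋ {x} {y} 0 (λ n _ → h n)

  <⇒≲ : ∀ {x y} → x < y → x ≲ y
  <⇒≲ (ε , 0<ε , M , h) = eventually-≤⇒≲ M (λ n M≤n → ℚP.≤-trans (p≤p+ε _ 0<ε) (h n M≤n))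

  ≲-trans : ∀ {x y z} → x ≲ y → y ≲ z → x ≲ z
  ≲-trans {x} {y} {z} h k = mk≲ {x} {z} λ ε 0<ε →
    combine ε (eventually h _ (Rational.½-pos 0<ε)) (eventually k _ (Rational.½-pos 0<ε))
    where
    combine : ∀ ε → (∃ λ N → ∀ n → N ℕ.≤ n → seq x n ℚ.≤ seq y n ℚ.+ ½ ℚ.* ε) →
              (∃ λ N → ∀ n → N ℕ.≤ n → seq y n ℚ.≤ seq z n ℚ.+ ½ ℚ.* ε) →
              ∃ λ N → ∀ n → N ℕ.≤ n → seq x n ℚ.≤ seq z n ℚ.+ ε
    combine ε (M , hM) (N , kN) = M ℕ.⊔ N , λ n p → subst (λ e → seq x n ℚ.≤ seq z n ℚ.+ e) (Rational.½ε+½ε≡ε ε)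
      (≤+-trans {seq x n} {seq y n} {seq z n} (hM n (ℕP.m⊔n≤o⇒m≤o M N p)) (kN n (ℕP.m⊔n≤o⇒n≤o M N p)))

  +-monoˡ-≲ : ∀ z {x y} → x ≲ y → x + z ≲ y + z
  +-monoˡ-≲ z {x} {y} h = mk≲ {x + z} {y + z} λ ε 0<ε → let (M , hM) = eventually h ε 0<ε in M , λ n p →
    subst (seq x n ℚ.+ seq z n ℚ.≤_)
      (solve 3 (λ y z e → y :+ e :+ z := y :+ z :+ e) refl (seq y n) (seq z n) ε)
      (ℚP.+-monoˡ-≤ (seq z n) (hM n p))

  neg-antimono-≲ : ∀ {x y} → x ≲ y → - y ≲ - x
  neg-antimono-≲ {x} {y} h = mk≲ { - y} { - x} λ ε 0<ε → let (M , hM) = eventually h ε 0<ε in M , λ n p → subst₂ ℚ._≤_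
    (solve 2 (λ x y → x :- x :- y := :- y) refl (seq x n) (seq y n))
    (solve 3 (λ x y e → y :+ e :- x :- y := :- x :+ e) refl (seq x n) (seq y n) ε)
    (ℚP.+-monoˡ-≤ (ℚ.- seq y n) (ℚP.+-monoˡ-≤ (ℚ.- seq x n) (hM n p)))

  ≋-refl : ∀ {x} → x ≋ x
  ≋-refl = pointwise (λ _ → refl)

  ≋-sym : ∀ {x y} → x ≋ y → y ≋ x
  ≋-sym (h , k) = k , h

  ≋-trans : ∀ {x y z} → x ≋ y → y ≋ z → x ≋ z
  ≋-trans (h , k) (h′ , k′) = ≲-trans h h′ , ≲-trans k′ k

  +-cong : ∀ {x x′ y y′} → x ≋ x′ → y ≋ y′ → x + y ≋ x′ + y′
  +-cong {x} {x′} {y} {y′} (h , h′) (k , k′) = mono {x} {x′} {y} {y′} h k , mono {x′} {x} {y′} {y} h′ k′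
    where
    swap : ∀ x y → x + y ≲ y + x
    swap x y = ≋⇒≲ (pointwise (λ n → ℚP.+-comm (seq x n) (seq y n)))
    mono : ∀ {x x′ y y′} → x ≲ x′ → y ≲ y′ → x + y ≲ x′ + y′
    mono {x} {x′} {y} {y′} h k = ≲-trans (+-monoˡ-≲ y h) (≲-trans (swap x′ y) (≲-trans (+-monoˡ-≲ x′ k) (swap y′ x′)))

  ε/a*a≡ε : ∀ {a} ε → 0ℚ ℚ.< a → ε ℚ.* Rational.recip a ℚ.* a ≡ ε
  ε/a*a≡ε {a} ε 0<a = trans (solve 3 (λ e r a → e :* r :* a := e :* (a :* r)) refl ε (Rational.recip a) a)
    (trans (cong (ε ℚ.*_) (Rational.recip-inverse (Rational.<⇒≢0 0<a))) (ℚP.*-identityʳ ε))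

  ε/a-pos : ∀ {ε a} → 0ℚ ℚ.< ε → 0ℚ ℚ.< a → 0ℚ ℚ.< ε ℚ.* Rational.recip a
  ε/a-pos 0<ε 0<a = Rational.*-pos 0<ε (Rational.recip-pos 0<a)

  *-close : ∀ p p′ q {δ ε B} → p ℚ.≤ p′ ℚ.+ δ → p′ ℚ.≤ p ℚ.+ δ → ℚ.∣ q ∣ ℚ.≤ B → δ ℚ.* B ≡ ε →
            p ℚ.* q ℚ.≤ p′ ℚ.* q ℚ.+ ε
  *-close p p′ q {δ} {ε} {B} h k l δB≡ε = subst (ℚ._≤ p′ ℚ.* q ℚ.+ ε)
    (solve 3 (λ p p′ q → p′ :* q :+ (p :- p′) :* q := p :* q) refl p p′ q)
    (ℚP.+-monoʳ-≤ (p′ ℚ.* q) (ℚP.≤-trans (Rational.p≤∣p∣ ((p ℚ.- p′) ℚ.* q))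
      (subst (ℚ.∣ (p ℚ.- p′) ℚ.* q ∣ ℚ.≤_) δB≡ε
        (Rational.*-mono-≤-∣∣ {δ} {B} (p ℚ.- p′) q (Rational.∣p-q∣≤ h k) l))))

  module _ {x x′ : ℝ} (y : ℝ) (h : x ≲ x′) (k : x′ ≲ x) where

    private
      combine : ∀ K {B} ε {δ} → (∀ n → K ℕ.≤ n → ℚ.∣ seq y n ∣ ℚ.≤ B) →
                (∃ λ N → ∀ n → N ℕ.≤ n → seq x n ℚ.≤ seq x′ n ℚ.+ δ) →
                (∃ λ N → ∀ n → N ℕ.≤ n → seq x′ n ℚ.≤ seq x n ℚ.+ δ) → δ ℚ.* B ≡ ε →
                ∃ λ N → ∀ n → N ℕ.≤ n → seq x n ℚ.* seq y n ℚ.≤ seq x′ n ℚ.* seq y n ℚ.+ ε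
      combine K ε hK (M , hM) (N , kN) e = K ℕ.⊔ (M ℕ.⊔ N) , λ n p →
        *-close (seq x n) (seq x′ n) (seq y n)
          (hM n (ℕP.m⊔n≤o⇒m≤o M N (ℕP.m⊔n≤o⇒n≤o K (M ℕ.⊔ N) p)))
          (kN n (ℕP.m⊔n≤o⇒n≤o M N (ℕP.m⊔n≤o⇒n≤o K (M ℕ.⊔ N) p)))
          (hK n (ℕP.m⊔n≤o⇒m≤o K (M ℕ.⊔ N) p)) e

      bounded : ∀ B → 0ℚ ℚ.< B → ∀ K → (∀ n → K ℕ.≤ n → ℚ.∣ seq y n ∣ ℚ.≤ B) → x * y ≲ x′ * y
      bounded B 0<B K hK = mk≲ {x * y} {x′ * y} (λ ε 0<ε →
        combine K ε hK (eventually h _ (ε/a-pos 0<ε 0<B)) (eventually k _ (ε/a-pos 0<ε 0<B)) (ε/a*a≡ε ε 0<B))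

    -- The factor `y` may have either sign, so both inequalities between x and x′ are used: they
    -- bound the absolute value of x - x′ by ε / B, where B bounds y.
    *-monoʳ-≲ : x * y ≲ x′ * y
    *-monoʳ-≲ = let (B , 0<B , K , hK) = eventually-bounded y in bounded B 0<B K hK

  *-congʳ : ∀ {x x′} y → x ≋ x′ → x * y ≋ x′ * y
  *-congʳ {x} {x′} y (h , k) = *-monoʳ-≲ {x} {x′} y h k , *-monoʳ-≲ {x′} {x} y k h

  *-comm : ∀ x y → x * y ≋ y * x
  *-comm x y = pointwise (λ n → ℚP.*-comm (seq x n) (seq y n))

  *-cong : ∀ {x x′ y y′} → x ≋ x′ → y ≋ y′ → x * y ≋ x′ * y′
  *-cong {x} {x′} {y} {y′} h k = ≋-trans (*-congʳ {x} {x′} y h)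
    (≋-trans (*-comm x′ y) (≋-trans (*-congʳ {y} {y′} x′ k) (*-comm y′ x′)))

  -- The factors are only known to be at least -δ, so (p + δ)(q + δ) is expanded: p q + ε is this
  -- product plus ε - δ (p + q + δ). The choice δ = ε / (a + b + 1 + ε) makes the last difference
  -- nonnegative; the summand 1 + ε in the denominator is there to dominate δ itself.
  *-nonneg-estimate : ∀ p q {a b δ ε} → 0ℚ ℚ.≤ δ → 0ℚ ℚ.≤ p ℚ.+ δ → 0ℚ ℚ.≤ q ℚ.+ δ → ℚ.∣ p ∣ ℚ.≤ a → ℚ.∣ q ∣ ℚ.≤ b →
                      δ ℚ.≤ 1ℚ ℚ.+ ε → δ ℚ.* (a ℚ.+ b ℚ.+ (1ℚ ℚ.+ ε)) ≡ ε → 0ℚ ℚ.≤ p ℚ.* q ℚ.+ ε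
  *-nonneg-estimate p q {a} {b} {δ} {ε} 0≤δ hp hq p≤a q≤b δ≤1+ε δD≡ε = subst (0ℚ ℚ.≤_)
    (solve 4 (λ p q d e → (p :+ d) :* (q :+ d) :+ (e :- d :* (p :+ q :+ d)) := p :* q :+ e) refl p q δ ε)
    (ℚP.+-mono-≤ {0ℚ} {(p ℚ.+ δ) ℚ.* (q ℚ.+ δ)} {0ℚ} (0≤*ℚ hp hq)
      (p≤q⇒0≤q-p (subst (δ ℚ.* (p ℚ.+ q ℚ.+ δ) ℚ.≤_) δD≡ε
        (ℚP.*-monoˡ-≤-nonNeg δ {{ℚ.nonNegative 0≤δ}} (ℚP.+-mono-≤ (ℚP.+-mono-≤
          (ℚP.≤-trans (Rational.p≤∣p∣ p) p≤a) (ℚP.≤-trans (Rational.p≤∣p∣ q) q≤b)) δ≤1+ε)))))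

  0<1+ε : ∀ {ε} → 0ℚ ℚ.< ε → 0ℚ ℚ.< 1ℚ ℚ.+ ε
  0<1+ε 0<ε = ℚP.+-mono-< (ℚP.positive⁻¹ 1ℚ) 0<ε

  ε≤a+[1+ε] : ∀ {a ε} → 0ℚ ℚ.< a → ε ℚ.≤ a ℚ.+ (1ℚ ℚ.+ ε)
  ε≤a+[1+ε] {a} {ε} 0<a = subst (ℚ._≤ a ℚ.+ (1ℚ ℚ.+ ε)) (ℚP.+-identityˡ ε)
    (subst (0ℚ ℚ.+ ε ℚ.≤_) (ℚP.+-assoc a 1ℚ ε) (ℚP.+-monoˡ-≤ ε (ℚP.<⇒≤ (ℚP.+-mono-< 0<a (ℚP.positive⁻¹ 1ℚ)))))

  δ*a≡ε≤a⇒δ≤1 : ∀ {a δ ε} → 0ℚ ℚ.< a → ε ℚ.≤ a → δ ℚ.* a ≡ ε → δ ℚ.≤ 1ℚ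
  δ*a≡ε≤a⇒δ≤1 {a} {δ} 0<a ε≤a δa≡ε = ℚP.*-cancelʳ-≤-pos a {{ℚ.positive 0<a}}
    (subst₂ ℚ._≤_ (sym δa≡ε) (sym (ℚP.*-identityˡ a)) ε≤a)

  module _ {x y : ℝ} (hx : 0ℝ ≲ x) (hy : 0ℝ ≲ y) where

    private
      combine : ∀ {a b} K L ε {δ} → 0ℚ ℚ.< a ℚ.+ b → 0ℚ ℚ.< ε → 0ℚ ℚ.< δ →
                (∀ n → K ℕ.≤ n → ℚ.∣ seq x n ∣ ℚ.≤ a) → (∀ n → L ℕ.≤ n → ℚ.∣ seq y n ∣ ℚ.≤ b) →
                (∃ λ N → ∀ n → N ℕ.≤ n → 0ℚ ℚ.≤ seq x n ℚ.+ δ) →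
                (∃ λ N → ∀ n → N ℕ.≤ n → 0ℚ ℚ.≤ seq y n ℚ.+ δ) → δ ℚ.* (a ℚ.+ b ℚ.+ (1ℚ ℚ.+ ε)) ≡ ε →
                ∃ λ N → ∀ n → N ℕ.≤ n → 0ℚ ℚ.≤ seq x n ℚ.* seq y n ℚ.+ ε
      combine K L ε 0<a+b 0<ε 0<δ hK hL (M , hM) (N , hN) e = (K ℕ.⊔ L) ℕ.⊔ (M ℕ.⊔ N) , λ n p →
        *-nonneg-estimate (seq x n) (seq y n) (ℚP.<⇒≤ 0<δ)
          (hM n (ℕP.m⊔n≤o⇒m≤o M N (ℕP.m⊔n≤o⇒n≤o (K ℕ.⊔ L) (M ℕ.⊔ N) p)))
          (hN n (ℕP.m⊔n≤o⇒n≤o M N (ℕP.m⊔n≤o⇒n≤o (K ℕ.⊔ L) (M ℕ.⊔ N) p)))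
          (hK n (ℕP.m⊔n≤o⇒m≤o K L (ℕP.m⊔n≤o⇒m≤o (K ℕ.⊔ L) (M ℕ.⊔ N) p)))
          (hL n (ℕP.m⊔n≤o⇒n≤o K L (ℕP.m⊔n≤o⇒m≤o (K ℕ.⊔ L) (M ℕ.⊔ N) p)))
          (ℚP.≤-trans (δ*a≡ε≤a⇒δ≤1 (ℚP.+-mono-< 0<a+b (0<1+ε 0<ε)) (ε≤a+[1+ε] 0<a+b) e) (p≤p+ε 1ℚ 0<ε)) e

      bounded : ∀ a → 0ℚ ℚ.< a → ∀ K → (∀ n → K ℕ.≤ n → ℚ.∣ seq x n ∣ ℚ.≤ a) →
                ∀ b → 0ℚ ℚ.< b → ∀ L → (∀ n → L ℕ.≤ n → ℚ.∣ seq y n ∣ ℚ.≤ b) → 0ℝ ≲ x * y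
      bounded a 0<a K hK b 0<b L hL = mk≲ {0ℝ} {x * y} λ ε 0<ε →
        let 0<D = ℚP.+-mono-< (ℚP.+-mono-< 0<a 0<b) (0<1+ε 0<ε) in
        combine K L ε (ℚP.+-mono-< 0<a 0<b) 0<ε (ε/a-pos 0<ε 0<D) hK hL
          (eventually hx _ (ε/a-pos 0<ε 0<D)) (eventually hy _ (ε/a-pos 0<ε 0<D)) (ε/a*a≡ε ε 0<D)

    0≲* : 0ℝ ≲ x * y
    0≲* = let (a , 0<a , K , hK) = eventually-bounded x
              (b , 0<b , L , hL) = eventually-bounded y
          in bounded a 0<a K hK b 0<b L hL

  +-assoc : ∀ x y z → (x + y) + z ≋ x + (y + z)
  +-assoc x y z = pointwise {(x + y) + z} {x + (y + z)} (λ n → ℚP.+-assoc (seq x n) (seq y n) (seq z n))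

  +-identityˡ : ∀ x → 0ℝ + x ≋ x
  +-identityˡ x = pointwise {0ℝ + x} {x} (λ n → ℚP.+-identityˡ (seq x n))

  +-identityʳ : ∀ x → x + 0ℝ ≋ x
  +-identityʳ x = pointwise {x + 0ℝ} {x} (λ n → ℚP.+-identityʳ (seq x n))

  +-inverseˡ : ∀ x → - x + x ≋ 0ℝ
  +-inverseˡ x = pointwise { - x + x} {0ℝ} (λ n → ℚP.+-inverseˡ (seq x n))

  +-inverseʳ : ∀ x → x + - x ≋ 0ℝ
  +-inverseʳ x = pointwise {x + - x} {0ℝ} (λ n → ℚP.+-inverseʳ (seq x n))

  -‿cong : ∀ {x y} → x ≋ y → - x ≋ - y
  -‿cong {x} {y} (h , k) = neg-antimono-≲ {y} {x} k , neg-antimono-≲ {x} {y} h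

  +-comm : ∀ x y → x + y ≋ y + x
  +-comm x y = pointwise {x + y} {y + x} (λ n → ℚP.+-comm (seq x n) (seq y n))

  *-assoc : ∀ x y z → (x * y) * z ≋ x * (y * z)
  *-assoc x y z = pointwise {(x * y) * z} {x * (y * z)} (λ n → ℚP.*-assoc (seq x n) (seq y n) (seq z n))

  *-identityˡ : ∀ x → fromℚ 1ℚ * x ≋ x
  *-identityˡ x = pointwise {fromℚ 1ℚ * x} {x} (λ n → ℚP.*-identityˡ (seq x n))

  *-identityʳ : ∀ x → x * fromℚ 1ℚ ≋ x
  *-identityʳ x = pointwise {x * fromℚ 1ℚ} {x} (λ n → ℚP.*-identityʳ (seq x n))

  *-distribˡ-+ : ∀ x y z → x * (y + z) ≋ x * y + x * z
  *-distribˡ-+ x y z = pointwise {x * (y + z)} {x * y + x * z} (λ n → ℚP.*-distribˡ-+ (seq x n) (seq y n) (seq z n))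

  *-distribʳ-+ : ∀ x y z → (y + z) * x ≋ y * x + z * x
  *-distribʳ-+ x y z = pointwise {(y + z) * x} {y * x + z * x} (λ n → ℚP.*-distribʳ-+ (seq x n) (seq y n) (seq z n))

  +-isMonoid : IsMonoid _≋_ _+_ 0ℝ
  +-isMonoid = record
    { isSemigroup = record
      { isMagma = record
        { isEquivalence = record { refl = ≋-refl ; sym = ≋-sym ; trans = ≋-trans }
        ; ∙-cong = λ {x} {x′} {y} {y′} → +-cong {x} {x′} {y} {y′} }
      ; assoc = +-assoc }
    ; identity = +-identityˡ , +-identityʳ }

  -- Stated for an arbitrary f, so that the type checker need not unfold the negation of ℝ.
  congruent₁ : (f : ℝ → ℝ) → (∀ {x y} → x ≋ y → f x ≋ f y) → Congruent₁ _≋_ f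
  congruent₁ f h {x} {y} = h {x} {y}

  +-isAbelianGroup : IsAbelianGroup _≋_ _+_ 0ℝ (-_)
  +-isAbelianGroup = record
    { isGroup = record
      { isMonoid = +-isMonoid
      ; inverse = +-inverseˡ , +-inverseʳ
      ; ⁻¹-cong = congruent₁ (-_) (λ {x} {y} → -‿cong {x} {y}) }
    ; comm = +-comm }

  isRing : IsRing _≋_ _+_ _*_ (-_) 0ℝ (fromℚ 1ℚ)
  isRing = record
      { +-isAbelianGroup = +-isAbelianGroup
      ; *-cong = λ {x} {x′} {y} {y′} → *-cong {x} {x′} {y} {y′}
      ; *-assoc = *-assoc
      ; *-identity = *-identityˡ , *-identityʳ
      ; distrib = *-distribˡ-+ , *-distribʳ-+ }

  isCommutativeRing : IsCommutativeRing _≋_ _+_ _*_ (-_) 0ℝ (fromℚ 1ℚ)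
  isCommutativeRing = record
    { isRing = isRing
    ; *-comm = *-comm }

  0<x⇒0<∣x∣ : ∀ {x} → 0ℝ < x → 0ℝ < ∣ x ∣
  0<x⇒0<∣x∣ {x} (ε , 0<ε , N , h) = ε , 0<ε , N , λ n N≤n → ℚP.≤-trans (h n N≤n) (Rational.p≤∣p∣ (seq x n))

  positive⇒≢0 : ∀ x ((ε , _ , N , _) : 0ℝ < x) → ∀ n → N ℕ.≤ n → seq x n ≢ 0ℚ
  positive⇒≢0 x (ε , 0<ε , N , h) n N≤n =
    Rational.<⇒≢0 (ℚP.<-≤-trans 0<ε (subst (ℚ._≤ seq x n) (ℚP.+-identityˡ ε) (h n N≤n)))

  reciprocal : ∀ x y → 0ℝ < x → (∀ n → seq y n ≡ Rational.recip (seq x n)) → ∃ λ y → x * y ≋ fromℚ 1ℚ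
  reciprocal x y 0<x e = y , eventually-≡⇒≋ {x * y} {fromℚ 1ℚ} (proj₁ (proj₂ (proj₂ 0<x)))
    (λ n N≤n → trans (cong (seq x n ℚ.*_) (e n)) (Rational.recip-inverse (positive⇒≢0 x 0<x n N≤n)))

  archimedeanℝ : ∀ x → ∃ λ n → x ≲ fromℤ (+ n)
  archimedeanℝ x = let (B , _ , N , h) = eventually-bounded x in
    ℤ.∣ ℚ.numerator B ∣ , eventually-≤⇒≲ {x} {fromℤ (+ ℤ.∣ ℚ.numerator B ∣)} N
      (λ n N≤n → ℚP.≤-trans (Rational.p≤∣p∣ (seq x n)) (ℚP.≤-trans (h n N≤n) (Rational.≤∣↥∣ B)))

  module _ (em : ExcludedMiddle 0ℓ) where

    ≴⇒> : ∀ {x y} → ¬ x ≲ y → y < x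
    ≴⇒> {x} {y} h with em {y < x}
    ... | yes k = k
    ... | no k  = contradiction (wrap k) h

    ≲-total : ∀ x y → x ≲ y ⊎ y ≲ x
    ≲-total x y with em {y < x}
    ... | yes h = inj₂ (<⇒≲ {y} {x} h)
    ... | no h  = inj₁ (wrap h)

    ℝ-orderedField : OrderedField
    ℝ-orderedField = record
      { Carrier = ℝ ; _≈_ = _≋_ ; _≤_ = _≲_ ; _+_ = _+_ ; _*_ = _*_ ; -_ = -_ ; 0# = 0ℝ ; 1# = fromℚ 1ℚ
      ; isCommutativeRing = isCommutativeRing
      ; fromℤ = fromℤ
      ; fromℤ-+ = λ i j → pointwise {fromℤ (i ℤ.+ j)} {fromℤ i + fromℤ j} (λ _ → /1-+ i j)
      ; fromℤ-* = λ i j → pointwise {fromℤ (i ℤ.* j)} {fromℤ i * fromℤ j} (λ _ → /1-* i j)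
      ; fromℤ-neg = λ i → pointwise {fromℤ (ℤ.- i)} { - fromℤ i} (λ _ → /1-neg i)
      ; fromℤ-0 = pointwise {fromℤ (+ 0)} {0ℝ} (λ _ → refl)
      ; fromℤ-1 = pointwise {fromℤ (+ 1)} {fromℚ 1ℚ} (λ _ → refl)
      ; ≤-reflexive = ≋⇒≲
      ; ≤-antisym = _,_
      ; ≤-trans = ≲-trans
      ; ≤-total = ≲-total
      ; +-monoˡ-≤ = λ z {x} {y} → +-monoˡ-≲ z {x} {y}
      ; *-nonneg = λ {x} {y} → 0≲* {x} {y}
      ; 1≰0 = λ h → unwrap h (1ℚ , ℚP.positive⁻¹ 1ℚ , 0 , λ _ _ → ℚP.≤-refl)
      ; inverse = λ x x≰0 → reciprocal x (inverse x (0<x⇒0<∣x∣ {x} (≴⇒> {x} {0ℝ} x≰0))) (≴⇒> {x} {0ℝ} x≰0) (λ _ → refl)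
      ; archimedean = archimedeanℝ
      }

-- Finite sums and the odd parts of the integers in [N , 2N).

module FiniteSums where

  open import Axiom.ExcludedMiddle using (ExcludedMiddle)
  open import Data.Empty using (⊥-elim)
  open import Data.List using (List; _++_; map; filter; length; upTo; applyUpTo; cartesianProduct)
  import Data.List.Properties as ListP
  open import Data.Nat using (ℕ; zero; suc; _+_; _*_; _∸_; _^_; _≤_; _<_; _≤?_; z≤n; s≤s)
  open import Data.Nat.Properties
  open import Data.Nat.Induction using (<-rec)
  open import Data.Product using (∃; ∃₂; _×_; _,_; proj₁; proj₂)
  open import Data.Sum using (_⊎_; inj₁; inj₂)
  open import Function using (_∘_)
  open import Level using (0ℓ)
  open import Relation.Binary.PropositionalEquality
  open import Relation.Binary.Definitions using (tri<; tri≈; tri>)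
  open import Relation.Nullary using (¬_; Dec; yes; no; contradiction)
  open import Data.Nat.Solver using (module +-*-Solver)

  Σ< : ℕ → (ℕ → ℕ) → ℕ
  Σ< zero    f = 0
  Σ< (suc n) f = Σ< n f + f n

  Σ-cong : ∀ n {f g : ℕ → ℕ} → (∀ i → i < n → f i ≡ g i) → Σ< n f ≡ Σ< n g
  Σ-cong zero    h = refl
  Σ-cong (suc n) h = cong₂ _+_ (Σ-cong n (λ i i<n → h i (m<n⇒m<1+n i<n))) (h n ≤-refl)

  Σ-mono : ∀ n {f g : ℕ → ℕ} → (∀ i → i < n → f i ≤ g i) → Σ< n f ≤ Σ< n g
  Σ-mono zero    h = z≤n
  Σ-mono (suc n) h = +-mono-≤ (Σ-mono n (λ i i<n → h i (m<n⇒m<1+n i<n))) (h n ≤-refl)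

  Σ-+ : ∀ n (f g : ℕ → ℕ) → Σ< n (λ i → f i + g i) ≡ Σ< n f + Σ< n g
  Σ-+ zero    f g = refl
  Σ-+ (suc n) f g = trans (cong (_+ (f n + g n)) (Σ-+ n f g))
    (solve 4 (λ a b c d → a :+ b :+ (c :+ d) := a :+ c :+ (b :+ d)) refl (Σ< n f) (Σ< n g) (f n) (g n))
    where open +-*-Solver

  Σ-zero : ∀ n {f : ℕ → ℕ} → (∀ i → i < n → f i ≡ 0) → Σ< n f ≡ 0
  Σ-zero zero    h = refl
  Σ-zero (suc n) h = cong₂ _+_ (Σ-zero n (λ i i<n → h i (m<n⇒m<1+n i<n))) (h n ≤-refl)

  Σ-swap : ∀ m n (f : ℕ → ℕ → ℕ) → Σ< m (λ i → Σ< n (f i)) ≡ Σ< n (λ j → Σ< m (λ i → f i j))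
  Σ-swap zero    n f = sym (Σ-zero n (λ _ _ → refl))
  Σ-swap (suc m) n f = trans (cong (_+ Σ< n (f m)) (Σ-swap m n f)) (sym (Σ-+ n _ _))

  Σ-split : ∀ m n (f : ℕ → ℕ) → Σ< (m + n) f ≡ Σ< m f + Σ< n (λ i → f (m + i))
  Σ-split m zero    f = trans (cong (λ k → Σ< k f) (+-identityʳ m)) (sym (+-identityʳ _))
  Σ-split m (suc n) f = trans (cong (λ k → Σ< k f) (+-suc m n))
    (trans (cong (_+ f (m + n)) (Σ-split m n f)) (+-assoc (Σ< m f) _ _))

  Σ-head : ∀ n (f : ℕ → ℕ) → Σ< (suc n) f ≡ f 0 + Σ< n (f ∘ suc)
  Σ-head n f = Σ-split 1 n f

  Σ-const-≤ : ∀ n {f : ℕ → ℕ} c → (∀ i → i < n → f i ≤ c) → Σ< n f ≤ n * c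
  Σ-const-≤ zero    c h = z≤n
  Σ-const-≤ (suc n) c h = ≤-trans
    (+-mono-≤ (Σ-const-≤ n c (λ i i<n → h i (m<n⇒m<1+n i<n))) (h n ≤-refl)) (≤-reflexive (+-comm (n * c) c))

  Σ-monoˡ : ∀ {m n} (f : ℕ → ℕ) → m ≤ n → Σ< m f ≤ Σ< n f
  Σ-monoˡ {m} {n} f m≤n = subst (λ k → Σ< m f ≤ Σ< k f) (m+[n∸m]≡n m≤n)
    (subst (Σ< m f ≤_) (sym (Σ-split m (n ∸ m) f)) (m≤m+n _ _))

  Σ-support : ∀ n {f : ℕ → ℕ} → (∀ i → n ≤ i → f i ≡ 0) → ∀ m → Σ< m f ≤ Σ< n f
  Σ-support n         h zero    = z≤n
  Σ-support n {f} h (suc m) with suc m ≤? n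
  ... | yes m<n = Σ-monoˡ f m<n
  ... | no m≮n  = subst (_≤ Σ< n f) (trans (sym (+-identityʳ _)) (cong (Σ< m f +_) (sym (h m (≤-pred (≰⇒> m≮n))))))
    (Σ-support n h m)

  -- With a = i + 1 and f running over a row of a double sum, the window indexes the row by the
  -- distance from i. It may reach beyond `n`, where f vanishes.
  window-≤ : ∀ n a k {f : ℕ → ℕ} → (∀ i → n ≤ i → f i ≡ 0) → Σ< k (λ t → f (a + t)) ≤ Σ< n f
  window-≤ n a k {f} h = ≤-trans (m≤n+m _ (Σ< a f)) (subst (_≤ Σ< n f) (Σ-split a k f) (Σ-support n h (a + k)))

  window-≥ : ∀ n a k {f : ℕ → ℕ} → (∀ i → i < a → f i ≡ 0) → (∀ i → a + k ≤ i → f i ≡ 0) →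
             Σ< n f ≤ Σ< k (λ t → f (a + t))
  window-≥ n a k {f} h h′ = subst (Σ< n f ≤_)
    (trans (Σ-split a k f) (cong (_+ Σ< k (λ t → f (a + t))) (Σ-zero a h))) (Σ-support (a + k) h′ n)

  -- Halve until an odd number is left. The integer decomposed is `suc c`, since 0 has no odd part;
  -- it is even exactly when c = 2d + 1, and then its half is `suc d`.
  odd-decomposition : ∀ c → ∃₂ λ i k → suc c ≡ 2 ^ i * suc (2 * k)
  odd-decomposition = <-rec _ λ c rec → go c rec (parity c)
    where
    parity : ∀ c → (∃ λ k → c ≡ 2 * k) ⊎ (∃ λ k → c ≡ suc (2 * k))
    parity zero    = inj₁ (0 , refl)
    parity (suc c) with parity c
    ... | inj₁ (k , e) = inj₂ (k , cong suc e)
    ... | inj₂ (k , e) = inj₁ (suc k , cong suc (trans e (sym (+-suc k (k + 0)))))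
    go : ∀ c → (∀ {d} → d < c → ∃₂ λ i k → suc d ≡ 2 ^ i * suc (2 * k)) →
         (∃ λ k → c ≡ 2 * k) ⊎ (∃ λ k → c ≡ suc (2 * k)) → ∃₂ λ i k → suc c ≡ 2 ^ i * suc (2 * k)
    go c rec (inj₁ (k , e)) = 0 , k , cong suc (trans e (sym (+-identityʳ _)))
    go c rec (inj₂ (d , e)) = let (i , k , e′) = rec {d} (subst (d <_) (sym e) (s≤s (m≤m+n d _))) in
      suc i , k , trans (cong suc e) (trans (sym (*-suc 2 d)) (trans (cong (2 *_) e′) (sym (*-assoc 2 (2 ^ i) _))))

  odd-part-unique : ∀ i j k l → 2 ^ i * suc (2 * k) ≡ 2 ^ j * suc (2 * l) → k ≡ l
  odd-part-unique zero zero k l e = *-cancelˡ-≡ k l 2 (suc-injective (trans (sym (*-identityˡ _)) (trans e (*-identityˡ _))))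
  odd-part-unique zero (suc j) k l e = ⊥-elim (even≢odd (2 ^ j * suc (2 * l)) k
    (trans (sym (*-assoc 2 (2 ^ j) _)) (trans (sym e) (*-identityˡ _))))
  odd-part-unique (suc i) zero k l e = ⊥-elim (even≢odd (2 ^ i * suc (2 * k)) l
    (trans (sym (*-assoc 2 (2 ^ i) _)) (trans e (*-identityˡ _))))
  odd-part-unique (suc i) (suc j) k l e = odd-part-unique i j k l
    (*-cancelˡ-≡ _ _ 2 (trans (sym (*-assoc 2 (2 ^ i) _)) (trans e (*-assoc 2 (2 ^ j) _))))

  -- The argument c stands for the integer c + 1, and `oddIndex c` is the position, counted from 0,
  -- of its odd part in 1, 3, 5, ....
  exponent oddIndex : ℕ → ℕ
  exponent c = proj₁ (odd-decomposition c)
  oddIndex c = proj₁ (proj₂ (odd-decomposition c))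

  oddIndex-spec : ∀ c → suc c ≡ 2 ^ exponent c * suc (2 * oddIndex c)
  oddIndex-spec c = proj₂ (proj₂ (odd-decomposition c))

  oddIndex-double : ∀ n → oddIndex (suc n + n) ≡ oddIndex n
  oddIndex-double n = odd-part-unique (exponent (suc n + n)) (suc (exponent n)) _ _
    (trans (sym (oddIndex-spec (suc n + n)))
    (trans (cong suc (trans (sym (+-suc n n)) (cong (n +_) (sym (+-identityʳ (suc n))))))
    (trans (cong (2 *_) (oddIndex-spec n)) (sym (*-assoc 2 (2 ^ exponent n) _)))))

  oddIndex-odd : ∀ n → oddIndex (n + n) ≡ n
  oddIndex-odd n = odd-part-unique (exponent (n + n)) 0 _ _
    (trans (sym (oddIndex-spec (n + n))) (trans (cong (λ m → suc (n + m)) (sym (+-identityʳ n))) (sym (*-identityˡ _))))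

  -- Every integer of [N , 2N) is an odd number below 2N times a power of 2, and every such odd number occurs once:
  -- passing from N to N + 1 replaces N by 2N, with the same odd part, and adds 2N + 1.
  reindex : ∀ (f : ℕ → ℕ) n → Σ< (suc n) (λ i → f (oddIndex (n + i))) ≡ Σ< (suc n) f
  reindex f zero    = cong f (oddIndex-odd 0)
  reindex f (suc n) = begin
    Σ< n (λ i → g (suc n + i)) + g (suc n + n) + g (suc n + suc n)
      ≡⟨ cong₂ (λ a b → Σ< n (λ i → g (suc n + i)) + f a + f b) (oddIndex-double n) (oddIndex-odd (suc n)) ⟩
    Σ< n (λ i → g (suc n + i)) + g n + f (suc n)
      ≡⟨ cong (_+ f (suc n)) (+-comm (Σ< n (λ i → g (suc n + i))) (g n)) ⟩
    g n + Σ< n (λ i → g (suc n + i)) + f (suc n)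
      ≡⟨ cong (_+ f (suc n)) (cong₂ _+_ (cong g (sym (+-identityʳ n))) (Σ-cong n (λ i _ → cong g (sym (+-suc n i))))) ⟩
    g (n + 0) + Σ< n (λ i → g (n + suc i)) + f (suc n)
      ≡⟨ cong (_+ f (suc n)) (sym (Σ-head n (λ i → g (n + i)))) ⟩
    Σ< (suc n) (λ i → g (n + i)) + f (suc n)
      ≡⟨ cong (_+ f (suc n)) (reindex f n) ⟩
    Σ< (suc n) f + f (suc n) ∎
    where
    open ≡-Reasoning
    g : ℕ → ℕ
    g c = f (oddIndex c)

  -- Two integers with the same odd part and different powers of 2 differ by a factor of at least 2,
  -- which is impossible within [N , 2N).
  oddIndex-injective : ∀ n i j → i < suc n → j < suc n → oddIndex (n + i) ≡ oddIndex (n + j) → i ≡ j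
  oddIndex-injective n i j i≤n j≤n e = +-cancelˡ-≡ n i j (suc-injective (main (<-cmp (exponent (n + i)) (exponent (n + j)))))
    where
    smaller : ∀ i j → j < suc n → oddIndex (n + i) ≡ oddIndex (n + j) → ¬ exponent (n + i) < exponent (n + j)
    smaller i j j≤n e h = <-irrefl refl (begin-strict
      suc (n + j)                                             ≤⟨ s≤s (+-monoʳ-≤ n (≤-pred j≤n)) ⟩
      suc (n + n)                                             <⟨ ≤-refl ⟩
      suc (suc (n + n))                                       ≡⟨ cong suc (sym (+-suc n n)) ⟩
      suc n + suc n                                           ≡⟨ cong (suc n +_) (sym (+-identityʳ (suc n))) ⟩
      2 * suc n                                               ≤⟨ *-monoʳ-≤ 2 (s≤s (m≤m+n n i)) ⟩
      2 * suc (n + i)                                         ≡⟨ cong (2 *_) (oddIndex-spec (n + i)) ⟩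
      2 * (2 ^ exponent (n + i) * suc (2 * oddIndex (n + i))) ≡⟨ sym (*-assoc 2 (2 ^ exponent (n + i)) _) ⟩
      2 ^ suc (exponent (n + i)) * suc (2 * oddIndex (n + i)) ≤⟨ *-monoˡ-≤ _ (^-monoʳ-≤ 2 h) ⟩
      2 ^ exponent (n + j) * suc (2 * oddIndex (n + i))       ≡⟨ cong (λ k → 2 ^ exponent (n + j) * suc (2 * k)) e ⟩
      2 ^ exponent (n + j) * suc (2 * oddIndex (n + j))       ≡⟨ sym (oddIndex-spec (n + j)) ⟩
      suc (n + j) ∎)
      where open ≤-Reasoning
    main : _ → suc (n + i) ≡ suc (n + j)
    main (tri< h _ _) = contradiction h (smaller i j j≤n e)
    main (tri> _ _ h) = contradiction h (smaller j i i≤n (sym e))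
    main (tri≈ _ h _) = trans (oddIndex-spec (n + i))
      (trans (cong₂ (λ a k → 2 ^ a * suc (2 * k)) h e) (sym (oddIndex-spec (n + j))))

  -- Indicators of propositions, and lengths of filtered lists as sums of indicators.

  module Indicator (em : ExcludedMiddle 0ℓ) where

    ind : Set → ℕ
    ind P with em {P}
    ... | yes _ = 1
    ... | no _  = 0

    ind-yes : ∀ {P} → P → ind P ≡ 1
    ind-yes {P} p with em {P}
    ... | yes _ = refl
    ... | no ¬p = contradiction p ¬p

    ind-no : ∀ {P} → ¬ P → ind P ≡ 0
    ind-no {P} ¬p with em {P}
    ... | yes p = contradiction p ¬p
    ... | no _  = refl

    ind-mono : ∀ {P Q} → (P → Q) → ind P ≤ ind Q
    ind-mono {P} {Q} f with em {P} | em {Q}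
    ... | no _  | _     = z≤n
    ... | yes _ | yes _ = ≤-refl
    ... | yes p | no ¬q = contradiction (f p) ¬q

    ind-cong : ∀ {P Q} → (P → Q) → (Q → P) → ind P ≡ ind Q
    ind-cong f g = ≤-antisym (ind-mono f) (ind-mono g)

    ind-≤1 : ∀ P → ind P ≤ 1
    ind-≤1 P with em {P}
    ... | yes _ = ≤-refl
    ... | no _  = z≤n

    ind-⊎ : ∀ {P Q R} → (P → Q ⊎ R) → ind P ≤ ind Q + ind R
    ind-⊎ {P} {Q} {R} f with em {P} | em {Q} | em {R}
    ... | no _  | _     | _     = z≤n
    ... | yes _ | yes _ | _     = s≤s z≤n
    ... | yes _ | no _  | yes _ = s≤s z≤n
    ... | yes p | no ¬q | no ¬r with f p
    ... | inj₁ q = contradiction q ¬q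
    ... | inj₂ r = contradiction r ¬r

    ind-disjoint : ∀ {P Q R} → (P → R) → (Q → R) → (P → ¬ Q) → ind P + ind Q ≤ ind R
    ind-disjoint {P} {Q} {R} f g h with em {P} | em {Q} | em {R}
    ... | no _  | no _  | _     = z≤n
    ... | yes p | yes q | _     = contradiction q (h p)
    ... | yes _ | no _  | yes _ = ≤-refl
    ... | no _  | yes _ | yes _ = ≤-refl
    ... | yes p | no _  | no ¬r = contradiction (f p) ¬r
    ... | no _  | yes q | no ¬r = contradiction (g q) ¬r

    module _ {A : Set} {P : A → Set} (P? : ∀ a → Dec (P a)) where

      length-filter-applyUpTo : ∀ (f : ℕ → A) n → length (filter P? (applyUpTo f n)) ≡ Σ< n (λ i → ind (P (f i)))
      length-filter-applyUpTo f zero    = refl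
      length-filter-applyUpTo f (suc n) = trans (first (P? (f 0))) (sym (Σ-head n (λ i → ind (P (f i)))))
        where
        rest = length-filter-applyUpTo (f ∘ suc) n
        first : Dec (P (f 0)) → length (filter P? (applyUpTo f (suc n))) ≡ ind (P (f 0)) + Σ< n (λ i → ind (P (f (suc i))))
        first (yes p) = trans (cong length (ListP.filter-accept P? p)) (cong₂ _+_ (sym (ind-yes p)) rest)
        first (no ¬p) = trans (cong length (ListP.filter-reject P? ¬p)) (cong₂ _+_ (sym (ind-no ¬p)) rest)

    length-filter-cartesianProduct : ∀ {P : ℕ × ℕ → Set} (P? : ∀ p → Dec (P p)) (f g : ℕ → ℕ) m n →
      length (filter P? (cartesianProduct (applyUpTo f m) (applyUpTo g n))) ≡ Σ< m (λ i → Σ< n (λ j → ind (P (f i , g j))))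
    length-filter-cartesianProduct P? f g zero    n = refl
    length-filter-cartesianProduct {P} P? f g (suc m) n = begin
      length (filter P? (map (f 0 ,_) (applyUpTo g n) ++ rest))
        ≡⟨ cong length (ListP.filter-++ P? (map (f 0 ,_) (applyUpTo g n)) rest) ⟩
      length (filter P? (map (f 0 ,_) (applyUpTo g n)) ++ filter P? rest)
        ≡⟨ ListP.length-++ (filter P? (map (f 0 ,_) (applyUpTo g n))) ⟩
      length (filter P? (map (f 0 ,_) (applyUpTo g n))) + length (filter P? rest)
        ≡⟨ cong₂ _+_ (trans (cong (λ xs → length (filter P? xs)) (ListP.map-applyUpTo g (f 0 ,_) n))
             (length-filter-applyUpTo P? (λ j → f 0 , g j) n)) (length-filter-cartesianProduct P? (f ∘ suc) g m n) ⟩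
      Σ< n (λ j → ind (P (f 0 , g j))) + Σ< m (λ i → Σ< n (λ j → ind (P (f (suc i) , g j))))
        ≡⟨ sym (Σ-head m (λ i → Σ< n (λ j → ind (P (f i , g j))))) ⟩
      Σ< (suc m) (λ i → Σ< n (λ j → ind (P (f i , g j)))) ∎
      where
      open ≡-Reasoning
      rest = cartesianProduct (applyUpTo (f ∘ suc) m) (applyUpTo g n)

    length-filter-pairs : ∀ {P : ℕ × ℕ → Set} (P? : ∀ p → Dec (P p)) n →
      length (filter P? (cartesianProduct (map suc (upTo n)) (map suc (upTo n)))) ≡
      Σ< n (λ i → Σ< n (λ j → ind (P (suc i , suc j))))
    length-filter-pairs P? n = trans (cong (λ xs → length (filter P? (cartesianProduct xs xs))) (ListP.map-upTo suc n))
      (length-filter-cartesianProduct P? suc suc n n)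

-- The asymptotic count of close pairs in an ordered field.

module PairCounting where

  open OrderedFields
  open FiniteSums
  open import Axiom.ExcludedMiddle using (ExcludedMiddle)
  open import Data.Integer as ℤ using (ℤ; +_; -[1+_])
  import Data.Integer.Properties as ℤP
  open import Data.Nat as ℕ using (ℕ; zero; suc; z≤n; s≤s; _∸_)
  import Data.Nat.Properties as ℕP
  open import Data.Product using (∃; _×_; _,_; proj₁; proj₂)
  open import Data.Sum using (_⊎_; inj₁; inj₂; [_,_]′)
  open import Data.Nat.Solver using (module +-*-Solver)
  open import Level using (0ℓ)
  open import Relation.Binary.PropositionalEquality as ≡ using (_≡_; _≢_)
  open import Relation.Binary.Definitions using (tri<; tri≈; tri>)
  open import Relation.Nullary using (¬_; yes; no; contradiction)

  halves : ∀ k → (∃ λ h → k ≡ h ℕ.+ h) ⊎ (∃ λ h → k ≡ h ℕ.+ suc h)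
  halves zero    = inj₁ (0 , ≡.refl)
  halves (suc k) with halves k
  ... | inj₁ (h , e) = inj₂ (h , ≡.trans (≡.cong suc e) (≡.sym (ℕP.+-suc h h)))
  ... | inj₂ (h , e) = inj₁ (suc h , ≡.cong suc e)

  h+h≢h+1+h : ∀ h m → h ℕ.+ h ≢ m ℕ.+ suc m
  h+h≢h+1+h h m e = ℕP.even≢odd h m (≡.trans (≡.cong (h ℕ.+_) (ℕP.+-identityʳ h))
    (≡.trans e (≡.trans (ℕP.+-suc m m) (≡.cong (λ n → suc (m ℕ.+ n)) (≡.sym (ℕP.+-identityʳ m))))))

  -- In the limit, the pairs at distance t + 1 in [N , 2N) contribute 1 if t + 1 ≤ σ and 2 - (t + 1) / σ if σ < t + 1 ≤ 2σ,
  -- that is, weight - slope / σ.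

  weight slope : ℕ → ℕ → ℕ
  weight h t with suc t ℕ.≤? h
  ... | yes _ = 1
  ... | no _  = 2
  slope h t with suc t ℕ.≤? h
  ... | yes _ = 0
  ... | no _  = suc t

  weight-≤ : ∀ {h t} → t ℕ.< h → weight h t ≡ 1
  weight-≤ {h} {t} l with suc t ℕ.≤? h
  ... | yes _ = ≡.refl
  ... | no ¬l = contradiction l ¬l

  weight-> : ∀ h i → weight h (h ℕ.+ i) ≡ 2
  weight-> h i with suc (h ℕ.+ i) ℕ.≤? h
  ... | yes l = contradiction (ℕP.m≤m+n h i) (ℕP.<⇒≱ l)
  ... | no _  = ≡.refl

  slope-≤ : ∀ {h t} → t ℕ.< h → slope h t ≡ 0
  slope-≤ {h} {t} l with suc t ℕ.≤? h
  ... | yes _ = ≡.refl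
  ... | no ¬l = contradiction l ¬l

  slope-> : ∀ h i → slope h (h ℕ.+ i) ≡ suc (h ℕ.+ i)
  slope-> h i with suc (h ℕ.+ i) ℕ.≤? h
  ... | yes l = contradiction (ℕP.m≤m+n h i) (ℕP.<⇒≱ l)
  ... | no _  = ≡.refl

  Σ-const : ∀ n c → Σ< n (λ _ → c) ≡ n ℕ.* c
  Σ-const zero    c = ≡.refl
  Σ-const (suc n) c = ≡.trans (≡.cong (ℕ._+ c) (Σ-const n c)) (ℕP.+-comm (n ℕ.* c) c)

  Σ-weight : ∀ h m → Σ< (h ℕ.+ m) (weight h) ≡ h ℕ.+ m ℕ.* 2
  Σ-weight h m = ≡.trans (Σ-split h m (weight h)) (≡.cong₂ ℕ._+_
    (≡.trans (Σ-cong h (λ t t<h → weight-≤ t<h)) (≡.trans (Σ-const h 1) (ℕP.*-identityʳ h)))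
    (≡.trans (Σ-cong m (λ i _ → weight-> h i)) (Σ-const m 2)))

  -- The terms up to h vanish, and an arithmetic progression of m terms starting at h + 1 remains.
  -- The factor 2 avoids a division.
  Σ-slope : ∀ h m → 2 ℕ.* Σ< (h ℕ.+ m) (slope h) ≡ m ℕ.* (h ℕ.+ h ℕ.+ m ℕ.+ 1)
  Σ-slope h m = ≡.trans (≡.cong (2 ℕ.*_) (≡.trans (Σ-split h m (slope h))
      (≡.cong₂ ℕ._+_ (Σ-zero h (λ t t<h → slope-≤ t<h)) (Σ-cong m (λ i _ → slope-> h i))))) (arithmetic m)
    where
    open +-*-Solver
    arithmetic : ∀ m → 2 ℕ.* Σ< m (λ i → suc (h ℕ.+ i)) ≡ m ℕ.* (h ℕ.+ h ℕ.+ m ℕ.+ 1)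
    arithmetic zero    = ≡.refl
    arithmetic (suc m) = ≡.trans (ℕP.*-distribˡ-+ 2 (Σ< m (λ i → suc (h ℕ.+ i))) (suc (h ℕ.+ m)))
      (≡.trans (≡.cong (ℕ._+ 2 ℕ.* suc (h ℕ.+ m)) (arithmetic m))
        (solve 2 (λ h m → m :* (h :+ h :+ m :+ con 1) :+ con 2 :* (con 1 :+ (h :+ m)) :=
                          (con 1 :+ m) :* (h :+ h :+ (con 1 :+ m) :+ con 1)) ≡.refl h m))

  2*weights-even : ∀ h → 2 ℕ.* Σ< (h ℕ.+ h) (weight h) ≡ 3 ℕ.* (h ℕ.+ h)
  2*weights-even h = ≡.trans (≡.cong (2 ℕ.*_) (Σ-weight h h))
    (solve 1 (λ h → con 2 :* (h :+ h :* con 2) := con 3 :* (h :+ h)) ≡.refl h)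
    where open +-*-Solver

  2*weights-odd : ∀ h → 2 ℕ.* Σ< (h ℕ.+ suc h) (weight h) ≡ 3 ℕ.* (h ℕ.+ suc h) ℕ.+ 1
  2*weights-odd h = ≡.trans (≡.cong (2 ℕ.*_) (Σ-weight h (suc h)))
    (solve 1 (λ h → con 2 :* (h :+ (con 1 :+ h) :* con 2) := con 3 :* (h :+ (con 1 :+ h)) :+ con 1) ≡.refl h)
    where open +-*-Solver

  -- The factor 8 matches the denominator 4 log(2) s of the theorem: the limit subtracts twice the
  -- sum of slopes divided by σ, and 2 / σ = 8 / (4σ).
  8*slopes-even : ∀ h → 8 ℕ.* Σ< (h ℕ.+ h) (slope h) ≡ 3 ℕ.* (h ℕ.+ h) ℕ.^ 2 ℕ.+ 2 ℕ.* (h ℕ.+ h)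
  8*slopes-even h = ≡.trans (ℕP.*-assoc 4 2 (Σ< (h ℕ.+ h) (slope h))) (≡.trans (≡.cong (4 ℕ.*_) (Σ-slope h h))
    (solve 1 (λ h → con 4 :* (h :* (h :+ h :+ h :+ con 1)) := con 3 :* ((h :+ h) :^ 2) :+ con 2 :* (h :+ h)) ≡.refl h))
    where open +-*-Solver

  8*slopes-odd : ∀ h → 8 ℕ.* Σ< (h ℕ.+ suc h) (slope h) ≡ 3 ℕ.* (h ℕ.+ suc h) ℕ.^ 2 ℕ.+ 4 ℕ.* (h ℕ.+ suc h) ℕ.+ 1
  8*slopes-odd h = ≡.trans (ℕP.*-assoc 4 2 (Σ< (h ℕ.+ suc h) (slope h))) (≡.trans (≡.cong (4 ℕ.*_) (Σ-slope h (suc h)))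
    (solve 1 (λ h → con 4 :* ((con 1 :+ h) :* (h :+ h :+ (con 1 :+ h) :+ con 1)) :=
        con 3 :* ((h :+ (con 1 :+ h)) :^ 2) :+ con 4 :* (h :+ (con 1 :+ h)) :+ con 1) ≡.refl h))
    where open +-*-Solver

  module Counting (em : ExcludedMiddle 0ℓ) (R : OrderedField) where

    open FieldProperties R
    open Indicator em

    ≡⇒≈ : ∀ {x y} → x ≡ y → x ≈ y
    ≡⇒≈ ≡.refl = refl

    below : ℕ → Carrier → ℕ
    below M β = Σ< M (λ i → ind (β ≤ fromℕ i))

    suc-shift : ∀ M β → fromℕ (suc M) - β ≈ 1# + (fromℕ M - β)
    suc-shift M β = trans (+-cong (fromℕ-suc M) refl) (solve 3 (λ o m b → o :+ m :- b := o :+ (m :- b)) refl 1# (fromℕ M) β)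

    -- An interval of length M - β contains that many integers up to an error of 1. For β < 0 only
    -- the integers from 0 on are counted, so the error stays within 1 just when β ≥ -1.
    below-≥ : ∀ M {β} → 0# ≤ β + 1# → fromℕ M - β ≤ fromℕ (below M β) + 1#
    below-≥ zero {β} h = by-diff
      (solve 3 (λ z b o → z :+ o :- (z :- b) := b :+ o) refl (fromℕ 0) β 1#) h
    below-≥ (suc M) {β} h with em {β ≤ fromℕ M}
    ... | yes p = by-diff
      (trans (+-cong (+-cong (trans (fromℕ-+ (below M β) 1) (+-cong refl fromℤ-1)) refl) (-‿cong (suc-shift M β)))
        (solve 3 (λ b o m → b :+ o :+ o :- (o :+ m) := b :+ o :- m) refl (fromℕ (below M β)) 1# (fromℕ M - β)))
      (diff (below-≥ M h))
    ... | no ¬p = by-diff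
      (trans (+-cong refl (-‿cong (suc-shift M β)))
        (solve 4 (λ b o m β → b :+ o :- (o :+ (m :- β)) := b :+ (β :- m)) refl (fromℕ (below M β ℕ.+ 0)) 1# (fromℕ M) β))
      (0≤+ (0≤fromℕ (below M β ℕ.+ 0)) (diff (≰⇒≥ ¬p)))

    below-0 : ∀ M {β} → ¬ β ≤ fromℕ M → below M β ≡ 0
    below-0 M h = Σ-zero M (λ i i<M → ind-no (λ k → h (≤-trans k (fromℕ-mono (ℕP.<⇒≤ i<M)))))

    -- The hypothesis covers thresholds beyond M: the count is then 0, and the right side must not
    -- be negative.
    below-≤ : ∀ M {β} → 0# ≤ fromℕ M - β + 1# → fromℕ (below M β) ≤ fromℕ M - β + 1#
    below-≤ zero h = ≤-respˡ (sym fromℤ-0) h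
    below-≤ (suc M) {β} h with em {β ≤ fromℕ M}
    ... | yes p = by-diff
      (trans (+-cong (+-cong (suc-shift M β) refl) (-‿cong (trans (fromℕ-+ (below M β) 1) (+-cong refl fromℤ-1))))
        (solve 3 (λ b o m → o :+ m :+ o :- (b :+ o) := m :+ o :- b) refl (fromℕ (below M β)) 1# (fromℕ M - β)))
      (diff (below-≤ M (0≤+ (diff p) 0≤1)))
    ... | no ¬p = ≤-respˡ (sym (≡⇒≈ (≡.cong (λ b → fromℕ (b ℕ.+ 0)) (below-0 M ¬p)))) (≤-respˡ (sym fromℤ-0) h)

    -- Here i is the rounding of z. An integer m ≠ i has distance at least ½ from z, while i has
    -- distance at most ½, so whatever bounds the distance to some integer also bounds the distance
    -- to i.
    nearest : ∀ {z r ½ i} m → ½ + ½ ≈ 1# → fromℤ i ≤ z + ½ → z + ½ ≤ fromℤ (i ℤ.+ + 1) →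
              z - fromℤ m ≤ r → fromℤ m - z ≤ r → (z - fromℤ i ≤ r) × (fromℤ i - z ≤ r)
    nearest {z} {r} {½} {i} m ½+½≈1 i≤ ≤i+1 h k with ℤP.<-cmp m i
    ... | tri≈ _ ≡.refl _ = h , k
    ... | tri< m<i _ _ =
        ≤-trans (by-diff (solve 3 (λ z i m → z :- m :- (z :- i) := i :- m) refl z (fromℤ i) (fromℤ m)) (diff (fromℤ-mono (ℤP.<⇒≤ m<i)))) h
      , ≤-trans (by-diff (solve 4 (λ z i m ½ → z :- m :- (i :- z) := z :+ ½ :- i :+ (z :+ ½ :- i) :+ (i :- (½ :+ ½ :+ m))) refl z (fromℤ i) (fromℤ m) ½)
          (0≤+ (0≤+ (diff i≤) (diff i≤)) (diff (≤-respˡ (trans (fromℤ-+ (+ 1) m) (+-cong (trans fromℤ-1 (sym ½+½≈1)) refl))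
            (fromℤ-mono (ℤP.i<j⇒suc[i]≤j m<i)))))) h
    ... | tri> _ _ i<m =
        ≤-trans (by-diff (solve 4 (λ z i m ½ → m :- z :- (z :- i) :=
              (i :+ (½ :+ ½) :- (z :+ ½)) :+ (i :+ (½ :+ ½) :- (z :+ ½)) :+ (m :- (½ :+ ½ :+ i))) refl z (fromℤ i) (fromℤ m) ½)
          (0≤+ (0≤+ (diff top) (diff top)) (diff (≤-respˡ (trans (fromℤ-+ (+ 1) i) (+-cong (trans fromℤ-1 (sym ½+½≈1)) refl))
            (fromℤ-mono (ℤP.i<j⇒suc[i]≤j i<m)))))) k
      , ≤-trans (by-diff (solve 3 (λ z i m → m :- z :- (i :- z) := m :- i) refl z (fromℤ i) (fromℤ m)) (diff (fromℤ-mono (ℤP.<⇒≤ i<m)))) k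
      where
      top : z + ½ ≤ fromℤ i + (½ + ½)
      top = ≤-respʳ (trans (fromℤ-+ i (+ 1)) (+-cong refl (trans fromℤ-1 (sym ½+½≈1)))) ≤i+1

    -- These are the properties of log on which the count rests. The bounds t / (c + t) and t / c
    -- for a difference of logarithms are multiplied out to avoid division; doubling serves both to
    -- remove powers of 2 and to compare with 2c.
    record IsLogarithm (lg : ℕ → Carrier) : Set where
      field
        lg-upper  : ∀ c t → fromℕ (suc c) * (lg (suc c ℕ.+ t) - lg (suc c)) ≤ fromℕ t
        lg-lower  : ∀ c t → fromℕ t ≤ fromℕ (suc c ℕ.+ t) * (lg (suc c ℕ.+ t) - lg (suc c))
        lg-double : ∀ c → lg (2 ℕ.* suc c) ≈ lg (suc c) + lg 2

    module Logarithm (lg : ℕ → Carrier) (isLogarithm : IsLogarithm lg) (σ : Carrier) (0≤σ : 0# ≤ σ) where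

      open IsLogarithm isLogarithm

      ℓ : Carrier
      ℓ = lg 2

      -- For σ = s ℓ this is the condition that (u - v) / ℓ lies within s / N of an integer,
      -- multiplied by N ℓ and split into its two one-sided inequalities.
      Close : ℕ → Carrier → Carrier → Set
      Close N u v = ∃ λ m → (fromℕ N * (u - v - fromℤ m * ℓ) ≤ σ) × (fromℕ N * (v - u + fromℤ m * ℓ) ≤ σ)

      Close-sym : ∀ {N u v} → Close N u v → Close N v u
      Close-sym {N} {u} {v} (m , h , k) = ℤ.- m
        , ≤-respˡ (*-cong refl (trans (solve 4 (λ u v m l → v :- u :+ m :* l := v :- u :- (:- m) :* l) refl u v (fromℤ m) ℓ)
            (+-cong refl (-‿cong (*-cong (sym (fromℤ-neg m)) refl))))) k
        , ≤-respˡ (*-cong refl (trans (solve 4 (λ u v m l → u :- v :- m :* l := u :- v :+ (:- m) :* l) refl u v (fromℤ m) ℓ)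
            (+-cong refl (*-cong (sym (fromℤ-neg m)) refl)))) h

      -- The integer m absorbs a - b. This is what allows an odd number to be replaced by its
      -- multiple in [N , 2N).
      Close-shift : ∀ {N u u′ v v′} a b → u′ ≈ u + fromℤ a * ℓ → v′ ≈ v + fromℤ b * ℓ → Close N u v → Close N u′ v′
      Close-shift {N} {u} {u′} {v} {v′} a b eu ev (m , h , k) = m ℤ.+ (a ℤ.- b)
        , ≤-respˡ (*-cong refl (sym (trans
            (+-cong (+-cong eu (-‿cong ev)) (-‿cong (*-cong m′ refl)))
            (solve 6 (λ u v m a b l → u :+ a :* l :- (v :+ b :* l) :- (m :+ (a :- b)) :* l := u :- v :- m :* l)
              refl u v (fromℤ m) (fromℤ a) (fromℤ b) ℓ)))) h
        , ≤-respˡ (*-cong refl (sym (trans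
            (+-cong (+-cong ev (-‿cong eu)) (*-cong m′ refl))
            (solve 6 (λ u v m a b l → v :+ b :* l :- (u :+ a :* l) :+ (m :+ (a :- b)) :* l := v :- u :+ m :* l)
              refl u v (fromℤ m) (fromℤ a) (fromℤ b) ℓ)))) k
        where
        m′ : fromℤ (m ℤ.+ (a ℤ.- b)) ≈ fromℤ m + (fromℤ a - fromℤ b)
        m′ = trans (fromℤ-+ m (a ℤ.- b)) (+-cong refl (trans (fromℤ-+ a (ℤ.- b)) (+-cong refl (fromℤ-neg b))))

      Close-unshift : ∀ {N u u′ v v′} a b → u′ ≈ u + fromℤ a * ℓ → v′ ≈ v + fromℤ b * ℓ → Close N u′ v′ → Close N u v
      Close-unshift {N} {u} {u′} {v} {v′} a b eu ev = Close-shift (ℤ.- a) (ℤ.- b) (back a eu) (back b ev)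
        where
        back : ∀ {u u′} a → u′ ≈ u + fromℤ a * ℓ → u ≈ u′ + fromℤ (ℤ.- a) * ℓ
        back {u} {u′} a e = sym (trans (+-cong e (*-cong (fromℤ-neg a) refl))
          (solve 3 (λ u a l → u :+ a :* l :+ (:- a) :* l := u) refl u (fromℤ a) ℓ))

      -- The elements q - i and q′ - j stand for two members of the sequence, with q = u / ℓ and q′
      -- = v / ℓ, and z for their difference. Multiplication by N ℓ > 0 turns nearness of z to an
      -- integer into `Close`, and the integers i and j are absorbed into the multiple of ℓ.
      module _ {N : ℕ} {s r : Carrier} {i j : ℤ} {q q′ u v z : Carrier}
        (1≤N : 1 ℕ.≤ N) (ℓ≰0 : ¬ ℓ ≤ 0#) (σ≈sℓ : σ ≈ s * ℓ) (r*N≈s : r * fromℕ N ≈ s)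
        (qℓ≈u : q * ℓ ≈ u) (q′ℓ≈v : q′ * ℓ ≈ v) (z≈ : z ≈ (q - fromℤ i) - (q′ - fromℤ j))
        where

        private
          σ≈ : fromℕ N * ℓ * r ≈ σ
          σ≈ = trans (solve 3 (λ n l r → n :* l :* r := r :* n :* l) refl (fromℕ N) ℓ r)
            (trans (*-cong r*N≈s refl) (sym σ≈sℓ))

          scale≰0 : ¬ fromℕ N * ℓ ≤ 0#
          scale≰0 h = ℓ≰0 (*-cancelˡ-≤ (fromℕ-pos 1≤N) (≤-respʳ (sym (zeroʳ (fromℕ N))) h))

          scaled : ∀ {m m′} → fromℤ m′ ≈ fromℤ m + (fromℤ i - fromℤ j) →
                   fromℕ N * (u - v - fromℤ m′ * ℓ) ≈ fromℕ N * ℓ * (z - fromℤ m)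
          scaled {m} e = trans
            (*-cong refl (+-cong (+-cong (sym qℓ≈u) (-‿cong (sym q′ℓ≈v))) (-‿cong (*-cong e refl))))
            (trans (solve 6 (λ n l q q′ m d → n :* (q :* l :- q′ :* l :- (m :+ d) :* l) := n :* l :* (q :- q′ :- d :- m))
              refl (fromℕ N) ℓ q q′ (fromℤ m) (fromℤ i - fromℤ j))
            (*-cong refl (+-cong (trans (solve 4 (λ q q′ i j → q :- q′ :- (i :- j) := q :- i :- (q′ :- j)) refl q q′ (fromℤ i) (fromℤ j))
              (sym z≈)) refl)))

          scaled′ : ∀ {m m′} → fromℤ m′ ≈ fromℤ m + (fromℤ i - fromℤ j) →
                    fromℕ N * (v - u + fromℤ m′ * ℓ) ≈ fromℕ N * ℓ * (fromℤ m - z)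
          scaled′ {m} {m′} e = trans
            (solve 5 (λ n u v m l → n :* (v :- u :+ m :* l) := :- (n :* (u :- v :- m :* l))) refl (fromℕ N) u v (fromℤ m′) ℓ)
            (trans (-‿cong (scaled {m} {m′} e))
              (solve 3 (λ n z m → :- (n :* (z :- m)) := n :* (m :- z)) refl (fromℕ N * ℓ) z (fromℤ m)))

        near⇒Close : ∀ {m} → z - fromℤ m ≤ r → fromℤ m - z ≤ r → Close N u v
        near⇒Close {m} h k = m′ , ≤-resp (sym (scaled {m} {m′} m′≈)) σ≈ (*-monoˡ-≤ (≰⇒≥ scale≰0) h)
                                , ≤-resp (sym (scaled′ {m} {m′} m′≈)) σ≈ (*-monoˡ-≤ (≰⇒≥ scale≰0) k)
          where
          m′ = m ℤ.+ (i ℤ.- j)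
          m′≈ : fromℤ m′ ≈ fromℤ m + (fromℤ i - fromℤ j)
          m′≈ = trans (fromℤ-+ m (i ℤ.- j)) (+-cong refl (trans (fromℤ-+ i (ℤ.- j)) (+-cong refl (fromℤ-neg j))))

        Close⇒near : Close N u v → ∃ λ m → (z - fromℤ m ≤ r) × (fromℤ m - z ≤ r)
        Close⇒near (m′ , h , k) = m , *-cancelˡ-≤ scale≰0 (≤-resp (scaled {m} {m′} m′≈) (sym σ≈) h)
                                    , *-cancelˡ-≤ scale≰0 (≤-resp (scaled′ {m} {m′} m′≈) (sym σ≈) k)
          where
          m = m′ ℤ.- (i ℤ.- j)
          m′≈ : fromℤ m′ ≈ fromℤ m + (fromℤ i - fromℤ j)
          m′≈ = sym (trans (+-cong (trans (fromℤ-+ m′ (ℤ.- (i ℤ.- j))) (+-cong refl (trans (fromℤ-neg (i ℤ.- j))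
              (-‿cong (trans (fromℤ-+ i (ℤ.- j)) (+-cong refl (fromℤ-neg j))))))) refl)
            (solve 2 (λ a d → a :- d :+ d := a) refl (fromℤ m′) (fromℤ i - fromℤ j)))

      lg-2^ : ∀ i c → lg (2 ℕ.^ i ℕ.* suc c) ≈ lg (suc c) + fromℤ (+ i) * ℓ
      lg-2^ zero c = trans (≡⇒≈ (≡.cong lg (ℕP.*-identityˡ (suc c))))
        (sym (trans (+-cong refl (trans (*-cong fromℤ-0 refl) (zeroˡ ℓ))) (+-identityʳ _)))
      lg-2^ (suc i) c = trans (≡⇒≈ (≡.cong lg (ℕP.*-assoc 2 (2 ℕ.^ i) (suc c))))
        (trans (double (2 ℕ.^ i ℕ.* suc c) (ℕP.*-mono-≤ (ℕP.m^n>0 2 i) (s≤s z≤n)))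
        (trans (+-cong (lg-2^ i c) refl)
        (trans (solve 4 (λ u i l o → u :+ i :* l :+ l := u :+ (con (+ 1) :+ i) :* l) refl (lg (suc c)) (fromℤ (+ i)) ℓ 1#)
          (+-cong refl (*-cong (sym (fromℕ-+ 1 i)) refl)))))
        where
        double : ∀ d → 1 ℕ.≤ d → lg (2 ℕ.* d) ≈ lg d + ℓ
        double (suc d) _ = lg-double d

      0≤lg-difference : ∀ c t → 0# ≤ lg (suc c ℕ.+ t) - lg (suc c)
      0≤lg-difference c t = *-cancelˡ-≤ (fromℕ-pos {suc c ℕ.+ t} (s≤s z≤n))
        (≤-respˡ (sym (zeroʳ _)) (≤-trans (0≤fromℕ t) (lg-lower c t)))

      0≤ℓ : 0# ≤ ℓ
      0≤ℓ = ≤-respʳ (trans (+-cong (lg-double 0) refl) (solve 2 (λ u v → u :+ v :- u := v) refl (lg 1) ℓ)) (0≤lg-difference 0 1)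

      -- The multiple 0 works: log (c + t) - log c is nonnegative and at most t / c ≤ σ / N, where c
      -- stands for `suc c`.
      close-of-≤ : ∀ N c t → fromℕ N * fromℕ t ≤ σ * fromℕ (suc c) → Close N (lg (suc c)) (lg (suc c ℕ.+ t))
      close-of-≤ N c t h = + 0
        , ≤-trans (by-diff (trans (+-cong refl (-‿cong (*-cong refl (+-cong refl (-‿cong zeroℓ)))))
              (solve 4 (λ z n u v → z :- n :* (u :- v :- z) := n :* (v :- u) :+ (z :+ n :* z)) refl 0# (fromℕ N) u v))
            (0≤+ (*-nonneg (0≤fromℕ N) (0≤lg-difference c t)) (≤-reflexive (sym (trans (+-cong refl (zeroʳ _)) (+-identityˡ 0#)))))) 0≤σ
        , *-cancelˡ-≤ (fromℕ-pos {suc c} (s≤s z≤n))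
            (≤-resp (trans (solve 3 (λ n c d → n :* (c :* d) := c :* (n :* d)) refl (fromℕ N) C (v - u))
                (*-cong refl (*-cong refl (sym (trans (+-cong refl zeroℓ) (+-identityʳ _))))))
              (*-comm σ C) (≤-trans (*-monoˡ-≤ (0≤fromℕ N) (lg-upper c t)) h))
        where
        C = fromℕ (suc c)
        u = lg (suc c)
        v = lg (suc c ℕ.+ t)
        zeroℓ : fromℤ (+ 0) * ℓ ≈ 0#
        zeroℓ = trans (*-cong fromℤ-0 refl) (zeroˡ ℓ)

      -- A difference of logarithms in [0 , log 2] is close to an integer multiple of log 2 only if it is close to 0 or to log 2.
      close⇒≤ : ∀ N c t r → t ℕ.+ r ≡ suc c → Close N (lg (suc c)) (lg (suc c ℕ.+ t)) →
                (fromℕ N * fromℕ t ≤ σ * fromℕ (suc c ℕ.+ t)) ⊎ (fromℕ N * fromℕ r ≤ σ * fromℕ (2 ℕ.* suc c))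
      close⇒≤ N c t r e (+ m , h , k) = inj₁ (≤-trans (*-monoˡ-≤ (0≤fromℕ N) (lg-lower c t))
          (≤-resp (solve 3 (λ n d x → d :* (n :* x) := n :* (d :* x)) refl (fromℕ N) D (v - u)) (*-comm D σ)
            (*-monoˡ-≤ (0≤fromℕ (suc c ℕ.+ t)) (≤-trans (by-diff
              (solve 3 (λ n x y → n :* (x :+ y) :- n :* x := n :* y) refl (fromℕ N) (v - u) (fromℕ m * ℓ))
              (*-nonneg (0≤fromℕ N) (*-nonneg (0≤fromℕ m) 0≤ℓ))) k))))
        where
        D = fromℕ (suc c ℕ.+ t)
        u = lg (suc c)
        v = lg (suc c ℕ.+ t)
      close⇒≤ N c t r e (-[1+ m ] , h , k) = inj₂ (≤-trans (*-monoˡ-≤ (0≤fromℕ N) r≤)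
          (≤-resp (solve 3 (λ n d x → d :* (n :* x) := n :* (d :* x)) refl (fromℕ N) D (u + ℓ - v)) (*-comm D σ)
            (*-monoˡ-≤ (0≤fromℕ (2 ℕ.* suc c)) (≤-trans (by-diff
              (trans (+-cong (*-cong refl (+-cong refl (-‿cong (*-cong neg refl)))) refl)
                (solve 5 (λ n u v l m → n :* (u :- v :- (:- (con (+ 1) :+ m)) :* l) :- n :* (u :+ l :- v) := n :* (m :* l))
                  refl (fromℕ N) u v ℓ (fromℕ m)))
              (*-nonneg (0≤fromℕ N) (*-nonneg (0≤fromℕ m) 0≤ℓ))) h))))
        where
        D = fromℕ (2 ℕ.* suc c)
        u = lg (suc c)
        v = lg (suc c ℕ.+ t)
        neg : fromℤ -[1+ m ] ≈ - (fromℤ (+ 1) + fromℕ m)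
        neg = trans (fromℤ-neg (+ suc m)) (-‿cong (fromℕ-+ 1 m))
        -- The number r is the distance from the larger point up to twice the smaller one, so u + ℓ
        -- - v is itself a difference of two logarithms, to which `lg-lower` applies.
        2c : suc c ℕ.+ t ℕ.+ r ≡ 2 ℕ.* suc c
        2c = ≡.trans (ℕP.+-assoc (suc c) t r) (≡.cong (suc c ℕ.+_) (≡.trans e (≡.sym (ℕP.+-identityʳ (suc c)))))
        r≤ : fromℕ r ≤ D * (u + ℓ - v)
        r≤ = ≤-respʳ (*-cong refl (+-cong (lg-double c) refl))
          (≡.subst (λ d → fromℕ r ≤ fromℕ d * (lg d - v)) 2c (lg-lower (c ℕ.+ t) r))

      -- With N = suc n, the points of [N , 2N) are suc (n + i) for i < N; k = ⌊ 2σ ⌋ and h = ⌊ k / 2 ⌋ = ⌊ σ ⌋.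
      module Pairs
        (k h : ℕ) (k≤2σ : fromℕ k ≤ σ + σ) (2σ<k+1 : ¬ fromℕ (suc k) ≤ σ + σ)
        (2h≤k : h ℕ.+ h ℕ.≤ k) (k≤2h+1 : k ℕ.≤ suc (h ℕ.+ h))
        -- τ is 1 / σ. It is specified for k ≥ 1 only, where 2σ ≥ 1; for k = 0 the number σ may be
        -- 0.
        (τ : Carrier) (σ*τ≈1 : 1 ℕ.≤ k → σ * τ ≈ 1#)
        where

        halve-≤ : ∀ {x y} → x + x ≤ y + y → x ≤ y
        halve-≤ {x} {y} l = *-cancelˡ-≤ (fromℕ-pos {2} (s≤s z≤n)) (≤-resp (double x) (double y) l)
          where
          double : ∀ x → x + x ≈ fromℕ 2 * x
          double = solve 1 (λ x → x :+ x := con (+ 2) :* x) refl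

        -- This and the next lemma make h the integer part of σ, by halving 2h ≤ k ≤ 2σ < k + 1 ≤ 2h
        -- + 2.
        ≤h⇒≤σ : ∀ {j} → j ℕ.≤ h → fromℕ j ≤ σ
        ≤h⇒≤σ {j} j≤h = halve-≤ (≤-trans (≤-reflexive (sym (fromℕ-+ j j)))
          (≤-trans (fromℕ-mono (ℕP.≤-trans (ℕP.+-mono-≤ j≤h j≤h) 2h≤k)) k≤2σ))

        >h⇒≥σ : ∀ {j} → h ℕ.< j → σ ≤ fromℕ j
        >h⇒≥σ {j} h<j = halve-≤ (≤-trans (≰⇒≥ 2σ<k+1) (≤-trans (fromℕ-mono
          (ℕP.≤-trans (s≤s k≤2h+1) (ℕP.≤-trans (ℕP.≤-reflexive (≡.cong suc (≡.sym (ℕP.+-suc h h)))) (ℕP.+-mono-≤ h<j h<j))))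
          (≤-reflexive (fromℕ-+ j j))))

        p s : ℕ → ℕ
        p = weight h
        s = slope h

        total : ℕ → ℕ → Carrier
        total N m = fromℕ N * (fromℕ (Σ< m p) - fromℕ (Σ< m s) * τ)

        total-suc : ∀ N m → total N (suc m) ≈ total N m + fromℕ N * (fromℕ (p m) - fromℕ (s m) * τ)
        total-suc N m = trans (*-cong refl (+-cong (fromℕ-+ (Σ< m p) (p m)) (-‿cong (*-cong (fromℕ-+ (Σ< m s) (s m)) refl))))
          (solve 6 (λ n P p S s t → n :* (P :+ p :- (S :+ s) :* t) := n :* (P :- S :* t) :+ n :* (p :- s :* t))
            refl (fromℕ N) (fromℕ (Σ< m p)) (fromℕ (p m)) (fromℕ (Σ< m s)) (fromℕ (s m)) τ)

        total-zero : ∀ N → total N 0 ≈ 0#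
        total-zero N = trans (*-cong refl (trans (+-cong fromℤ-0 (-‿cong (trans (*-cong fromℤ-0 refl) (zeroˡ τ))))
          (trans (solve 1 (λ z → z :- z := con (+ 0)) refl 0#) fromℤ-0))) (zeroʳ (fromℕ N))

        -- At distance j = t + 1 the error is at most j + 1. The 1 is the rounding in `below`. The j
        -- comes, from below, from the points whose partner lies beyond the interval and, from
        -- above, from testing the larger point instead of the smaller one.
        error : ℕ → ℕ
        error m = Σ< m (λ t → suc (suc t))

        total-≤ : ∀ N m {f : ℕ → ℕ} →
                  (∀ t → t ℕ.< m → fromℕ N * (fromℕ (p t) - fromℕ (s t) * τ) ≤ fromℕ (f t) + fromℕ (suc (suc t))) →
                  total N m ≤ fromℕ (Σ< m f) + fromℕ (error m)
        total-≤ N zero h′ = ≤-resp (sym (total-zero N)) (+-cong (sym fromℤ-0) (sym fromℤ-0)) (≤-reflexive (sym (+-identityˡ 0#)))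
        total-≤ N (suc m) {f} h′ = ≤-resp (sym (total-suc N m))
          (trans (solve 4 (λ a b c d → a :+ b :+ (c :+ d) := a :+ c :+ (b :+ d)) refl (fromℕ (Σ< m f)) (fromℕ (error m)) (fromℕ (f m)) (fromℕ (suc (suc m))))
            (+-cong (sym (fromℕ-+ (Σ< m f) (f m))) (sym (fromℕ-+ (error m) (suc (suc m))))))
          (+-mono-≤ (total-≤ N m (λ t t<m → h′ t (ℕP.m<n⇒m<1+n t<m))) (h′ m ℕP.≤-refl))

        total-≥ : ∀ N m {f : ℕ → ℕ} →
                  (∀ t → t ℕ.< m → fromℕ (f t) ≤ fromℕ N * (fromℕ (p t) - fromℕ (s t) * τ) + fromℕ (suc (suc t))) →
                  fromℕ (Σ< m f) ≤ total N m + fromℕ (error m)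
        total-≥ N zero h′ = ≤-resp (sym fromℤ-0) (+-cong (sym (total-zero N)) (sym fromℤ-0)) (≤-reflexive (sym (+-identityˡ 0#)))
        total-≥ N (suc m) {f} h′ = ≤-resp (sym (fromℕ-+ (Σ< m f) (f m)))
          (trans (solve 4 (λ a b c d → a :+ b :+ (c :+ d) := a :+ c :+ (b :+ d)) refl
              (total N m) (fromℕ (error m)) (fromℕ N * (fromℕ (p m) - fromℕ (s m) * τ)) (fromℕ (suc (suc m))))
            (+-cong (sym (total-suc N m)) (sym (fromℕ-+ (error m) (suc (suc m))))))
          (+-mono-≤ (total-≥ N m (λ t t<m → h′ t (ℕP.m<n⇒m<1+n t<m))) (h′ m ℕP.≤-refl))

        limit : Carrier
        limit = (fromℕ (Σ< k p) - fromℕ (Σ< k s) * τ) + (fromℕ (Σ< k p) - fromℕ (Σ< k s) * τ)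

        wraps : ℕ
        wraps = (suc k ℕ.+ suc k) ℕ.* (suc k ℕ.+ suc k)

        -- The errors are doubled because each pair is counted in both orders. The bound does not
        -- depend on N.
        maxError : ℕ
        maxError = (error k ℕ.+ wraps) ℕ.+ (error k ℕ.+ wraps)

        module _ (n : ℕ) where

          N : ℕ
          N = suc n

          Near : ℕ → ℕ → Set
          Near d i = fromℕ N * fromℕ d ≤ σ * fromℕ (suc (n ℕ.+ i))

          -- These enclose the number of close pairs at distance t + 1, apart from those near ± log
          -- 2. Testing the smaller point is sufficient, by the upper bound for log; testing the
          -- larger point is necessary, by the lower bound. In `upperCount` the larger point may
          -- leave the interval, which only increases the count.
          lowerCount upperCount : ℕ → ℕ
          lowerCount t = Σ< N (λ i → ind ((i ℕ.+ suc t ℕ.< N) × Near (suc t) i))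
          upperCount t = Σ< N (λ i → ind (Near (suc t) (i ℕ.+ suc t)))

          mainTerm : ℕ → Carrier
          mainTerm t = fromℕ N * (fromℕ (p t) - fromℕ (s t) * τ)

          fromℕ-point : ∀ i → fromℕ (suc (n ℕ.+ i)) ≈ fromℕ N + fromℕ i
          fromℕ-point i = fromℕ-+ N i

          N≤M+j : ∀ j → fromℕ N ≤ fromℕ (N ∸ j) + fromℕ j
          N≤M+j j = ≤-trans (fromℕ-mono (ℕP.≤-trans (ℕP.m≤n+m∸n N j) (ℕP.≤-reflexive (ℕP.+-comm j (N ∸ j)))))
            (≤-reflexive (fromℕ-+ (N ∸ j) j))

          i<N∸j⇒i+j<N : ∀ {i j} → i ℕ.< N ∸ j → i ℕ.+ j ℕ.< N
          i<N∸j⇒i+j<N {i} {j} l with ℕP.≤-total j N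
          ... | inj₁ j≤N = ℕP.≤-trans (ℕP.+-monoˡ-< j l) (ℕP.≤-reflexive (ℕP.m∸n+n≡m j≤N))
          ... | inj₂ N≤j = contradiction (≡.subst (i ℕ.<_) (ℕP.m≤n⇒m∸n≡0 N≤j) l) ℕP.n≮0

          lowerCount-≥ : ∀ t {β} → (∀ i → β ≤ fromℕ i → Near (suc t) i) → below (N ∸ suc t) β ℕ.≤ lowerCount t
          lowerCount-≥ t near = ℕP.≤-trans
            (Σ-mono (N ∸ suc t) (λ i l → ind-mono (λ β≤i → i<N∸j⇒i+j<N l , near i β≤i)))
            (Σ-monoˡ _ (ℕP.m∸n≤m N (suc t)))

          -- The indices from β up to N - (t + 1) are all counted by `lowerCount`; their number is
          -- estimated by `below-≥`, and cutting off the last t + 1 indices costs t + 1.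
          mainTerm-bound : ∀ t {β} → 0# ≤ β + 1# → (∀ i → β ≤ fromℕ i → Near (suc t) i) →
                       fromℕ N - β ≤ fromℕ (lowerCount t) + fromℕ (suc (suc t))
          mainTerm-bound t {β} 0≤β+1 near = by-diff
            (trans (+-cong (+-cong refl (fromℕ-suc (suc t))) refl)
              (solve 6 (λ c o t n b m → c :+ (o :+ t) :- (n :- b) := (m :+ t :- n) :+ (c :+ o :- (m :- b)))
                refl (fromℕ (lowerCount t)) 1# (fromℕ (suc t)) (fromℕ N) β (fromℕ (N ∸ suc t))))
            (0≤+ (diff (N≤M+j (suc t))) (diff (≤-trans (below-≥ (N ∸ suc t) 0≤β+1)
              (+-monoˡ-≤ 1# (fromℕ-mono (lowerCount-≥ t near))))))

          1≤k : ∀ {t} → t ℕ.< k → 1 ℕ.≤ k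
          1≤k = ℕP.≤-trans (s≤s z≤n)

          0≤τ : ∀ {t} → t ℕ.< k → 0# ≤ τ
          0≤τ t<k = inverse-nonneg 0≤σ (σ*τ≈1 (1≤k t<k))

          mainTerm-≤ : ∀ t → t ℕ.< k → mainTerm t ≤ fromℕ (lowerCount t) + fromℕ (suc (suc t))
          mainTerm-≤ t t<k with suc t ℕ.≤? h
          ... | yes t<h = ≤-respˡ (trans (+-cong refl (-‿cong fromℤ-0))
                (sym (trans (*-cong refl (+-cong fromℤ-1 (-‿cong (trans (*-cong fromℤ-0 refl) (zeroˡ τ)))))
                  (trans (solve 3 (λ n o z → n :* (o :- z) := n :* o :- n :* z) refl (fromℕ N) 1# 0#)
                    (+-cong (*-identityʳ _) (-‿cong (zeroʳ _)))))))
              (mainTerm-bound t {fromℕ 0} (0≤+ (0≤fromℕ 0) 0≤1) (λ i _ →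
                near i))
            where
            near : ∀ i → Near (suc t) i
            near i = ≤-respˡ (*-comm (fromℕ (suc t)) (fromℕ N))
              (*-mono-≤ (0≤fromℕ (suc t)) (0≤fromℕ _) (≤h⇒≤σ t<h) (fromℕ-mono (ℕP.m≤m+n N i)))
          ... | no t≮h = ≤-respˡ (solve 3 (λ n j τ → n :- (n :* (j :* τ) :- n) := n :* (con (+ 2) :- j :* τ))
                  refl (fromℕ N) J τ)
              (mainTerm-bound t {β} (0≤+ 0≤β 0≤1) near)
            where
            J = fromℕ (suc t)
            -- The condition N j ≤ σ (N + i) solved for i. Since j > h forces j ≥ σ, the threshold
            -- is not negative.
            β = fromℕ N * (J * τ) - fromℕ N
            1≤Jτ : 1# ≤ J * τ
            1≤Jτ = ≤-resp (trans (*-comm τ σ) (σ*τ≈1 (1≤k t<k))) (*-comm τ J)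
              (*-monoˡ-≤ (0≤τ t<k) (>h⇒≥σ (ℕP.≰⇒> t≮h)))
            0≤β : 0# ≤ β
            0≤β = diff (≤-respˡ (*-identityʳ _) (*-monoˡ-≤ (0≤fromℕ N) 1≤Jτ))
            near : ∀ i → β ≤ fromℕ i → Near (suc t) i
            near i β≤i = by-diff
              (trans (+-cong (*-cong refl (fromℕ-point i)) (-‿cong (trans (sym (*-identityʳ _)) (*-cong refl (sym (σ*τ≈1 (1≤k t<k)))))))
                (solve 5 (λ s n i j τ → s :* (n :+ i) :- n :* j :* (s :* τ) := s :* (i :- (n :* (j :* τ) :- n)))
                  refl σ (fromℕ N) (fromℕ i) J τ))
              (*-nonneg 0≤σ (diff β≤i))

          mainTerm-≥ : ∀ t → t ℕ.< k → fromℕ (upperCount t) ≤ mainTerm t + fromℕ (suc (suc t))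
          mainTerm-≥ t t<k with suc t ℕ.≤? h
          ... | yes t<h = ≤-trans (fromℕ-mono (ℕP.≤-trans (Σ-const-≤ N 1 (λ i _ → ind-≤1 _)) (ℕP.≤-reflexive (ℕP.*-identityʳ N))))
              (by-diff (trans (+-cong (+-cong (*-cong refl (+-cong fromℤ-1 (-‿cong (trans (*-cong fromℤ-0 refl) (zeroˡ τ))))) refl) refl)
                  (trans (solve 4 (λ n o z e → n :* (o :- z) :+ e :- n := n :* o :- n :+ (e :- n :* z)) refl (fromℕ N) 1# 0# (fromℕ (suc (suc t))))
                    (+-cong (+-cong (*-identityʳ _) refl) (+-cong refl (-‿cong (zeroʳ _))))))
                (≤-respʳ (solve 3 (λ n e z → e :- z := n :- n :+ (e :- z)) refl (fromℕ N) (fromℕ (suc (suc t))) 0#)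
                  (diff (0≤fromℕ (suc (suc t))))))
          ... | no t≮h = ≤-trans (fromℕ-mono (Σ-mono N (λ i _ → ind-mono (near i))))
              (≤-trans (below-≤ N 0≤N-β+1) (≤-reflexive (trans
                (solve 4 (λ n j τ o → n :- (n :* (j :* τ) :- n :- j) :+ o := n :* (con (+ 2) :- j :* τ) :+ (o :+ j))
                  refl (fromℕ N) J τ 1#) (+-cong refl (sym (fromℕ-suc (suc t)))))))
            where
            J = fromℕ (suc t)
            -- The same threshold with the larger point N + i + j in place of N + i, hence lower by
            -- j.
            β = fromℕ N * (J * τ) - fromℕ N - J
            στ≈1 = σ*τ≈1 (1≤k t<k)
            near : ∀ i → Near (suc t) (i ℕ.+ suc t) → β ≤ fromℕ i
            near i l = by-diff
              (trans (solve 4 (λ i n j τ → i :- (n :* (j :* τ) :- n :- j) := con (+ 1) :* (n :+ (i :+ j)) :- τ :* (n :* j)) refl (fromℕ i) (fromℕ N) J τ)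
                (+-cong (*-cong (trans fromℤ-1 (sym στ≈1)) refl) refl))
              (diff (≤-respʳ (trans (*-cong refl (*-cong refl (trans (fromℕ-point (i ℕ.+ suc t)) (+-cong refl (fromℕ-+ i (suc t))))))
                  (solve 3 (λ τ s x → τ :* (s :* x) := s :* τ :* x) refl τ σ (fromℕ N + (fromℕ i + J))))
                (*-monoˡ-≤ (0≤τ t<k) l)))
            -- From j ≤ k ≤ 2σ the threshold exceeds N by nothing, which is what `below-≤` asks for.
            Jτ≤2 : J * τ ≤ 1# + 1#
            Jτ≤2 = ≤-resp (*-comm τ J) (trans (solve 2 (λ τ s → τ :* (s :+ s) := s :* τ :+ s :* τ) refl τ σ) (+-cong στ≈1 στ≈1))
              (*-monoˡ-≤ (0≤τ t<k) (≤-trans (fromℕ-mono t<k) k≤2σ))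
            0≤N-β+1 : 0# ≤ fromℕ N - β + 1#
            0≤N-β+1 = ≤-respʳ
              (trans (+-cong (+-cong (trans (solve 3 (λ n o x → n :* (o :+ o) :- x := n :* o :+ n :* o :- x) refl (fromℕ N) 1# (fromℕ N * (J * τ)))
                  (+-cong (+-cong (*-identityʳ _) (*-identityʳ _)) refl)) refl) refl)
                (solve 4 (λ n j x o → n :+ n :- x :+ j :+ o := n :- (x :- n :- j) :+ o) refl (fromℕ N) J (fromℕ N * (J * τ)) 1#))
              (0≤+ (0≤+ (diff (*-monoˡ-≤ (0≤fromℕ N) Jτ≤2)) (0≤fromℕ (suc t))) 0≤1)

          -- For i < j, `Lower` implies `Q`, and `Q` implies `Upper` or `Wrap`. The last alternative
          -- collects the pairs whose logarithms differ by nearly log 2: one index at the bottom of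
          -- the range and the other at the top.
          Lower Upper Wrap Q : ℕ → ℕ → Set
          Lower i j = (i ℕ.< j) × (j ℕ.< N) × Near (j ∸ i) i
          Upper i j = (i ℕ.< j) × (j ℕ.< N) × Near (j ∸ i) j
          Wrap i j = (i ℕ.< suc k ℕ.+ suc k) × (j ℕ.< N) × (N ℕ.< j ℕ.+ (suc k ℕ.+ suc k))
          Q i j = i ≢ j × Close N (lg (suc (n ℕ.+ i))) (lg (suc (n ℕ.+ j)))

          point-+ : ∀ {i j} → i ℕ.< j → suc (n ℕ.+ i) ℕ.+ (j ∸ i) ≡ suc (n ℕ.+ j)
          point-+ {i} {j} i<j = ≡.cong suc (≡.trans (ℕP.+-assoc n i (j ∸ i)) (≡.cong (n ℕ.+_) (ℕP.m+[n∸m]≡n (ℕP.<⇒≤ i<j))))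

          Lower⇒Close : ∀ {i j} → Lower i j → Close N (lg (suc (n ℕ.+ i))) (lg (suc (n ℕ.+ j)))
          Lower⇒Close {i} {j} (i<j , _ , l) = ≡.subst (λ d → Close N (lg (suc (n ℕ.+ i))) (lg d)) (point-+ i<j)
            (close-of-≤ N (n ℕ.+ i) (j ∸ i) l)

          Lower⇒Q : ∀ {i j} → Lower i j → Q i j
          Lower⇒Q l = ℕP.<⇒≢ (proj₁ l) , Lower⇒Close l

          Lower⇒Q′ : ∀ {i j} → Lower j i → Q i j
          Lower⇒Q′ l = (λ e → ℕP.<⇒≢ (proj₁ l) (≡.sym e)) , Close-sym (Lower⇒Close l)

          -- If r is the distance from suc (n + j) to the double of suc (n + i), then r ≤ 4σ < 2 (k + 1).
          Near⇒Wrap : ∀ {i j r} → i ℕ.< j → j ℕ.< N → (j ∸ i) ℕ.+ r ≡ suc (n ℕ.+ i) →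
                      fromℕ N * fromℕ r ≤ σ * fromℕ (2 ℕ.* suc (n ℕ.+ i)) → Wrap i j
          Near⇒Wrap {i} {j} {r} i<j j<N e l =
            ℕP.≤-<-trans i≤r r<K , j<N , ℕP.≤-<-trans N≤j+r (ℕP.+-monoʳ-< j r<K)
            where
            K = suc k ℕ.+ suc k
            r≤4σ : fromℕ r ≤ (σ + σ) + (σ + σ)
            r≤4σ = *-cancelˡ-≤ (fromℕ-pos {N} (s≤s z≤n)) (≤-trans l (≤-trans
              (*-monoˡ-≤ 0≤σ (≤-trans (fromℕ-mono (ℕP.*-monoʳ-≤ 2 (s≤s (ℕP.≤-trans (ℕP.+-monoʳ-≤ n (ℕP.<⇒≤ (ℕP.<-trans i<j j<N))) ℕP.≤-refl))))
                (≤-trans (≤-reflexive (fromℕ-* 2 (suc (n ℕ.+ N)))) (≤-reflexive (*-cong refl (fromℕ-point N))))))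
              (≤-reflexive (solve 2 (λ s n → s :* (con (+ 2) :* (n :+ n)) := n :* (s :+ s :+ (s :+ s))) refl σ (fromℕ N)))))
            r<K : r ℕ.< K
            r<K = ℕP.≰⇒> (λ K≤r → 2σ<k+1 (halve-≤ (≤-trans (≤-reflexive (sym (fromℕ-+ (suc k) (suc k))))
              (≤-trans (fromℕ-mono K≤r) r≤4σ))))
            i≤r : i ℕ.≤ r
            i≤r = ℕP.+-cancelˡ-≤ (j ∸ i) i r (ℕP.≤-trans (ℕP.≤-reflexive (ℕP.m∸n+n≡m (ℕP.<⇒≤ i<j)))
              (ℕP.≤-trans (ℕP.<⇒≤ j<N) (ℕP.≤-trans (ℕP.m≤m+n N i) (ℕP.≤-reflexive (≡.sym e)))))
            N≤j+r : N ℕ.≤ j ℕ.+ r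
            N≤j+r = ℕP.≤-trans (ℕP.m≤m+n N i) (ℕP.≤-trans (ℕP.≤-reflexive (≡.sym e)) (ℕP.+-monoˡ-≤ r (ℕP.m∸n≤m j i)))

          Close⇒Upper⊎Wrap : ∀ {i j} → i ℕ.< j → j ℕ.< N →
                             Close N (lg (suc (n ℕ.+ i))) (lg (suc (n ℕ.+ j))) → Upper i j ⊎ Wrap i j
          Close⇒Upper⊎Wrap {i} {j} i<j j<N c
            with close⇒≤ N (n ℕ.+ i) (j ∸ i) (suc (n ℕ.+ i) ∸ (j ∸ i)) e
                   (≡.subst (λ d → Close N (lg (suc (n ℕ.+ i))) (lg d)) (≡.sym (point-+ i<j)) c)
            where
            e = ℕP.m+[n∸m]≡n {j ∸ i} (ℕP.≤-trans (ℕP.m∸n≤m j i) (ℕP.≤-trans (ℕP.<⇒≤ j<N) (ℕP.m≤m+n N i)))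
          ... | inj₁ l = inj₁ (i<j , j<N , ≡.subst (λ d → fromℕ N * fromℕ (j ∸ i) ≤ σ * fromℕ d) (point-+ i<j) l)
          ... | inj₂ l = inj₂ (Near⇒Wrap i<j j<N
                  (ℕP.m+[n∸m]≡n {j ∸ i} (ℕP.≤-trans (ℕP.m∸n≤m j i) (ℕP.≤-trans (ℕP.<⇒≤ j<N) (ℕP.m≤m+n N i)))) l)

          ind-Q-≥ : ∀ i j → ind (Lower i j) ℕ.+ ind (Lower j i) ℕ.≤ ind (Q i j)
          ind-Q-≥ i j = ind-disjoint Lower⇒Q Lower⇒Q′ (λ l l′ → ℕP.<-asym (proj₁ l) (proj₁ l′))

          either : ℕ → ℕ → ℕ
          either i j = ind (Upper i j) ℕ.+ ind (Wrap i j)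

          ind-Q-≤ : ∀ i j → i ℕ.< N → j ℕ.< N → ind (Q i j) ℕ.≤ either i j ℕ.+ either j i
          ind-Q-≤ i j i<N j<N with ℕP.<-cmp i j
          ... | tri< i<j _ _ = ℕP.≤-trans (ind-⊎ (λ q → Close⇒Upper⊎Wrap i<j j<N (proj₂ q))) (ℕP.m≤m+n _ _)
          ... | tri> _ _ j<i = ℕP.≤-trans (ind-⊎ (λ q → Close⇒Upper⊎Wrap j<i i<N (Close-sym (proj₂ q)))) (ℕP.m≤n+m _ (either i j))
          ... | tri≈ _ i≡j _ = ℕP.≤-trans (ℕP.≤-reflexive (ind-no (λ q → proj₁ q i≡j))) z≤n

          ΣΣ : (ℕ → ℕ → ℕ) → ℕ
          ΣΣ f = Σ< N (λ i → Σ< N (f i))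

          ΣΣ-mono : ∀ {f g : ℕ → ℕ → ℕ} → (∀ i j → i ℕ.< N → j ℕ.< N → f i j ℕ.≤ g i j) → ΣΣ f ℕ.≤ ΣΣ g
          ΣΣ-mono h = Σ-mono N (λ i i<N → Σ-mono N (λ j j<N → h i j i<N j<N))

          ΣΣ-+ : ∀ f g → ΣΣ (λ i j → f i j ℕ.+ g i j) ≡ ΣΣ f ℕ.+ ΣΣ g
          ΣΣ-+ f g = ≡.trans (Σ-cong N (λ i _ → Σ-+ N (f i) (g i))) (Σ-+ N _ _)

          ΣΣ-symmetrise : ∀ f → ΣΣ (λ i j → f i j ℕ.+ f j i) ≡ ΣΣ f ℕ.+ ΣΣ f
          ΣΣ-symmetrise f = ≡.trans (ΣΣ-+ f (λ i j → f j i)) (≡.cong (ΣΣ f ℕ.+_) (≡.sym (Σ-swap N N f)))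

          shift-index : ∀ i t → suc i ℕ.+ t ≡ i ℕ.+ suc t
          shift-index i t = ≡.sym (ℕP.+-suc i t)

          shift-difference : ∀ i t → (suc i ℕ.+ t) ∸ i ≡ suc t
          shift-difference i t = ≡.trans (≡.cong (_∸ i) (shift-index i t)) (ℕP.m+n∸m≡n i (suc t))

          -- After exchanging the sums, row i is indexed by j = i + (t + 1), and its first k
          -- distances form a window of the row.
          lowerCounts-≤ : Σ< k lowerCount ℕ.≤ ΣΣ (λ i j → ind (Lower i j))
          lowerCounts-≤ = ℕP.≤-trans (ℕP.≤-reflexive (Σ-swap k N _))
            (Σ-mono N (λ i _ → ℕP.≤-trans
              (Σ-mono k (λ t _ → ind-mono (λ (l , near) →
                s≤s (ℕP.m≤m+n i t) , ≡.subst (ℕ._< N) (≡.sym (shift-index i t)) l ,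
                ≡.subst (λ d → Near d i) (≡.sym (shift-difference i t)) near)))
              (window-≤ N (suc i) k (λ j N≤j → ind-no (λ (_ , j<N , _) → ℕP.<⇒≱ j<N N≤j)))))

          -- The larger point is at most 2N, so the distance is at most 2σ < k + 1. This is why only
          -- the distances up to k contribute.
          Upper⇒≤k : ∀ {i j} → Upper i j → j ∸ i ℕ.≤ k
          Upper⇒≤k {i} {j} (i<j , j<N , l) = ℕP.≮⇒≥ (λ k<d → 2σ<k+1 (≤-trans (fromℕ-mono k<d)
            (*-cancelˡ-≤ (fromℕ-pos {N} (s≤s z≤n)) (≤-trans l (≤-trans
              (*-monoˡ-≤ 0≤σ (≤-trans (fromℕ-mono (s≤s (ℕP.+-monoʳ-≤ n (ℕP.<⇒≤ j<N)))) (≤-reflexive (fromℕ-point N))))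
              (≤-reflexive (solve 2 (λ s n → s :* (n :+ n) := n :* (s :+ s)) refl σ (fromℕ N))))))))

          uppers-≤ : ΣΣ (λ i j → ind (Upper i j)) ℕ.≤ Σ< k upperCount
          uppers-≤ = ℕP.≤-trans
            (Σ-mono N (λ i _ → ℕP.≤-trans
              (window-≥ N (suc i) k
                (λ j j≤i → ind-no (λ (i<j , _) → ℕP.<⇒≱ i<j (ℕP.≤-pred j≤i)))
                (λ j i+k<j → ind-no (λ u → ℕP.<⇒≱ (ℕP.≤-trans (ℕP.≤-reflexive (≡.cong suc (ℕP.+-comm k i))) i+k<j)
                  (ℕP.≤-trans (ℕP.m≤n+m∸n j i) (ℕP.≤-trans (ℕP.+-monoʳ-≤ i (Upper⇒≤k u)) (ℕP.≤-reflexive (ℕP.+-comm i k)))))))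
              (Σ-mono k (λ t _ → ind-mono (λ (_ , _ , near) →
                ≡.subst₂ Near (shift-difference i t) (shift-index i t) near)))))
            (ℕP.≤-reflexive (Σ-swap N k _))

          -- Nonzero entries lie in the first 2 (k + 1) rows and the last 2 (k + 1) columns.
          wraps-≤ : ΣΣ (λ i j → ind (Wrap i j)) ℕ.≤ (suc k ℕ.+ suc k) ℕ.* (suc k ℕ.+ suc k)
          wraps-≤ = ℕP.≤-trans
            (Σ-support K (λ i K≤i → Σ-zero N (λ j _ → ind-no (λ (i<K , _) → ℕP.<⇒≱ i<K K≤i))) N)
            (Σ-const-≤ K K (λ i _ → ℕP.≤-trans
              (window-≥ N (N ∸ K) K
                (λ j j<N∸K → ind-no (λ (_ , _ , N<j+K) → ℕP.<-asym N<j+K (i<N∸j⇒i+j<N j<N∸K)))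
                (λ j N≤j → ind-no (λ (_ , j<N , _) → ℕP.<⇒≱ j<N (ℕP.≤-trans (ℕP.m≤n+m∸n N K)
                  (ℕP.≤-trans (ℕP.≤-reflexive (ℕP.+-comm K (N ∸ K))) N≤j)))))
              (ℕP.≤-trans (Σ-const-≤ K 1 (λ _ _ → ind-≤1 _)) (ℕP.≤-reflexive (ℕP.*-identityʳ K)))))
            where K = suc k ℕ.+ suc k

          count : ℕ
          count = ΣΣ (λ i j → ind (Q i j))

          N*limit : fromℕ N * limit ≈ total N k + total N k
          N*limit = solve 2 (λ n x → n :* (x :+ x) := n :* x :+ n :* x) refl (fromℕ N) _

          count-≥ : fromℕ N * limit ≤ fromℕ count + fromℕ maxError
          count-≥ = ≤-trans (≤-reflexive N*limit) (≤-trans (+-mono-≤ one one) (≤-trans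
            (≤-reflexive (trans (solve 2 (λ a b → a :+ b :+ (a :+ b) := a :+ a :+ (b :+ b)) refl (fromℕ A) (fromℕ (error k)))
              (+-cong (sym (fromℕ-+ A A)) (sym (fromℕ-+ (error k) (error k))))))
            (+-mono-≤ (fromℕ-mono 2A≤count) (fromℕ-mono (ℕP.+-mono-≤ (ℕP.m≤m+n (error k) wraps) (ℕP.m≤m+n (error k) wraps))))))
            where
            A = Σ< k lowerCount
            one = total-≤ N k mainTerm-≤
            2A≤count : A ℕ.+ A ℕ.≤ count
            2A≤count = ℕP.≤-trans (ℕP.+-mono-≤ lowerCounts-≤ lowerCounts-≤)
              (ℕP.≤-trans (ℕP.≤-reflexive (≡.sym (ΣΣ-symmetrise (λ i j → ind (Lower i j)))))
                (ΣΣ-mono (λ i j _ _ → ind-Q-≥ i j)))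

          count-≤ : fromℕ count ≤ fromℕ N * limit + fromℕ maxError
          count-≤ = ≤-trans (fromℕ-mono count≤) (≤-trans
            (≤-reflexive (trans (fromℕ-+ (B ℕ.+ wraps) (B ℕ.+ wraps)) (+-cong (fromℕ-+ B wraps) (fromℕ-+ B wraps))))
            (≤-trans (+-mono-≤ (+-monoˡ-≤ (fromℕ wraps) one) (+-monoˡ-≤ (fromℕ wraps) one))
              (≤-reflexive (trans (solve 3 (λ t e w → t :+ e :+ w :+ (t :+ e :+ w) := t :+ t :+ (e :+ w :+ (e :+ w))) refl
                  (total N k) (fromℕ (error k)) (fromℕ wraps))
                (+-cong (sym N*limit) (sym (trans (fromℕ-+ (error k ℕ.+ wraps) (error k ℕ.+ wraps))
                  (+-cong (fromℕ-+ (error k) wraps) (fromℕ-+ (error k) wraps)))))))))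
            where
            B = Σ< k upperCount
            one = total-≥ N k mainTerm-≥
            count≤ : count ℕ.≤ (B ℕ.+ wraps) ℕ.+ (B ℕ.+ wraps)
            count≤ = ℕP.≤-trans (ΣΣ-mono ind-Q-≤) (ℕP.≤-trans (ℕP.≤-reflexive (ΣΣ-symmetrise either))
              (ℕP.+-mono-≤ both both))
              where
              both : ΣΣ either ℕ.≤ B ℕ.+ wraps
              both = ℕP.≤-trans (ℕP.≤-reflexive (ΣΣ-+ _ _)) (ℕP.+-mono-≤ uppers-≤ wraps-≤)

          oddPoint : ℕ → Carrier
          oddPoint a = lg (suc (2 ℕ.* a))

          lg-point : ∀ i → lg (suc (n ℕ.+ i)) ≈ oddPoint (oddIndex (n ℕ.+ i)) + fromℤ (+ exponent (n ℕ.+ i)) * ℓ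
          lg-point i = trans (≡⇒≈ (≡.cong lg (oddIndex-spec (n ℕ.+ i)))) (lg-2^ (exponent (n ℕ.+ i)) (2 ℕ.* oddIndex (n ℕ.+ i)))

          -- `reindex` is applied to each of the two variables. Closeness survives because powers of
          -- 2 shift logarithms by multiples of ℓ, and distinctness survives because `oddIndex` is
          -- injective on the interval.
          count-odd : ∀ {P : ℕ → ℕ → Set} →
            (∀ a b → P a b → a ≢ b × Close N (oddPoint a) (oddPoint b)) →
            (∀ a b → a ≢ b × Close N (oddPoint a) (oddPoint b) → P a b) →
            Σ< N (λ a → Σ< N (λ b → ind (P a b))) ≡ count
          count-odd {P} f g = ≡.trans (≡.sym (reindex (λ a → Σ< N (λ b → ind (P a b))) n))
            (Σ-cong N (λ i i<N → ≡.trans (≡.sym (reindex (λ b → ind (P (oddIndex (n ℕ.+ i)) b)) n))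
              (Σ-cong N (λ j j<N → ind-cong
                (λ q → let (a≢b , c) = f _ _ q in (λ i≡j → a≢b (≡.cong (λ i → oddIndex (n ℕ.+ i)) i≡j)) ,
                  Close-shift (+ exponent (n ℕ.+ i)) (+ exponent (n ℕ.+ j)) (lg-point i) (lg-point j) c)
                (λ (i≢j , c) → g _ _ ((λ a≡b → i≢j (oddIndex-injective n i j i<N j<N a≡b)) ,
                  Close-unshift (+ exponent (n ℕ.+ i)) (+ exponent (n ℕ.+ j)) (lg-point i) (lg-point j) c))))))

        -- The element w is the quotient b / (4σ), given by its equation. As b is 8 times the sum of
        -- slopes, w equals twice that sum divided by σ.
        limit-formula : ∀ {a b w} → 1 ℕ.≤ k → 2 ℕ.* Σ< k p ≡ a → 8 ℕ.* Σ< k s ≡ b →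
                        w * (fromℕ 4 * σ) ≈ fromℕ b → limit ≈ fromℕ a - w
        limit-formula {w = w} 1≤k ≡.refl ≡.refl e = sym (trans
          (+-cong (fromℕ-* 2 (Σ< k p)) (-‿cong w≈2Sτ))
          (solve 3 (λ P S τ → con (+ 2) :* P :- con (+ 2) :* (S :* τ) := P :- S :* τ :+ (P :- S :* τ)) refl (fromℕ (Σ< k p)) S τ))
          where
          S = fromℕ (Σ< k s)
          4w≈ : fromℕ 4 * w ≈ fromℕ 4 * (fromℕ 2 * (S * τ))
          4w≈ = trans (sym (trans (*-cong refl (σ*τ≈1 1≤k)) (*-identityʳ _)))
            (trans (solve 3 (λ w σ τ → con (+ 4) :* w :* (σ :* τ) := w :* (con (+ 4) :* σ) :* τ) refl w σ τ)
            (trans (*-cong (trans e (fromℕ-* 8 (Σ< k s))) refl)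
              (solve 2 (λ S τ → con (+ 8) :* S :* τ := con (+ 4) :* (con (+ 2) :* (S :* τ))) refl S τ)))
          w≈2Sτ : w ≈ fromℕ 2 * (S * τ)
          w≈2Sτ = ≤-antisym (*-cancelˡ-≤ (fromℕ-pos {4} (s≤s z≤n)) (≤-reflexive 4w≈))
            (*-cancelˡ-≤ (fromℕ-pos {4} (s≤s z≤n)) (≤-reflexive (sym 4w≈)))

        limit-zero : k ≡ 0 → limit ≈ 0#
        limit-zero e = trans (+-cong half half) (+-identityˡ 0#)
          where
          empty : ∀ f → fromℕ (Σ< k f) ≈ 0#
          empty f = trans (≡⇒≈ (≡.cong (λ k → fromℕ (Σ< k f)) e)) fromℤ-0
          half : fromℕ (Σ< k p) - fromℕ (Σ< k s) * τ ≈ 0#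
          half = trans (+-cong (empty p) (-‿cong (trans (*-cong (empty s) refl) (zeroˡ τ))))
            (trans (solve 1 (λ z → z :- z := con (+ 0)) refl 0#) fromℤ-0)

        convergence : ∀ ε → ¬ ε ≤ 0# → ∃ λ M → ∀ n q → M ℕ.≤ suc n → q * fromℕ (suc n) ≈ fromℕ (count n) →
                      (¬ ε ≤ q - limit) × (¬ ε ≤ limit - q)
        convergence ε ε≰0 with inverse ε ε≰0
        -- The bound M is at least (`maxError` + 1) / ε, so N ε exceeds the error strictly for N ≥
        -- M; the added 1 turns two weak inequalities into a contradiction.
        ... | y , εy≈1 with archimedean ((fromℕ maxError + 1#) * y)
        ... | M , C+1≤M = M , λ n q M≤N e →
            (λ h → ≤-1+≰ (fromℕ maxError) (≤-trans (C+1≤Nε M≤N) (≤-trans (*-monoˡ-≤ (0≤fromℕ (suc n)) h) (by-diff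
              (trans (+-cong refl (-‿cong (trans (solve 3 (λ n q l → n :* (q :- l) := q :* n :- n :* l) refl (fromℕ (suc n)) q limit)
                  (+-cong e refl))))
                (solve 3 (λ c m x → c :- (m :- x) := x :+ c :- m) refl (fromℕ maxError) (fromℕ (count n)) (fromℕ (suc n) * limit)))
              (diff (count-≤ n))))))
          , (λ h → ≤-1+≰ (fromℕ maxError) (≤-trans (C+1≤Nε M≤N) (≤-trans (*-monoˡ-≤ (0≤fromℕ (suc n)) h) (by-diff
              (trans (+-cong refl (-‿cong (trans (solve 3 (λ n q l → n :* (l :- q) := n :* l :- q :* n) refl (fromℕ (suc n)) q limit)
                  (+-cong refl (-‿cong e)))))
                (solve 3 (λ c m x → c :- (x :- m) := m :+ c :- x) refl (fromℕ maxError) (fromℕ (count n)) (fromℕ (suc n) * limit)))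
              (diff (count-≥ n))))))
          where
          C+1≤Nε : ∀ {N} → M ℕ.≤ N → fromℕ maxError + 1# ≤ fromℕ N * ε
          C+1≤Nε {N} M≤N = ≤-respˡ
            (trans (solve 3 (λ c y e → e :* (c :* y) := c :* (e :* y)) refl (fromℕ maxError + 1#) y ε)
              (trans (*-cong refl εy≈1) (*-identityʳ _)))
            (≤-respʳ (*-comm ε (fromℕ N)) (*-monoˡ-≤ (≰⇒≥ ε≰0) (≤-trans C+1≤M (fromℕ-mono M≤N))))

      record Formula (s value : Carrier) (a b : ℕ) : Set where
        constructor formula
        field
          equation : ∀ w → w * (fromℕ 4 * (s * ℓ)) ≈ fromℕ b → value ≈ fromℕ a - w

      -- Both parities are listed for a single k, and the clause with the wrong parity holds
      -- vacuously. This lets the case distinction on k stay inside the counting.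
      record Result (s : Carrier) (F : ℕ → Carrier) : Set where
        field
          value     : Carrier
          k         : ℕ
          k≤2sℓ     : fromℕ k ≤ s * ℓ + s * ℓ
          2sℓ<k+1   : ¬ fromℕ (suc k) ≤ s * ℓ + s * ℓ
          converges : ∀ ε → ¬ ε ≤ 0# → ∃ λ M → ∀ n → M ℕ.≤ suc n → (¬ ε ≤ F n - value) × (¬ ε ≤ value - F n)
          k≡0⇒0     : k ≡ 0 → value ≈ 0#
          even      : ∀ {h} → k ≡ h ℕ.+ h → 1 ℕ.≤ k → Formula s value (3 ℕ.* k) (3 ℕ.* k ℕ.^ 2 ℕ.+ 2 ℕ.* k)
          odd       : ∀ {h} → k ≡ h ℕ.+ suc h → 1 ℕ.≤ k →
                      Formula s value (3 ℕ.* k ℕ.+ 1) (3 ℕ.* k ℕ.^ 2 ℕ.+ 4 ℕ.* k ℕ.+ 1)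

      -- The sequence, the quotient s / N, the relation on pairs and F are known here only through
      -- specifications, free of floors, lists and total division. With N = n + 1, index a stands
      -- for the odd number 2a + 1.
      module _
        (s : Carrier) (σ≈sℓ : σ ≈ s * ℓ) (ℓ≰0 : ¬ ℓ ≤ 0#)
        (k : ℕ) (k≤2σ : fromℕ k ≤ σ + σ) (2σ<k+1 : ¬ fromℕ (suc k) ≤ σ + σ)
        (X : ℕ → Carrier)
        (X-spec : ∀ a → ∃ λ q → ∃ λ i → (q * ℓ ≈ lg (suc (2 ℕ.* a))) × (X a ≈ q - fromℤ i))
        (ratio : ℕ → Carrier) (ratio-spec : ∀ n → ratio n * fromℕ (suc n) ≈ s)
        (P : ℕ → ℕ → ℕ → Set)
        (P⇒near : ∀ {n a b} → P n a b → a ≢ b × ∃ λ m → (X a - X b - fromℤ m ≤ ratio n) × (fromℤ m - (X a - X b) ≤ ratio n))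
        (near⇒P : ∀ {n a b} m → a ≢ b → X a - X b - fromℤ m ≤ ratio n → fromℤ m - (X a - X b) ≤ ratio n → P n a b)
        (F : ℕ → Carrier)
        (F-spec : ∀ n → F n * fromℕ (suc n) ≈ fromℕ (Σ< (suc n) (λ a → Σ< (suc n) (λ b → ind (P n a b)))))
        where

        private
          P⇒Close : ∀ n a b → P n a b → a ≢ b × Close (suc n) (lg (suc (2 ℕ.* a))) (lg (suc (2 ℕ.* b)))
          P⇒Close n a b pr =
            let (a≢b , m , l , l′) = P⇒near pr
                (q , i , qℓ , Xa) = X-spec a
                (q′ , j , q′ℓ , Xb) = X-spec b
            in a≢b , near⇒Close {suc n} {s} {ratio n} {i} {j} {q} {q′} {lg (suc (2 ℕ.* a))} {lg (suc (2 ℕ.* b))} {X a - X b}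
                       (s≤s z≤n) ℓ≰0 σ≈sℓ (ratio-spec n) qℓ q′ℓ (+-cong Xa (-‿cong Xb)) {m} l l′

          Close⇒P : ∀ n a b → a ≢ b × Close (suc n) (lg (suc (2 ℕ.* a))) (lg (suc (2 ℕ.* b))) → P n a b
          Close⇒P n a b (a≢b , c) =
            let (q , i , qℓ , Xa) = X-spec a
                (q′ , j , q′ℓ , Xb) = X-spec b
                (m , l , l′) = Close⇒near {suc n} {s} {ratio n} {i} {j} {q} {q′} {lg (suc (2 ℕ.* a))} {lg (suc (2 ℕ.* b))} {X a - X b}
                       (s≤s z≤n) ℓ≰0 σ≈sℓ (ratio-spec n) qℓ q′ℓ (+-cong Xa (-‿cong Xb)) c
            in near⇒P m a≢b l l′

          τ-exists : ∃ λ τ → 1 ℕ.≤ k → σ * τ ≈ 1#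
          τ-exists with 1 ℕ.≤? k
          ... | no 1≰k = 0# , λ 1≤k → contradiction 1≤k 1≰k
          ... | yes 1≤k = let (τ , e) = inverse σ σ≰0 in τ , λ _ → e
            where
            σ≰0 : ¬ σ ≤ 0#
            σ≰0 h = fromℕ-pos 1≤k (≤-trans k≤2σ (≤-respʳ (+-identityˡ 0#) (+-mono-≤ h h)))

          σ+σ≈ : σ + σ ≈ s * ℓ + s * ℓ
          σ+σ≈ = +-cong σ≈sℓ σ≈sℓ

          module _ (h : ℕ) (2h≤k : h ℕ.+ h ℕ.≤ k) (k≤2h+1 : k ℕ.≤ suc (h ℕ.+ h)) where

            τ : Carrier
            τ = proj₁ τ-exists

            σ*τ≈1 : 1 ℕ.≤ k → σ * τ ≈ 1#
            σ*τ≈1 = proj₂ τ-exists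

            value : Carrier
            value = Pairs.limit k h k≤2σ 2σ<k+1 2h≤k k≤2h+1 τ σ*τ≈1

            F-converges : ∀ ε → ¬ ε ≤ 0# → ∃ λ M → ∀ n → M ℕ.≤ suc n → (¬ ε ≤ F n - value) × (¬ ε ≤ value - F n)
            F-converges ε ε≰0 =
              let (M , conv) = Pairs.convergence k h k≤2σ 2σ<k+1 2h≤k k≤2h+1 τ σ*τ≈1 ε ε≰0 in
              M , λ n M≤N → conv n (F n) M≤N (trans (F-spec n) (≡⇒≈ (≡.cong fromℕ
                (Pairs.count-odd k h k≤2σ 2σ<k+1 2h≤k k≤2h+1 τ σ*τ≈1 n (P⇒Close n) (Close⇒P n)))))

            value-zero : k ≡ 0 → value ≈ 0#
            value-zero = Pairs.limit-zero k h k≤2σ 2σ<k+1 2h≤k k≤2h+1 τ σ*τ≈1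

            value-formula : ∀ {a b} → 2 ℕ.* Σ< k (weight h) ≡ a → 8 ℕ.* Σ< k (slope h) ≡ b →
                            1 ℕ.≤ k → Formula s value a b
            value-formula ea eb 1≤k = formula λ w e → Pairs.limit-formula k h k≤2σ 2σ<k+1 2h≤k k≤2h+1 τ σ*τ≈1 1≤k ea eb
              (trans (*-cong refl (*-cong refl σ≈sℓ)) e)

        result : Result s F
        result = [ even , odd ]′ (halves k)
          where
          even : (∃ λ h → k ≡ h ℕ.+ h) → Result s F
          even (h , e) = record
            { value = value h ≤k k≤ ; k = k ; k≤2sℓ = ≤-respʳ σ+σ≈ k≤2σ ; 2sℓ<k+1 = λ l → 2σ<k+1 (≤-respʳ (sym σ+σ≈) l)
            ; converges = F-converges h ≤k k≤ ; k≡0⇒0 = value-zero h ≤k k≤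
            ; odd = λ {h′} e′ → contradiction (≡.trans (≡.sym e) e′) (h+h≢h+1+h h h′)
            ; even = λ _ → value-formula h ≤k k≤
                (≡.subst (λ k → 2 ℕ.* Σ< k (weight h) ≡ 3 ℕ.* k) (≡.sym e) (2*weights-even h))
                (≡.subst (λ k → 8 ℕ.* Σ< k (slope h) ≡ 3 ℕ.* k ℕ.^ 2 ℕ.+ 2 ℕ.* k) (≡.sym e) (8*slopes-even h)) }
            where
            ≤k = ℕP.≤-reflexive (≡.sym e)
            k≤ = ℕP.≤-trans (ℕP.≤-reflexive e) (ℕP.n≤1+n (h ℕ.+ h))
          odd : (∃ λ h → k ≡ h ℕ.+ suc h) → Result s F
          odd (h , e) = record
            { value = value h ≤k k≤ ; k = k ; k≤2sℓ = ≤-respʳ σ+σ≈ k≤2σ ; 2sℓ<k+1 = λ l → 2σ<k+1 (≤-respʳ (sym σ+σ≈) l)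
            ; converges = F-converges h ≤k k≤ ; k≡0⇒0 = value-zero h ≤k k≤
            ; even = λ {h′} e′ → contradiction (≡.trans (≡.sym e′) e) (h+h≢h+1+h h′ h)
            ; odd = λ _ → value-formula h ≤k k≤
                (≡.subst (λ k → 2 ℕ.* Σ< k (weight h) ≡ 3 ℕ.* k ℕ.+ 1) (≡.sym e) (2*weights-odd h))
                (≡.subst (λ k → 8 ℕ.* Σ< k (slope h) ≡ 3 ℕ.* k ℕ.^ 2 ℕ.+ 4 ℕ.* k ℕ.+ 1) (≡.sym e) (8*slopes-odd h)) }
            where
            ≤k = ℕP.≤-trans (ℕP.+-monoʳ-≤ h (ℕP.n≤1+n h)) (ℕP.≤-reflexive (≡.sym e))
            k≤ = ℕP.≤-reflexive (≡.trans e (ℕP.+-suc h h))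

-- Bounds and the doubling formula for the logarithm, from its Riemann sums.

module Logarithms where

  open import Defs
  open OrderedFields
  open RealField
  open import Data.Integer as ℤ using (ℤ; +_; 1ℤ)
  open import Data.Nat as ℕ using (ℕ; suc; z≤n; s≤s)
  import Data.Nat.Properties as ℕP
  open import Data.Product using (∃; _×_; _,_; proj₁; proj₂)
  open import Data.Rational as ℚ using (ℚ; 0ℚ; 1ℚ; ½)
  import Data.Rational.Properties as ℚP
  import Data.Integer.Properties as ℤP

  import Data.Rational.Solver as ℚSolver
  open import Relation.Binary.PropositionalEquality
  open import Relation.Nullary using (¬_)
  open ℚSolver.+-*-Solver using (solve; _:+_; _:*_; _:-_; :-_; _:=_; con)

  record Quotient (q a b : ℝ) : Set where
    constructor mkQuotient
    field
      *-quotient : q * b ≋ a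

  record Shift (y z : ℝ) (i : ℤ) : Set where
    constructor mkShift
    field
      shifted : y ≋ z - fromℤ i

  -- The hypotheses are equations between rational sequences, with `r` the sequence of the inverse,
  -- because division is defined by a case distinction. From the index at which b stays away from 0,
  -- the product of `r` and b is exactly 1.
  quotient-seq : ∀ {q a b} (r : ℕ → ℚ) → 0ℝ < b → (∀ n → seq q n ≡ seq a n ℚ.* r n) →
                 (∀ n → r n ≡ Rational.recip (seq b n)) → Quotient q a b
  quotient-seq {q} {a} {b} r 0<b e e′ = mkQuotient (eventually-≡⇒≋ {q * b} {a} (proj₁ (proj₂ (proj₂ 0<b))) λ n N≤n →
    trans (cong (ℚ._* seq b n) (trans (e n) (cong (seq a n ℚ.*_) (e′ n))))
      (trans (solve 3 (λ a r b → a :* r :* b := a :* (b :* r)) refl (seq a n) (Rational.recip (seq b n)) (seq b n))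
        (trans (cong (seq a n ℚ.*_) (Rational.recip-inverse (positive⇒≢0 b 0<b n N≤n))) (ℚP.*-identityʳ (seq a n)))))

  quotient-seq′ : ∀ {q a b} (r : ℕ → ℚ) → 0ℝ < b → (∀ n → seq q n ≡ 1ℚ ℚ.* r n ℚ.* seq a n) →
                  (∀ n → r n ≡ Rational.recip (seq b n)) → Quotient q a b
  quotient-seq′ {q} {a} {b} r 0<b e = quotient-seq {q} {a} {b} r 0<b
    (λ n → trans (e n) (trans (cong (ℚ._* seq a n) (ℚP.*-identityˡ (r n))) (ℚP.*-comm (r n) (seq a n))))

  ∣∣≲ : ∀ {x r} → x ≲ r → - x ≲ r → ∣ x ∣ ≲ r
  ∣∣≲ {x} {r} h k = mk≲ {∣ x ∣} {r} λ ε 0<ε → let (M , hM) = eventually h ε 0<ε ; (N , kN) = eventually k ε 0<ε in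
    M ℕ.⊔ N , λ n p → Rational.∣p∣≤ (hM n (ℕP.m⊔n≤o⇒m≤o M N p)) (kN n (ℕP.m⊔n≤o⇒n≤o M N p))

  ≲∣∣ : ∀ x → x ≲ ∣ x ∣
  ≲∣∣ x = eventually-≤⇒≲ {x} {∣ x ∣} 0 λ n _ → Rational.p≤∣p∣ (seq x n)

  -≲∣∣ : ∀ x → - x ≲ ∣ x ∣
  -≲∣∣ x = eventually-≤⇒≲ { - x} {∣ x ∣} 0 λ n _ →
    subst (ℚ.- seq x n ℚ.≤_) (ℚP.∣-p∣≡∣p∣ (seq x n)) (Rational.p≤∣p∣ (ℚ.- seq x n))

  record IsFloor (z : ℝ) (i : ℤ) : Set where
    constructor mkFloor
    field
      lower : fromℤ i ≲ z
      upper : ¬ fromℤ (i ℤ.+ 1ℤ) ≲ z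

  record Rounding (z y : ℝ) (i : ℤ) : Set where
    constructor mkRounding
    field
      rounding : y ≋ ∣ z - fromℤ i ∣
      isFloor  : IsFloor (z + fromℚ ½) i

  isFloor-exists : ∀ {z} (i : ∃ λ i → fromℤ i ≤ z × z < fromℤ (i ℤ.+ 1ℤ)) → IsFloor z (proj₁ i)
  isFloor-exists (i , h , k) = mkFloor (wrap h) (λ l → unwrap l k)

  0<fromℕ : ∀ n → 0ℝ < fromℕ (suc n)
  0<fromℕ n = 1ℚ , ℚP.positive⁻¹ 1ℚ , 0 , λ _ _ → Rational./-monoˡ-≤ {+ 1} {+ suc n} 1 (ℤ.+≤+ (s≤s z≤n))

  -- Since `suc (m + c * suc m)` is (c + 1)(m + 1), this evaluates the crude bound t (m + 1) / ((c +
  -- 1)(m + 1)) for a block of t (m + 1) harmonic terms.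
  *1/-cancel : ∀ t c m → + suc c ℚ./ 1 ℚ.* (+ (t ℕ.* suc m) ℚ./ 1 ℚ.* (+ 1 ℚ./ suc (m ℕ.+ c ℕ.* suc m))) ≡ + t ℚ./ 1
  *1/-cancel t c m = begin
    C ℚ.* (+ (t ℕ.* suc m) ℚ./ 1 ℚ.* r)     ≡⟨ cong (λ q → C ℚ.* (q ℚ.* r)) (trans (cong (ℚ._/ 1) (ℤP.pos-* t (suc m))) (/1-* (+ t) (+ suc m))) ⟩
    C ℚ.* (T ℚ.* M ℚ.* r)                   ≡⟨ solve 4 (λ c t m r → c :* (t :* m :* r) := t :* (c :* (m :* r))) refl C T M r ⟩
    T ℚ.* (C ℚ.* (M ℚ.* r))                 ≡⟨ cong (λ q → T ℚ.* (C ℚ.* q)) (Rational.n*1/mn≡1/m c m) ⟩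
    T ℚ.* (C ℚ.* (+ 1 ℚ./ suc c))           ≡⟨ cong (λ n → T ℚ.* (C ℚ.* (+ 1 ℚ./ suc n))) (sym (ℕP.+-identityʳ c)) ⟩
    T ℚ.* (C ℚ.* (+ 1 ℚ./ suc (c ℕ.+ 0)))   ≡⟨ cong (T ℚ.*_) (Rational.n*1/mn≡1/m 0 c) ⟩
    T ℚ.* 1ℚ                                ≡⟨ ℚP.*-identityʳ T ⟩
    T                                       ∎
    where
    open ≡-Reasoning
    C = + suc c ℚ./ 1
    T = + t ℚ./ 1
    M = + suc m ℚ./ 1
    r = + 1 ℚ./ suc (m ℕ.+ c ℕ.* suc m)

  fromℕ-nonNeg : ∀ c → 0ℚ ℚ.≤ + c ℚ./ 1
  fromℕ-nonNeg c = Rational./-monoˡ-≤ {+ 0} {+ c} 1 (ℤ.+≤+ z≤n)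

  -- The Riemann sum of mesh 1 / (m + 1) for the larger logarithm extends the one for the smaller.
  -- What remains starts with the term 1 / ((c + 1)(m + 1)).
  log-block : ∀ c t m → seq (log (suc c ℕ.+ t)) m ℚ.- seq (log (suc c)) m ≡
                        Rational.harmonic (m ℕ.+ c ℕ.* suc m) (t ℕ.* suc m)
  log-block c t m = begin
    harmonic m ((c ℕ.+ t) ℕ.* suc m) ℚ.- harmonic m (c ℕ.* suc m)
      ≡⟨ cong (λ n → harmonic m n ℚ.- harmonic m (c ℕ.* suc m)) (ℕP.*-distribʳ-+ (suc m) c t) ⟩
    harmonic m (c ℕ.* suc m ℕ.+ t ℕ.* suc m) ℚ.- harmonic m (c ℕ.* suc m)
      ≡⟨ cong (ℚ._- harmonic m (c ℕ.* suc m)) (Rational.harmonic-+ m (c ℕ.* suc m) (t ℕ.* suc m)) ⟩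
    harmonic m (c ℕ.* suc m) ℚ.+ harmonic (c ℕ.* suc m ℕ.+ m) (t ℕ.* suc m) ℚ.- harmonic m (c ℕ.* suc m)
      ≡⟨ solve 2 (λ p q → p :+ q :- p := q) refl (harmonic m (c ℕ.* suc m)) (harmonic (c ℕ.* suc m ℕ.+ m) (t ℕ.* suc m)) ⟩
    harmonic (c ℕ.* suc m ℕ.+ m) (t ℕ.* suc m)
      ≡⟨ cong (λ a → harmonic a (t ℕ.* suc m)) (ℕP.+-comm (c ℕ.* suc m) m) ⟩
    harmonic (m ℕ.+ c ℕ.* suc m) (t ℕ.* suc m) ∎
    where
    open ≡-Reasoning
    open Rational using (harmonic)

  -- Each of the t (m + 1) terms of the block is at most the first one, so the bound holds at every
  -- stage of the sequence.
  log-upper : ∀ c t → fromℕ (suc c) * (log (suc c ℕ.+ t) - log (suc c)) ≲ fromℕ t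
  log-upper c t = eventually-≤⇒≲ {fromℕ (suc c) * (log (suc c ℕ.+ t) - log (suc c))} {fromℕ t} 0 λ m _ →
    subst₂ ℚ._≤_ (cong (+ suc c ℚ./ 1 ℚ.*_) (sym (log-block c t m))) (*1/-cancel t c m)
      (ℚP.*-monoˡ-≤-nonNeg (+ suc c ℚ./ 1) {{ℚ.nonNegative (fromℕ-nonNeg (suc c))}}
        (Rational.harmonic-≤ (m ℕ.+ c ℕ.* suc m) (t ℕ.* suc m) (m ℕ.+ c ℕ.* suc m) ℕP.≤-refl))

  -- Each term of the block is at least the one that would follow it, 1 / ((c + t + 1)(m + 1)).
  log-lower : ∀ c t → fromℕ t ≲ fromℕ (suc c ℕ.+ t) * (log (suc c ℕ.+ t) - log (suc c))
  log-lower c t = eventually-≤⇒≲ {fromℕ t} {fromℕ (suc c ℕ.+ t) * (log (suc c ℕ.+ t) - log (suc c))} 0 λ m _ →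
    subst₂ ℚ._≤_ (*1/-cancel t (c ℕ.+ t) m) (cong (+ suc (c ℕ.+ t) ℚ./ 1 ℚ.*_) (sym (log-block c t m)))
      (ℚP.*-monoˡ-≤-nonNeg (+ suc (c ℕ.+ t) ℚ./ 1) {{ℚ.nonNegative (fromℕ-nonNeg (suc (c ℕ.+ t)))}}
        (Rational.harmonic-≥ (m ℕ.+ c ℕ.* suc m) (t ℕ.* suc m) (m ℕ.+ (c ℕ.+ t) ℕ.* suc m)
          (ℕP.m≤n⇒m≤1+n (ℕP.≤-reflexive (trans (ℕP.+-assoc m (c ℕ.* suc m) (t ℕ.* suc m)) (cong (m ℕ.+_) (sym (ℕP.*-distribʳ-+ (suc m) c t))))))))

  -- The block between c + 1 and 2 (c + 1) is also the Riemann sum for log 2 with a mesh c + 1 times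
  -- finer. Refinement decreases a left Riemann sum by at most 1 / (m + 1), which tends to 0.
  log-double : ∀ c → log (2 ℕ.* suc c) ≋ log (suc c) + log 2
  log-double c = le , ge
    where
    open Rational using (harmonic)
    block : ∀ m → seq (log (2 ℕ.* suc c)) m ℚ.- seq (log (suc c)) m ≡ harmonic (c ℕ.+ m ℕ.* suc c) (suc m ℕ.* suc c)
    block m = trans (log-block c (suc c ℕ.+ 0) m) (cong₂ harmonic
      (trans (cong (m ℕ.+_) (ℕP.*-suc c m)) (trans (sym (ℕP.+-assoc m c _))
        (trans (cong₂ ℕ._+_ (ℕP.+-comm m c) (ℕP.*-comm c m)) (trans (ℕP.+-assoc c m _) (cong (c ℕ.+_) (sym (ℕP.*-suc m c)))))))
      (trans (cong (ℕ._* suc m) (ℕP.+-identityʳ (suc c))) (ℕP.*-comm (suc c) (suc m))))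
    split : ∀ m → seq (log (2 ℕ.* suc c)) m ≡ seq (log (suc c)) m ℚ.+ harmonic (c ℕ.+ m ℕ.* suc c) (suc m ℕ.* suc c)
    split m = trans (solve 2 (λ p q → p := q :+ (p :- q)) refl (seq (log (2 ℕ.* suc c)) m) (seq (log (suc c)) m))
      (cong (seq (log (suc c)) m ℚ.+_) (block m))
    log2 : ∀ m → harmonic m (suc m) ≡ seq (log 2) m
    log2 m = cong (harmonic m) (sym (ℕP.*-identityˡ (suc m)))
    le : log (2 ℕ.* suc c) ≲ log (suc c) + log 2
    le = eventually-≤⇒≲ {log (2 ℕ.* suc c)} {log (suc c) + log 2} 0 λ m _ →
      subst₂ ℚ._≤_ (sym (split m)) (cong (seq (log (suc c)) m ℚ.+_) (log2 m))
        (ℚP.+-monoʳ-≤ (seq (log (suc c)) m) (Rational.refine-≤ m (suc m) c))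
    finer : ℕ → ℚ
    finer m = harmonic (c ℕ.+ m ℕ.* suc c) (suc m ℕ.* suc c)
    lower : ∀ m → harmonic m (suc m) ℚ.≤ finer m ℚ.+ (+ 1 ℚ./ suc m)
    lower m = ℚP.≤-trans (p≤p+ε (harmonic m (suc m)) (Rational.1/sucn>0 (m ℕ.+ suc m))) (Rational.refine-≥ m (suc m) c)
    ge : log (suc c) + log 2 ≲ log (2 ℕ.* suc c)
    ge = mk≲ {log (suc c) + log 2} {log (2 ℕ.* suc c)} λ ε 0<ε →
      let (N , h) = Rational.archimedean 0<ε in N , λ m N≤m →
      subst₂ ℚ._≤_ (cong (seq (log (suc c)) m ℚ.+_) (log2 m))
        (trans (sym (ℚP.+-assoc (seq (log (suc c)) m) (finer m) ε)) (cong (ℚ._+ ε) (sym (split m))))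
        (ℚP.+-monoʳ-≤ (seq (log (suc c)) m) (ℚP.≤-trans (lower m)
          (ℚP.+-monoʳ-≤ (finer m) (ℚP.≤-trans (Rational.1/-antimono N≤m) h))))

-- Transfer of the count to the real sequence, and the cases of the formula.

module LogarithmicSequence where

  open import Defs
  open OrderedFields
  open RealField
  open FiniteSums
  open PairCounting
  open Logarithms
  open import Axiom.ExcludedMiddle using (ExcludedMiddle)
  open import Data.Empty using (⊥; ⊥-elim)
  open import Data.Integer as ℤ using (ℤ; +_; 1ℤ)
  open import Data.Nat as ℕ using (ℕ; suc; z≤n; _∸_)
  import Data.Nat.Properties as ℕP
  open import Data.Nat.Divisibility using (_∣_; divides)
  open import Data.Product using (∃; _×_; _,_; proj₁; proj₂)
  open import Data.Rational as ℚ using (ℚ; 1ℚ; ½)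
  open import Data.List using (map; filter; length; upTo; cartesianProduct)
  import Data.Rational.Properties as ℚP
  import Data.Rational.Solver as ℚSolver
  open import Data.Sum using (_⊎_; inj₁; inj₂; [_,_]′)
  open import Level using (0ℓ)
  open import Relation.Binary.PropositionalEquality
  open import Relation.Nullary using (¬_; Dec; yes; no; contradiction)

  open ℚSolver.+-*-Solver using (solve; _:+_; _:*_; _:-_; :-_; _:=_; con)

  -- The proofs (λ _ → refl) compare sequences only, whereas a conversion of real numbers would also compare Cauchy moduli.
  cast≲ : ∀ {x y x′ y′} → (∀ n → seq x n ≡ seq x′ n) → (∀ n → seq y n ≡ seq y′ n) → x ≲ y → x′ ≲ y′
  cast≲ {x} {y} {x′} {y′} ex ey h = ≲-trans {x′} {x} {y′} (≋⇒≳ (pointwise {x} {x′} ex))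
    (≲-trans {x} {y} {y′} h (≋⇒≲ (pointwise {y} {y′} ey)))

  recast≲ : ∀ {x y x′ y′} → x ≲ y → (∀ n → seq x n ≡ seq x′ n) → (∀ n → seq y n ≡ seq y′ n) → x′ ≲ y′
  recast≲ {x} {y} {x′} {y′} h ex ey = cast≲ {x} {y} {x′} {y′} ex ey h

  cast≋ : ∀ {x y x′ y′} → (∀ n → seq x n ≡ seq x′ n) → (∀ n → seq y n ≡ seq y′ n) → x ≋ y → x′ ≋ y′
  cast≋ {x} {y} {x′} {y′} ex ey (h , k) = cast≲ {x} {y} {x′} {y′} ex ey h , cast≲ {y} {x} {y′} {x′} ey ex k

  record Near (a L ε : ℝ) : Set where
    constructor mkNear
    field
      near : ∣ a - L ∣ < ε

  record Separated (a L ε : ℝ) : Set where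
    constructor mkSeparated
    field
      above : ¬ ε ≲ a - L
      below : ¬ ε ≲ L - a

  record Formula (L a w : ℝ) : Set where
    constructor mkFormula
    field
      equation : L ≋ a - w

  open Quotient
  open Shift
  open IsFloor
  open Rounding
  open Near
  open Separated
  open Formula

  recast≋ : ∀ {x y x′ y′} → x ≋ y → (∀ n → seq x n ≡ seq x′ n) → (∀ n → seq y n ≡ seq y′ n) → x′ ≋ y′
  recast≋ {x} {y} {x′} {y′} h ex ey = cast≋ {x} {y} {x′} {y′} ex ey h

  record NearInteger (z r : ℝ) : Set where
    constructor mkNearInteger
    field
      integer : ℤ
      z-m≲r   : z - fromℤ integer ≲ r
      m-z≲r   : fromℤ integer - z ≲ r

  record Spec (s : ℝ) (f : ℕ → ℝ) (L : ℝ) : Set where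
    field
      k         : ℕ
      k≲        : fromℕ k ≲ s * log 2 + s * log 2
      k+1≴      : ¬ fromℕ (suc k) ≲ s * log 2 + s * log 2
      converges : ∀ ε → ¬ ε ≲ 0ℝ → ∃ λ M → ∀ n → M ℕ.≤ suc n → Separated (f n) L ε
      k≡0⇒0     : k ≡ 0 → L ≋ 0ℝ
      even      : ∀ {h} → k ≡ h ℕ.+ h → ∀ w → 1 ℕ.≤ k →
                  Quotient w (fromℕ (3 ℕ.* k ℕ.^ 2 ℕ.+ 2 ℕ.* k)) (fromℕ 4 * log 2 * s) → Formula L (fromℕ (3 ℕ.* k)) w
      odd       : ∀ {h} → k ≡ h ℕ.+ suc h → ∀ w → 1 ℕ.≤ k →
                  Quotient w (fromℕ (3 ℕ.* k ℕ.^ 2 ℕ.+ 4 ℕ.* k ℕ.+ 1)) (fromℕ 4 * log 2 * s) →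
                  Formula L (fromℕ (3 ℕ.* k ℕ.+ 1)) w

  module Main (em : ExcludedMiddle 0ℓ) where

    field-ℝ : OrderedField
    field-ℝ = ℝ-orderedField em

    -- The case distinction in the definition of the inverse is resolved here, on sequences.
    seq-⁻¹ : ∀ x → 0ℝ < ∣ x ∣ → ∀ n → seq (Classical._⁻¹ em x) n ≡ Rational.recip (seq x n)
    seq-⁻¹ x x≠0 n with em {0ℝ < ∣ x ∣}
    ... | yes _ = refl
    ... | no ¬h = contradiction x≠0 ¬h

    quotient : ∀ a b → 0ℝ < b → Quotient (Classical._/_ em a b) a b
    quotient a b 0<b = quotient-seq _ 0<b (λ n → refl) (seq-⁻¹ b (0<x⇒0<∣x∣ {b} 0<b))

    x-shift : ∀ k → Shift (Classical.x em k) (Classical._/_ em (log (2 ℕ.* k ∸ 1)) (log 2))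
                          (Classical.⌊_⌋ em (Classical._/_ em (log (2 ℕ.* k ∸ 1)) (log 2)))
    x-shift k = mkShift (pointwise {_} {_} (λ n → refl))

    ⌊⌋-isFloor : ∀ z → IsFloor z (Classical.⌊_⌋ em z)
    ⌊⌋-isFloor z = isFloor-exists (Classical.floor-exists em z)

    ‖‖-rounding : ∀ z → Rounding z (Classical.‖_‖ em z) (Classical.⌊_⌋ em (z + fromℚ ½))
    ‖‖-rounding z = mkRounding (pointwise {_} {_} (λ n → refl)) (⌊⌋-isFloor _)

    F-seq : ∀ N s m → seq (Classical.F em N s) m ≡
            1ℚ ℚ.* seq (Classical._⁻¹ em (fromℕ N)) m ℚ.* seq (fromℕ (Classical.pairCount em N s)) m
    F-seq N s m = refl

    F-quotient : ∀ N s → 0ℝ < fromℕ N →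
                 Quotient (Classical.F em N s) (fromℕ (Classical.pairCount em N s)) (fromℕ N)
    F-quotient N s 0<N = quotient-seq′ _ 0<N (F-seq N s) (seq-⁻¹ (fromℕ N) (0<x⇒0<∣x∣ {fromℕ N} 0<N))

    Pair : ℕ → ℝ → ℕ × ℕ → Set
    Pair N s p = proj₁ p ≢ proj₂ p ×
      Classical.‖_‖ em (Classical.x em (proj₁ p) - Classical.x em (proj₂ p)) ≤ Classical._/_ em s (fromℕ N)

    -- The decision procedure is local to `pairCount` and cannot be named; the existential lets
    -- unification recover it, and the indicator sum is then computed for an arbitrary procedure.
    pairCount-filter : ∀ N s → ∃ λ (P? : ∀ p → Dec (Pair N s p)) → Classical.pairCount em N s ≡
      length (filter P? (cartesianProduct (map suc (upTo N)) (map suc (upTo N))))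
    pairCount-filter N s = _ , refl

    ≴⇒≳ : ∀ {x y} → ¬ x ≲ y → y ≲ x
    ≴⇒≳ {x} {y} h = <⇒≲ {y} {x} (≴⇒> em {x} {y} h)

    round⇒near : ∀ {z y i r} → Rounding z y i → y ≲ r → ∃ λ m → (z - fromℤ m ≲ r) × (fromℤ m - z ≲ r)
    round⇒near {z} {y} {i} {r} ρ h = i
      , ≲-trans {z - fromℤ i} {∣ z - fromℤ i ∣} {r} (≲∣∣ (z - fromℤ i)) ∣∣≲r
      , cast≲ { - (z - fromℤ i)} {r} {fromℤ i - z} {r}
          (λ n → solve 2 (λ p q → :- (p :- q) := q :- p) refl (seq z n) (i ℚ./ 1)) (λ _ → refl)
          (≲-trans { - (z - fromℤ i)} {∣ z - fromℤ i ∣} {r} (-≲∣∣ (z - fromℤ i)) ∣∣≲r)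
      where
      ∣∣≲r : ∣ z - fromℤ i ∣ ≲ r
      ∣∣≲r = ≲-trans {∣ z - fromℤ i ∣} {y} {r} (≋⇒≳ (rounding {z} {y} {i} ρ)) h

    near⇒round : ∀ {z y i r} → Rounding z y i → ∀ m → z - fromℤ m ≲ r → fromℤ m - z ≲ r → y ≲ r
    near⇒round {z} {y} {i} {r} ρ m h k = ≲-trans {y} {∣ z - fromℤ i ∣} {r} (≋⇒≲ (rounding {z} {y} {i} ρ))
      (let ½+½≋1 = pointwise {fromℚ ½ + fromℚ ½} {fromℚ 1ℚ} (λ _ → refl)
           bounds = Counting.nearest em field-ℝ {z} {r} {fromℚ ½} {i} m
             (cast≋ {fromℚ ½ + fromℚ ½} {fromℚ 1ℚ} (λ _ → refl) (λ _ → refl) ½+½≋1)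
             (cast≲ {fromℤ i} {z + fromℚ ½} (λ _ → refl) (λ _ → refl) (lower {z + fromℚ ½} {i} (isFloor {z} {y} {i} ρ)))
             (cast≲ {z + fromℚ ½} {fromℤ (i ℤ.+ 1ℤ)} (λ _ → refl) (λ _ → refl)
               (≴⇒≳ {fromℤ (i ℤ.+ 1ℤ)} {z + fromℚ ½} (upper {z + fromℚ ½} {i} (isFloor {z} {y} {i} ρ))))
             (cast≲ {z - fromℤ m} {r} (λ _ → refl) (λ _ → refl) h)
             (cast≲ {fromℤ m - z} {r} (λ _ → refl) (λ _ → refl) k)
           z-i≲r = proj₁ bounds
           i-z≲r = proj₂ bounds
       in ∣∣≲ {z - fromℤ i} {r} (cast≲ (λ _ → refl) (λ _ → refl) z-i≲r)
            (cast≲ (λ n → solve 2 (λ p q → q :- p := :- (p :- q)) refl (seq z n) (i ℚ./ 1)) (λ _ → refl) i-z≲r))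

    ‖‖⇒near : ∀ z r → Classical.‖_‖ em z ≤ r → NearInteger z r
    ‖‖⇒near z r h = let (m , h₁ , h₂) = round⇒near (‖‖-rounding z) (wrap h) in mkNearInteger m h₁ h₂

    near⇒‖‖ : ∀ z r → NearInteger z r → Classical.‖_‖ em z ≲ r
    near⇒‖‖ z r (mkNearInteger m h k) = near⇒round (‖‖-rounding z) m h k

    -- The lower bound from 1 to 2 reads 1 ≤ 2 (log 2 - log 1), and the sequence of log 1 is
    -- constantly 0.
    log2≰0 : ¬ log 2 ≲ 0ℝ
    log2≰0 = FieldProperties.double≥1⇒≰0 field-ℝ {log 2} (recast≲ (log-lower 0 1) (λ _ → refl)
      (λ n → cong (+ 2 ℚ./ 1 ℚ.*_) (ℚP.+-identityʳ (seq (log 2) n))))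

    0<log2 : 0ℝ < log 2
    0<log2 = ≴⇒> em {log 2} {0ℝ} log2≰0

    log4≰0 : ¬ log 4 ≲ 0ℝ
    log4≰0 h = log2≰0 (≲-trans {log 2} {log 4} {0ℝ} log2≲log4 h)
      where
      log2≲2log2 : log 2 ≲ log 2 + log 2
      log2≲2log2 = cast≲ {0ℝ + log 2} {log 2 + log 2} {log 2} {log 2 + log 2}
        (λ n → ℚP.+-identityˡ (seq (log 2) n)) (λ _ → refl) (+-monoˡ-≲ (log 2) {0ℝ} {log 2} (≴⇒≳ {log 2} {0ℝ} log2≰0))
      log2≲log4 : log 2 ≲ log 4
      log2≲log4 = let 2log2≲log4 = ≋⇒≳ (log-double 1) in
        ≲-trans {log 2} {log 2 + log 2} {log 4} log2≲2log2 (recast≲ 2log2≲log4 (λ _ → refl) (λ _ → refl))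

    0<log4 : 0ℝ < log 4
    0<log4 = ≴⇒> em {log 4} {0ℝ} log4≰0

    X : ℕ → ℝ
    X a = Classical.x em (suc a)

    ratio : ℝ → ℕ → ℝ
    ratio s n = Classical._/_ em s (fromℕ (suc n))

    P : ℝ → ℕ → ℕ → ℕ → Set
    P s n a b = Pair (suc n) s (suc a , suc b)

    F : ℝ → ℕ → ℝ
    F s n = Classical.F em (suc n) s

    record Point (y u : ℝ) : Set where
      constructor mkPoint
      field
        {q}      : ℝ
        {i}      : ℤ
        quot     : Quotient q u (log 2)
        shift    : Shift y q i

    X-point : ∀ a → Point (X a) (log (2 ℕ.* suc a ∸ 1))
    X-point a = mkPoint (quotient _ _ 0<log2) (x-shift (suc a))

    F-count : ∀ s n → Quotient (F s n) (fromℕ (Classical.pairCount em (suc n) s)) (fromℕ (suc n))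
    F-count s n = F-quotient (suc n) s (0<fromℕ n)

    pairCount-Σ : ∀ N s → Classical.pairCount em N s ≡
      Σ< N (λ a → Σ< N (λ b → Indicator.ind em (Pair N s (suc a , suc b))))
    pairCount-Σ N s = trans (proj₂ (pairCount-filter N s))
      (Indicator.length-filter-pairs em (proj₁ (pairCount-filter N s)) N)

    pair⇒near : ∀ N s k l →
      Classical.‖_‖ em (Classical.x em k - Classical.x em l) ≤ Classical._/_ em s (fromℕ N) →
      NearInteger (Classical.x em k - Classical.x em l) (Classical._/_ em s (fromℕ N))
    pair⇒near N s k l h = ‖‖⇒near _ _ h

    near⇒pair : ∀ N s k l → NearInteger (Classical.x em k - Classical.x em l) (Classical._/_ em s (fromℕ N)) →
      Classical.‖_‖ em (Classical.x em k - Classical.x em l) ≲ Classical._/_ em s (fromℕ N)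
    near⇒pair N s k l h = let h′ = near⇒‖‖ _ _ h in h′

    log-isLogarithm : Counting.IsLogarithm em field-ℝ log
    log-isLogarithm = record
      { lg-upper  = λ c t → recast≲ (log-upper c t) (λ _ → refl) (λ _ → refl)
      ; lg-lower  = λ c t → recast≲ (log-lower c t) (λ _ → refl) (λ _ → refl)
      ; lg-double = λ c → recast≋ (log-double c) (λ _ → refl) (λ _ → refl)
      }

    open Counting.Logarithm using (module Result)

    module _ {σ : ℝ} {0≤σ : 0ℝ ≲ σ} {s : ℝ}
      (r : Counting.Logarithm.Result em field-ℝ log log-isLogarithm σ 0≤σ s (F s)) where

      private
        k≲ : fromℕ (Result.k r) ≲ s * log 2 + s * log 2
        k≲ = recast≲ (Result.k≤2sℓ r) (λ _ → refl) (λ _ → refl)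

        k+1≴ : ¬ fromℕ (suc (Result.k r)) ≲ s * log 2 + s * log 2
        k+1≴ h = Result.2sℓ<k+1 r (recast≲ h (λ _ → refl) (λ _ → refl))

        converges : ∀ ε → ¬ ε ≲ 0ℝ → ∃ λ M → ∀ n → M ℕ.≤ suc n → Separated (F s n) (Result.value r) ε
        converges ε ε≰0 = let (M , c) = Result.converges r ε ε≰0 in M , λ n p → mkSeparated
            (λ h → proj₁ (c n p) (recast≲ h (λ _ → refl) (λ _ → refl)))
            (λ h → proj₂ (c n p) (recast≲ h (λ _ → refl) (λ _ → refl)))

        k≡0⇒0 : Result.k r ≡ 0 → Result.value r ≋ 0ℝ
        k≡0⇒0 = Result.k≡0⇒0 r

        quotient-4sl : ∀ w a → Quotient w a (fromℕ 4 * log 2 * s) → w * (fromℕ 4 * (s * log 2)) ≋ a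
        quotient-4sl w a q = let e = *-quotient q
                                 e′ = FieldProperties.reassociate field-ℝ {w} {s} {log 2} {a}
                                        (recast≋ e (λ _ → refl) (λ _ → refl))
                             in recast≋ e′ (λ _ → refl) (λ _ → refl)

        transfer : ∀ {value a b} → Counting.Logarithm.Formula em field-ℝ log log-isLogarithm σ 0≤σ s value a b →
                   ∀ w → Quotient w (fromℕ b) (fromℕ 4 * log 2 * s) → Formula value (fromℕ a) w
        transfer {value} {a} {b} φ w q =
          let q′ = quotient-4sl w (fromℕ b) q
              e  = Counting.Logarithm.Formula.equation φ w (recast≋ q′ (λ _ → refl) (λ _ → refl))
          in mkFormula (recast≋ e (λ _ → refl) (λ _ → refl))

      spec : Spec s (F s) (Result.value r)
      spec = record
        { k = Result.k r ; k≲ = k≲ ; k+1≴ = k+1≴ ; converges = converges ; k≡0⇒0 = k≡0⇒0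
        ; even = λ {h} e w 1≤k → transfer (Result.even r {h} e 1≤k) w
        ; odd = λ {h} e w 1≤k → transfer (Result.odd r {h} e 1≤k) w }

    0≲log2 : 0ℝ ≲ log 2
    0≲log2 = ≴⇒≳ {log 2} {0ℝ} log2≰0

    0≲σ : ∀ {s} → 0ℝ ≲ s → 0ℝ ≲ s * log 2
    0≲σ {s} 0≲s = 0≲* {s} {log 2} 0≲s 0≲log2

    0≲2σ : ∀ {s} → 0ℝ ≲ s → 0ℝ ≲ s * log 2 + s * log 2
    0≲2σ {s} 0≲s = ≲-trans {0ℝ} {s * log 2} {s * log 2 + s * log 2} (0≲σ {s} 0≲s)
      (cast≲ {0ℝ + s * log 2} {s * log 2 + s * log 2} (λ n → ℚP.+-identityˡ (seq (s * log 2) n)) (λ _ → refl)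
        (+-monoˡ-≲ (s * log 2) {0ℝ} {s * log 2} (0≲σ {s} 0≲s)))

    floor-2σ : ∀ {s} → 0ℝ ≲ s → ∃ λ k → (fromℕ k ≲ s * log 2 + s * log 2) × ¬ (fromℕ (suc k) ≲ s * log 2 + s * log 2)
    floor-2σ {s} 0≲s = go (⌊⌋-isFloor (s * log 2 + s * log 2))
      where
      go : ∀ {i} → IsFloor (s * log 2 + s * log 2) i →
           ∃ λ k → (fromℕ k ≲ s * log 2 + s * log 2) × ¬ (fromℕ (suc k) ≲ s * log 2 + s * log 2)
      go {i} (mkFloor l u) =
        FieldProperties.natural-floor field-ℝ {s * log 2 + s * log 2} {i} (0≲2σ {s} 0≲s) l u

    module _ (s : ℝ) (0≲s : 0ℝ ≲ s) where

      private
        X-spec : ∀ a → ∃ λ q → ∃ λ i → (q * log 2 ≋ log (suc (2 ℕ.* a))) × (X a ≋ q - fromℤ i)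
        X-spec a = let p = X-point a
                       e = *-quotient (Point.quot p)
                       e′ = shifted (Point.shift p)
                   in Point.q p , Point.i p
                    -- The number `2 * suc a ∸ 1` reduces to `a + suc (a + 0)`, one step of `+-suc`
                    -- away from `suc (2 * a)`.
                    , recast≋ e (λ _ → refl) (λ n → cong (λ m → seq (log m) n) (ℕP.+-suc a (a ℕ.+ 0)))
                    , recast≋ e′ (λ _ → refl) (λ _ → refl)
        P⇒near : ∀ {n a b} → P s n a b → a ≢ b × NearInteger (Classical.x em (suc a) - Classical.x em (suc b)) (Classical._/_ em s (fromℕ (suc n)))
        P⇒near {n} {a} {b} (ne , h) = (λ e → ne (cong suc e)) , pair⇒near (suc n) s (suc a) (suc b) h

        near⇒P : ∀ {n a b} → a ≢ b → NearInteger (Classical.x em (suc a) - Classical.x em (suc b)) (Classical._/_ em s (fromℕ (suc n))) → P s n a b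
        near⇒P {n} {a} {b} ne h = (λ e → ne (ℕP.suc-injective e)) , (let h′ = near⇒pair (suc n) s (suc a) (suc b) h in unwrap h′)

      result : Counting.Logarithm.Result em field-ℝ log log-isLogarithm (s * log 2) (0≲σ {s} 0≲s) s (F s)
      result = Counting.Logarithm.result em field-ℝ log log-isLogarithm (s * log 2) (0≲σ {s} 0≲s)
        s (pointwise {s * log 2} (λ _ → refl)) log2≰0
        (proj₁ (floor-2σ {s} 0≲s))
        (recast≲ {fromℕ (proj₁ (floor-2σ {s} 0≲s))} {s * log 2 + s * log 2} (proj₁ (proj₂ (floor-2σ {s} 0≲s))) (λ _ → refl) (λ _ → refl))
        (λ h → proj₂ (proj₂ (floor-2σ {s} 0≲s)) (recast≲ h (λ _ → refl) (λ _ → refl)))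
        X
        (λ a → let (q , i , e , e′) = X-spec a in
          q , i , recast≋ e (λ _ → refl) (λ _ → refl) , recast≋ e′ (λ _ → refl) (λ _ → refl))
        (ratio s)
        (λ n → let e = *-quotient (quotient s (fromℕ (suc n)) (0<fromℕ n)) in recast≋ e (λ _ → refl) (λ _ → refl))
        (P s)
        (λ {n} {a} {b} pr → let (ne , mkNearInteger m h h′) = P⇒near {n} {a} {b} pr in
          ne , m , recast≲ h (λ _ → refl) (λ _ → refl) , recast≲ h′ (λ _ → refl) (λ _ → refl))
        (λ {n} {a} {b} m ne h h′ → near⇒P {n} {a} {b} ne
          (mkNearInteger m (recast≲ h (λ _ → refl) (λ _ → refl)) (recast≲ h′ (λ _ → refl) (λ _ → refl))))
        (F s)
        (λ n → let e = *-quotient (F-count s n) in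
          recast≋ e (λ _ → refl) (λ m → cong (λ c → + c ℚ./ 1) (pairCount-Σ (suc n) s)))

    separated⇒near : ∀ {a L ε} → Separated a L ε → Near a L ε
    separated⇒near {a} {L} {ε} (mkSeparated ε≴a-L ε≴L-a) = mkNear (≴⇒> em {ε} {∣ a - L ∣} (λ h → [ left h , right h ]′ (≲-total em a L)))
      where
      order : ∀ {a b} → a ≲ b → a - b ≲ b - a
      order {a} {b} h = ≲-trans {a - b} {a - a} {b - a}
        (cast≲ {a - b} {b - b} {a - b} {a - a} (λ _ → refl)
          (λ n → trans (ℚP.+-inverseʳ (seq b n)) (sym (ℚP.+-inverseʳ (seq a n)))) (+-monoˡ-≲ (- b) {a} {b} h))
        (+-monoˡ-≲ (- a) {a} {b} h)
      flip : ∀ a b → - (a - b) ≲ b - a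
      flip a b = ≋⇒≲ (pointwise { - (a - b)} {b - a} (λ n → solve 2 (λ p q → :- (p :- q) := q :- p) refl (seq a n) (seq b n)))
      left : ε ≲ ∣ a - L ∣ → a ≲ L → ⊥
      left h l = ε≴L-a (≲-trans {ε} {∣ a - L ∣} {L - a} h (∣∣≲ {a - L} {L - a} (order {a} {L} l) (flip a L)))
      right : ε ≲ ∣ a - L ∣ → L ≲ a → ⊥
      right h l = ε≴a-L (≲-trans {ε} {∣ a - L ∣} {a - L} h (∣∣≲ {a - L} {a - L} (≋⇒≲ (≋-refl {a - L}))
        (≲-trans { - (a - L)} {L - a} {a - L} (flip a L) (order {L} {a} l))))

    F-near : ∀ s L ε n → Separated (F s n) L ε → Near (Classical.F em (suc n) s) L ε
    F-near s L ε n h = separated⇒near {F s n} {L} {ε} h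

    F-⟶ : ∀ s L → (∀ ε → ¬ ε ≲ 0ℝ → ∃ λ M → ∀ n → M ℕ.≤ suc n → Separated (F s n) L ε) →
          (λ N → Classical.F em N s) ⟶ L
    -- The bound `suc M` excludes N = 0, the dummy index of F, so that N has the form `suc n`.
    F-⟶ s L c ε 0<ε = let (M , h) = c ε (λ z → unwrap z 0<ε) in suc M , λ where
      (suc n) p → let g = near (F-near s L ε n (h n (ℕP.≤-trans (ℕP.n≤1+n M) p))) in g

    -- Doubling at 2 gives log 4 = log 2 + log 2, so comparing a / log 4 with s amounts to comparing
    -- a with 2 s log 2. The breakpoints of the theorem are thus the integer values of 2 s log 2.
    quotient-≴ : ∀ {q a s} → Quotient q a (log 4) → ¬ q ≲ s → ¬ a ≲ s * log 2 + s * log 2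
    quotient-≴ {q} {a} {s} qu h l = let e = *-quotient qu in
      h (FieldProperties.quotient-≤⇐ field-ℝ {q} {a} {s} {log 2} {log 4}
        (recast≋ e (λ _ → refl) (λ _ → refl)) (recast≋ (log-double 1) (λ _ → refl) (λ _ → refl)) log4≰0
        (recast≲ l (λ _ → refl) (λ _ → refl)))

    quotient-≲ : ∀ {q a s} → Quotient q a (log 4) → q ≲ s → a ≲ s * log 2 + s * log 2
    quotient-≲ {q} {a} {s} qu h =
      let e = *-quotient qu
          l = FieldProperties.quotient-≤⇒ field-ℝ {q} {a} {s} {log 2} {log 4}
                (recast≋ e (λ _ → refl) (λ _ → refl)) (recast≋ (log-double 1) (λ _ → refl) (λ _ → refl))
                (≴⇒≳ {log 4} {0ℝ} log4≰0) h
      in recast≲ l (λ _ → refl) (λ _ → refl)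

    </log4⇒≴ : ∀ s j → s < Classical._/_ em (fromℕ j) (log 4) → ¬ fromℕ j ≲ s * log 2 + s * log 2
    </log4⇒≴ s j h = quotient-≴ {_} {fromℕ j} {s} (quotient (fromℕ j) (log 4) 0<log4) (λ l → unwrap l h)

    /log4≤⇒≲ : ∀ s j → Classical._/_ em (fromℕ j) (log 4) ≤ s → fromℕ j ≲ s * log 2 + s * log 2
    /log4≤⇒≲ s j h = quotient-≲ {_} {fromℕ j} {s} (quotient (fromℕ j) (log 4) 0<log4) (wrap h)

    0<4sl : ∀ s k → 1 ℕ.≤ k → fromℕ k ≲ s * log 2 + s * log 2 → 0ℝ < fromℕ 4 * log 2 * s
    0<4sl s k 1≤k h = ≴⇒> em {fromℕ 4 * log 2 * s} {0ℝ} (λ l →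
      FieldProperties.4ls≰0 field-ℝ {k} {s} {log 2} 1≤k (recast≲ h (λ _ → refl) (λ _ → refl)) (recast≲ l (λ _ → refl) (λ _ → refl)))

    -- It identifies the k quantified in a clause of the theorem with the integer part of 2 s log 2
    -- on which the count was based.
    k-unique : ∀ {s f L} (sp : Spec s f L) k → fromℕ k ≲ s * log 2 + s * log 2 → ¬ fromℕ (suc k) ≲ s * log 2 + s * log 2 →
               k ≡ Spec.k sp
    k-unique {s} sp k h h′ = FieldProperties.floor-unique field-ℝ {s * log 2 + s * log 2} {k} {Spec.k sp} h h′ (Spec.k≲ sp) (Spec.k+1≴ sp)

    even-formula : ∀ {s f L} (sp : Spec s f L) k → k ≡ Spec.k sp → 2 ∣ k → 1 ℕ.≤ k →
                   ∀ w → Quotient w (fromℕ (3 ℕ.* k ℕ.^ 2 ℕ.+ 2 ℕ.* k)) (fromℕ 4 * log 2 * s) → Formula L (fromℕ (3 ℕ.* k)) w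
    even-formula sp k refl (divides h e) 1≤k w q =
      Spec.even sp {h} (trans e (trans (ℕP.*-comm h 2) (cong (h ℕ.+_) (ℕP.+-identityʳ h)))) w 1≤k q

    odd-formula : ∀ {s f L} (sp : Spec s f L) k → k ≡ Spec.k sp → ¬ (2 ∣ k) → 1 ℕ.≤ k →
                  ∀ w → Quotient w (fromℕ (3 ℕ.* k ℕ.^ 2 ℕ.+ 4 ℕ.* k ℕ.+ 1)) (fromℕ 4 * log 2 * s) →
                  Formula L (fromℕ (3 ℕ.* k ℕ.+ 1)) w
    odd-formula {s} {f} {L} sp k refl 2∤k 1≤k w q = go (halves k)
      where
      go : (∃ λ h → k ≡ h ℕ.+ h) ⊎ (∃ λ h → k ≡ h ℕ.+ suc h) → Formula L (fromℕ (3 ℕ.* k ℕ.+ 1)) w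
      go (inj₁ (h , e)) = ⊥-elim (2∤k (divides h (trans e (trans (cong (h ℕ.+_) (sym (ℕP.+-identityʳ h))) (ℕP.*-comm 2 h)))))
      go (inj₂ (h , e)) = Spec.odd sp {h} e w 1≤k q

    formula⇒≈ : ∀ {L a w} → Formula L a w → L ≈ a - w
    formula⇒≈ {L} {a} {w} φ = unwrap {L} {a - w} (≋⇒≲ (equation {L} {a} {w} φ)) , unwrap {a - w} {L} (≋⇒≳ (equation {L} {a} {w} φ))

    suc≴ : ∀ s k → ¬ fromℕ (k ℕ.+ 1) ≲ s * log 2 + s * log 2 → ¬ fromℕ (suc k) ≲ s * log 2 + s * log 2
    suc≴ s k = subst (λ n → ¬ fromℕ n ≲ s * log 2 + s * log 2) (ℕP.+-comm k 1)

    zero-clause : ∀ s L → Spec s (F s) L → s < Classical._/_ em (fromℕ 1) (log 4) → L ≈ 0ℝ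
    zero-clause s L sp h = let e = Spec.k≡0⇒0 sp (sym (k-unique sp 0 0≲ (</log4⇒≴ s 1 h))) in
        unwrap {L} {0ℝ} (≋⇒≲ e) , unwrap {0ℝ} {L} (≋⇒≳ e)
      where
      0≲ : fromℕ 0 ≲ s * log 2 + s * log 2
      0≲ = ≲-trans {fromℕ 0} {fromℕ (Spec.k sp)} {s * log 2 + s * log 2}
        (FieldProperties.fromℕ-mono field-ℝ {0} {Spec.k sp} z≤n) (Spec.k≲ sp)

    even-clause : ∀ s L → Spec s (F s) L → ∀ k → 1 ℕ.≤ k → 2 ∣ k →
      Classical._/_ em (fromℕ k) (log 4) ≤ s → s < Classical._/_ em (fromℕ (k ℕ.+ 1)) (log 4) →
      L ≈ fromℕ (3 ℕ.* k) - Classical._/_ em (fromℕ (3 ℕ.* k ℕ.^ 2 ℕ.+ 2 ℕ.* k)) (fromℕ 4 * log 2 * s)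
    even-clause s L sp k 1≤k 2∣k h h′ =
      let k≲ = /log4≤⇒≲ s k h
          φ = even-formula sp k (k-unique sp k k≲ (suc≴ s k (</log4⇒≴ s (k ℕ.+ 1) h′))) 2∣k 1≤k _
                (quotient (fromℕ (3 ℕ.* k ℕ.^ 2 ℕ.+ 2 ℕ.* k)) (fromℕ 4 * log 2 * s) (0<4sl s k 1≤k k≲))
          e = formula⇒≈ φ
      in e

    odd-clause : ∀ s L → Spec s (F s) L → ∀ k → 1 ℕ.≤ k → ¬ (2 ∣ k) →
      Classical._/_ em (fromℕ k) (log 4) ≤ s → s < Classical._/_ em (fromℕ (k ℕ.+ 1)) (log 4) →
      L ≈ fromℕ (3 ℕ.* k ℕ.+ 1) - Classical._/_ em (fromℕ (3 ℕ.* k ℕ.^ 2 ℕ.+ 4 ℕ.* k ℕ.+ 1)) (fromℕ 4 * log 2 * s)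
    odd-clause s L sp k 1≤k 2∤k h h′ =
      let k≲ = /log4≤⇒≲ s k h
          φ = odd-formula sp k (k-unique sp k k≲ (suc≴ s k (</log4⇒≴ s (k ℕ.+ 1) h′))) 2∤k 1≤k _
                (quotient (fromℕ (3 ℕ.* k ℕ.^ 2 ℕ.+ 4 ℕ.* k ℕ.+ 1)) (fromℕ 4 * log 2 * s) (0<4sl s k 1≤k k≲))
          e = formula⇒≈ φ
      in e

    Conclusion : ℝ → ℝ → Set
    Conclusion s L =
      ((λ N → Classical.F em N s) ⟶ L) ×
      (s < Classical._/_ em (fromℕ 1) (log 4) → L ≈ 0ℝ) ×
      (∀ (k : ℕ) → 1 ℕ.≤ k → 2 ∣ k →
        Classical._/_ em (fromℕ k) (log 4) ≤ s → s < Classical._/_ em (fromℕ (k ℕ.+ 1)) (log 4) →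
        L ≈ fromℕ (3 ℕ.* k) - Classical._/_ em (fromℕ (3 ℕ.* k ℕ.^ 2 ℕ.+ 2 ℕ.* k)) (fromℕ 4 * log 2 * s)) ×
      (∀ (k : ℕ) → 1 ℕ.≤ k → ¬ (2 ∣ k) →
        Classical._/_ em (fromℕ k) (log 4) ≤ s → s < Classical._/_ em (fromℕ (k ℕ.+ 1)) (log 4) →
        L ≈ fromℕ (3 ℕ.* k ℕ.+ 1) - Classical._/_ em (fromℕ (3 ℕ.* k ℕ.^ 2 ℕ.+ 4 ℕ.* k ℕ.+ 1)) (fromℕ 4 * log 2 * s))

    conclusion : ∀ s L → Spec s (F s) L → Conclusion s L
    conclusion s L sp = F-⟶ s L (Spec.converges sp) , zero-clause s L sp , even-clause s L sp , odd-clause s L sp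

    theorem : ∀ s → 0ℝ ≤ s → ∃ λ L → Conclusion s L
    theorem s 0≤s = let r = result s (wrap 0≤s) in Result.value r , conclusion s (Result.value r) (spec r)

open import Defs
open import Axiom.ExcludedMiddle using (ExcludedMiddle)
open import Data.Nat using (ℕ)
open import Data.Nat.Divisibility using (_∣_)
open import Data.Product using (∃; _×_)
open import Level using (0ℓ)
open import Relation.Nullary using (¬_)
import Data.Nat as ℕ

theorem1p1 : (em : ExcludedMiddle 0ℓ) →
    let open Classical em in
    ∀ (s : ℝ) → 0ℝ ≤ s →
    ∃ λ (L : ℝ) →
    ((λ N → F N s) ⟶ L) ×
    (s < fromℕ 1 / log 4 → L ≈ 0ℝ) ×
    (∀ (k : ℕ) → 1 ℕ.≤ k → 2 ∣ k →
    fromℕ k / log 4 ≤ s → s < fromℕ (k ℕ.+ 1) / log 4 →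
    L ≈ fromℕ (3 ℕ.* k) - fromℕ (3 ℕ.* k ℕ.^ 2 ℕ.+ 2 ℕ.* k) / (fromℕ 4 * log 2 * s)) ×
    (∀ (k : ℕ) → 1 ℕ.≤ k → ¬ (2 ∣ k) →
    fromℕ k / log 4 ≤ s → s < fromℕ (k ℕ.+ 1) / log 4 →
    L ≈ fromℕ (3 ℕ.* k ℕ.+ 1) - fromℕ (3 ℕ.* k ℕ.^ 2 ℕ.+ 4 ℕ.* k ℕ.+ 1) / (fromℕ 4 * log 2 * s))
theorem1p1 = LogarithmicSequence.Main.theorem
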